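{- Let $n\ge3$, let $\gamma$ be a weak composition with $n$ parts and let $\tau\in S_n$. The permuted basement nonsymmetric polynomial $E_{\gamma,\tau}(x_1,\dots,x_n;q,t)$ is a simultaneous eigenfunction of the operators $Y_1^\tau,\dots,Y_n^\tau$; that is, for each $1\le i\le n$ there is a scalar $c\in\mathbb{Q}(q,t)$ with $Y_i^\tau E_{\gamma,\tau}=c\,E_{\gamma,\tau}$.
   Context: Operators. On $\mathbb{Q}(q,t)[x_1^{\pm1},\dots,x_n^{\pm1}]$ define, for $0<i<n$, $T_if=t\,(s_if)+(t-1)\frac{f-s_if}{1-x_i/x_{i+1}}$, where $s_i$ exchanges $x_i,x_{i+1}$, and $\pi f(x_1,\dots,x_n)=f(x_2,\dots,x_n,q^{ -1}x_1)$. Each $T_i$ is invertible (as $(T_i-t)(T_i+1)=0$). These are the actions of generators of the double affine Hecke algebra of type $A$ in Cherednik's representation. For $\tau\in S_n$ and $1\le i\le n$, $$Y_i^\tau=t^{\varepsilon_i^\tau}\,T_{i-1}^{\varepsilon_{i-1}}\cdots T_1^{\varepsilon_1}\,\pi\,T_{n-1}^{\varepsilon_{n-1}}\cdots T_i^{\varepsilon_i},$$ where $\varepsilon_j\in\{1,-1\}$ (depending on $i,\tau$) is given by: for $i\le j<n$, $\varepsilon_j=-1$ if $(i,j+1)$ form an inversion in $\tau$ and $\varepsilon_j=1$ otherwise; for $1\le j<i$, $\varepsilon_j=1$ if $(j,i)$ form an inversion in $\tau$ and $\varepsilon_j=-1$ otherwise; and $\varepsilon_i^\tau=|\{1\le j\le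 n-1:\varepsilon_j=-1\}|$. Here, for values $a<b$, "$(a,b)$ form an inversion in $\tau$" means that $b$ appears to the left of $a$ in the one-line notation $\tau(1)\cdots\tau(n)$, i.e. $\tau^{ -1}(a)>\tau^{ -1}(b)$. Diagrams. $\mathrm{dg}(\gamma)=\{(i,j):1\le i\le n,\ 1\le j\le\gamma_i\}$, $i$ indexing columns (left to right) and $j$ rows (bottom to top); $\widehat{\mathrm{dg}}(\gamma)$ adds the boxes $(i,0)$, $1\le i\le n$. For $u=(i,j)\in\mathrm{dg}(\gamma)$: $d(u)=(i,j-1)$, $l(u)=\gamma_i-j$, $\mathrm{arm}(u)=\{(i',j)\in\mathrm{dg}(\gamma):i'<i,\gamma_{i'}\le\gamma_i\}\sqcup\{(i',j-1)\in\widehat{\mathrm{dg}}(\gamma):i'>i,\gamma_{i'}<\gamma_i\}$, $a(u)=|\mathrm{arm}(u)|$. For a filling $\sigma\colon\mathrm{dg}(\gamma)\to[n]$, the augmented filling $\widehat\sigma^\tau\colon\widehat{\mathrm{dg}}(\gamma)\to[n]$ agrees with $\sigma$ on $\mathrm{dg}(\gamma)$ and has $\widehat\sigma^\tau((j,0))=\tau(j)$. Two boxes are attacking if they are in the same row, or they are in consecutive rows and the box in the higher row is strictly to the left of the box in the lower row. $\widehat\sigma^\tau$ is non-attacking if attacking boxes always have different entries. $\mathrm{maj}(\widehat\sigma^\tau)=\sum(l(u)+1)$ over $u\in\mathrm{dg}(\gamma)$ with $\widehat\sigma^\tau(u)>\widehat\sigma^\tau(d(u))$. A triple is $(u,v,w)$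 with $u\in\mathrm{dg}(\gamma)$, $w=d(u)$, $v\in\mathrm{arm}(u)$. With $\chi_{xy}=1$ if $\widehat\sigma^\tau(x)>\widehat\sigma^\tau(y)$ and $0$ otherwise, $\chi_{uv}+\chi_{vw}-\chi_{uw}\in\{0,1\}$, and the triple is a coinversion triple if this quantity is $0$; $\mathrm{Coinvtrip}(\widehat\sigma^\tau)$ is the number of coinversion triples. Definition: $$E_{\gamma,\tau}(\mathbf{x};q,t)=\sum_{\sigma}\mathbf{x}^\sigma q^{\mathrm{maj}(\widehat\sigma^\tau)}t^{\mathrm{Coinvtrip}(\widehat\sigma^\tau)}\prod_{\substack{u\in\mathrm{dg}(\gamma)\\ \widehat\sigma^\tau(u)\ne\widehat\sigma^\tau(d(u))}}\frac{1-t}{1-q^{l(u)+1}t^{a(u)+1}},$$ the sum over $\sigma\colon\mathrm{dg}(\gamma)\to[n]$ with $\widehat\sigma^\tau$ non-attacking, $\mathbf{x}^\sigma=\prod_{u\in\mathrm{dg}(\gamma)}x_{\sigma(u)}$. -}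

module Defs where

open import Algebra.Bundles using (CommutativeRing)
import Algebra.Properties.CommutativeSemigroup as CommutativeSemigroupProperties
import Algebra.Properties.Group as GroupProperties
import Algebra.Properties.Ring as RingProperties
import Algebra.Properties.Semiring.Exp as Exp
import Algebra.Solver.Ring.NaturalCoefficients.Default as Solver
open import Data.Bool.Base using (if_then_else_)
open import Data.Fin.Base as Fin using (Fin; zero; suc; toℕ; inject₁; fromℕ)
import Data.Fin.Permutation as Perm
open import Data.Fin.Permutation using (Permutation′; _⟨$⟩ʳ_; _⟨$⟩ˡ_)
import Data.Fin.Properties as Fin
open import Data.Integer.Base as ℤ using (ℤ; +_; -[1+_]; 0ℤ; 1ℤ)
import Data.Integer.Properties as ℤ
open import Data.List.Base using
  (List; []; _∷_; _++_; [_]; map; concatMap; filter; foldr; length; allFin; cartesianProductWith)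
open import Data.Nat.Base as ℕ using (ℕ; zero; suc; _∸_)
open import Data.Nat.ListAction using (sum)
import Data.Nat.Properties as ℕ
open import Data.Product.Base using (Σ-syntax; _×_; _,_; proj₁)
import Data.Rational.Base as ℚ
import Data.Rational.Properties as ℚ
open import Data.Sign.Base as Sign using (Sign)
import Data.Sign.Properties as Sign
open import Data.Sum.Base as Sum using (_⊎_; inj₁; inj₂; [_,_]′)
open import Data.Vec.Functional using (Vector)
open import Function.Base using (_∘_; flip)
open import Level using (_⊔_; 0ℓ)
open import Relation.Binary.Core using (Rel)
open import Relation.Binary.PropositionalEquality.Core as ≡ using (_≡_; _≢_)
open import Relation.Nullary.Decidable.Core
  using (Dec; yes; no; does; map′; _×-dec_; _⊎-dec_; _→-dec_; ¬?)
open import Relation.Nullary.Negation.Core using (¬_)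

------------------------------------------------------------------------
-- Integral domains

NoZeroDivisors : ∀ {c ℓ} → CommutativeRing c ℓ → Set (c ⊔ ℓ)
NoZeroDivisors R = ∀ x y → x * y ≈ 0# → x ≈ 0# ⊎ y ≈ 0#
  where open CommutativeRing R

Nontrivial : ∀ {c ℓ} → CommutativeRing c ℓ → Set ℓ
Nontrivial R = ¬ 1# ≈ 0#
  where open CommutativeRing R

ℚ-noZeroDivisors : NoZeroDivisors ℚ.+-*-commutativeRing
ℚ-noZeroDivisors x y xy≡0 with x ℚ.≟ ℚ.0ℚ
... | yes x≡0 = inj₁ x≡0
... | no  x≢0 = inj₂ (begin
  y                      ≡⟨ ℚ.*-identityˡ y ⟨
  ℚ.1ℚ ℚ.* y             ≡⟨ ≡.cong (ℚ._* y) (ℚ.*-inverseˡ x) ⟨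
  (ℚ.1/ x) ℚ.* x ℚ.* y   ≡⟨ ℚ.*-assoc (ℚ.1/ x) x y ⟩
  (ℚ.1/ x) ℚ.* (x ℚ.* y) ≡⟨ ≡.cong ((ℚ.1/ x) ℚ.*_) xy≡0 ⟩
  (ℚ.1/ x) ℚ.* ℚ.0ℚ      ≡⟨ ℚ.*-zeroʳ (ℚ.1/ x) ⟩
  ℚ.0ℚ                   ∎)
  where
  open import Relation.Binary.PropositionalEquality.Properties using (module ≡-Reasoning)
  open ≡-Reasoning
  instance
    x-nonZero : ℚ.NonZero x
    x-nonZero = ℚ.≢-nonZero x≢0

------------------------------------------------------------------------
-- The polynomial ring R[X]: a polynomial is the list of its coefficients,
-- constant coefficient first, trailing zeros being irrelevant.

module Polynomial {c ℓ} (R : CommutativeRing c ℓ) where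

  open CommutativeRing R
  open RingProperties ring using (-0#≈0#)
  open CommutativeSemigroupProperties +-commutativeSemigroup using (interchange)
  open import Relation.Binary.Reasoning.Setoid setoid

  Poly : Set c
  Poly = List Carrier

  coeff : Poly → ℕ → Carrier
  coeff []      _       = 0#
  coeff (a ∷ p) zero    = a
  coeff (a ∷ p) (suc k) = coeff p k

  infix 4 _≈ᴾ_

  record _≈ᴾ_ (p p′ : Poly) : Set ℓ where
    constructor mk≈
    field at : ∀ k → coeff p k ≈ coeff p′ k

  open _≈ᴾ_ public

  infixl 6 _+ᴾ_
  infixl 7 _*ᴾ_
  infixr 8 -ᴾ_

  0ᴾ 1ᴾ X : Poly
  0ᴾ = []
  1ᴾ = 1# ∷ []
  X  = 0# ∷ 1# ∷ []

  const : Carrier → Poly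
  const a = a ∷ []

  _+ᴾ_ : Poly → Poly → Poly
  []      +ᴾ p′       = p′
  (a ∷ p) +ᴾ []       = a ∷ p
  (a ∷ p) +ᴾ (b ∷ p′) = (a + b) ∷ (p +ᴾ p′)

  -ᴾ_ : Poly → Poly
  -ᴾ_ = map (-_)

  scale : Carrier → Poly → Poly
  scale a = map (a *_)

  _*ᴾ_ : Poly → Poly → Poly
  []      *ᴾ p′ = []
  (a ∷ p) *ᴾ p′ = scale a p′ +ᴾ (0# ∷ (p *ᴾ p′))

  coeff-+ : ∀ p p′ k → coeff (p +ᴾ p′) k ≈ coeff p k + coeff p′ k
  coeff-+ []      p′       k       = sym (+-identityˡ _)
  coeff-+ (a ∷ p) []       k       = sym (+-identityʳ _)
  coeff-+ (a ∷ p) (b ∷ p′) zero    = refl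
  coeff-+ (a ∷ p) (b ∷ p′) (suc k) = coeff-+ p p′ k

  coeff-neg : ∀ p k → coeff (-ᴾ p) k ≈ - coeff p k
  coeff-neg []      k       = sym -0#≈0#
  coeff-neg (a ∷ p) zero    = refl
  coeff-neg (a ∷ p) (suc k) = coeff-neg p k

  coeff-scale : ∀ a p k → coeff (scale a p) k ≈ a * coeff p k
  coeff-scale a []      k       = sym (zeroʳ a)
  coeff-scale a (b ∷ p) zero    = refl
  coeff-scale a (b ∷ p) (suc k) = coeff-scale a p k

  reflᴾ : ∀ {p} → p ≈ᴾ p
  reflᴾ .at k = refl

  symᴾ : ∀ {p r} → p ≈ᴾ r → r ≈ᴾ p
  symᴾ e .at k = sym (e .at k)

  transᴾ : ∀ {p r s} → p ≈ᴾ r → r ≈ᴾ s → p ≈ᴾ s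
  transᴾ e f .at k = trans (e .at k) (f .at k)

  +ᴾ-cong : ∀ {p p′ r r′} → p ≈ᴾ p′ → r ≈ᴾ r′ → p +ᴾ r ≈ᴾ p′ +ᴾ r′
  +ᴾ-cong {p} {p′} {r} {r′} e f .at k = begin
    coeff (p +ᴾ r) k        ≈⟨ coeff-+ p r k ⟩
    coeff p k + coeff r k   ≈⟨ +-cong (e .at k) (f .at k) ⟩
    coeff p′ k + coeff r′ k ≈⟨ coeff-+ p′ r′ k ⟨
    coeff (p′ +ᴾ r′) k      ∎

  +ᴾ-assoc : ∀ p r s → (p +ᴾ r) +ᴾ s ≈ᴾ p +ᴾ (r +ᴾ s)
  +ᴾ-assoc p r s .at k = begin
    coeff ((p +ᴾ r) +ᴾ s) k               ≈⟨ coeff-+ (p +ᴾ r) s k ⟩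
    coeff (p +ᴾ r) k + coeff s k          ≈⟨ +-congʳ (coeff-+ p r k) ⟩
    coeff p k + coeff r k + coeff s k     ≈⟨ +-assoc _ _ _ ⟩
    coeff p k + (coeff r k + coeff s k)   ≈⟨ +-congˡ (coeff-+ r s k) ⟨
    coeff p k + coeff (r +ᴾ s) k          ≈⟨ coeff-+ p (r +ᴾ s) k ⟨
    coeff (p +ᴾ (r +ᴾ s)) k               ∎

  +ᴾ-comm : ∀ p r → p +ᴾ r ≈ᴾ r +ᴾ p
  +ᴾ-comm p r .at k = begin
    coeff (p +ᴾ r) k      ≈⟨ coeff-+ p r k ⟩
    coeff p k + coeff r k ≈⟨ +-comm _ _ ⟩
    coeff r k + coeff p k ≈⟨ coeff-+ r p k ⟨
    coeff (r +ᴾ p) k      ∎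

  +ᴾ-identityʳ : ∀ p → p +ᴾ 0ᴾ ≈ᴾ p
  +ᴾ-identityʳ p = +ᴾ-comm p 0ᴾ

  -ᴾ-cong : ∀ {p r} → p ≈ᴾ r → -ᴾ p ≈ᴾ -ᴾ r
  -ᴾ-cong {p} {r} e .at k = begin
    coeff (-ᴾ p) k ≈⟨ coeff-neg p k ⟩
    - coeff p k    ≈⟨ -‿cong (e .at k) ⟩
    - coeff r k    ≈⟨ coeff-neg r k ⟨
    coeff (-ᴾ r) k ∎

  -ᴾ-inverseˡ : ∀ p → (-ᴾ p) +ᴾ p ≈ᴾ 0ᴾ
  -ᴾ-inverseˡ p .at k = begin
    coeff ((-ᴾ p) +ᴾ p) k      ≈⟨ coeff-+ (-ᴾ p) p k ⟩
    coeff (-ᴾ p) k + coeff p k ≈⟨ +-congʳ (coeff-neg p k) ⟩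
    - coeff p k + coeff p k    ≈⟨ -‿inverseˡ _ ⟩
    0#                         ∎

  scale-cong : ∀ {a b p r} → a ≈ b → p ≈ᴾ r → scale a p ≈ᴾ scale b r
  scale-cong {a} {b} {p} {r} e f .at k = begin
    coeff (scale a p) k ≈⟨ coeff-scale a p k ⟩
    a * coeff p k       ≈⟨ *-cong e (f .at k) ⟩
    b * coeff r k       ≈⟨ coeff-scale b r k ⟨
    coeff (scale b r) k ∎

  scale-+ᴾ : ∀ a p r → scale a (p +ᴾ r) ≈ᴾ scale a p +ᴾ scale a r
  scale-+ᴾ a p r .at k = begin
    coeff (scale a (p +ᴾ r)) k                ≈⟨ coeff-scale a (p +ᴾ r) k ⟩
    a * coeff (p +ᴾ r) k                      ≈⟨ *-congˡ (coeff-+ p r k) ⟩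
    a * (coeff p k + coeff r k)               ≈⟨ distribˡ a _ _ ⟩
    a * coeff p k + a * coeff r k             ≈⟨ +-cong (coeff-scale a p k) (coeff-scale a r k) ⟨
    coeff (scale a p) k + coeff (scale a r) k ≈⟨ coeff-+ (scale a p) (scale a r) k ⟨
    coeff (scale a p +ᴾ scale a r) k          ∎

  scale-scale : ∀ a b p → scale (a * b) p ≈ᴾ scale a (scale b p)
  scale-scale a b p .at k = begin
    coeff (scale (a * b) p) k     ≈⟨ coeff-scale (a * b) p k ⟩
    a * b * coeff p k             ≈⟨ *-assoc a b _ ⟩
    a * (b * coeff p k)           ≈⟨ *-congˡ (coeff-scale b p k) ⟨
    a * coeff (scale b p) k       ≈⟨ coeff-scale a (scale b p) k ⟨
    coeff (scale a (scale b p)) k ∎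

  scale-0 : ∀ p → scale 0# p ≈ᴾ 0ᴾ
  scale-0 p .at k = trans (coeff-scale 0# p k) (zeroˡ _)

  scale-1 : ∀ p → scale 1# p ≈ᴾ p
  scale-1 p .at k = trans (coeff-scale 1# p k) (*-identityˡ _)

  ∷-cong : ∀ {a b p r} → a ≈ b → p ≈ᴾ r → a ∷ p ≈ᴾ b ∷ r
  ∷-cong e f .at zero    = e
  ∷-cong e f .at (suc k) = f .at k

  0∷[]≈0 : 0# ∷ [] ≈ᴾ 0ᴾ
  0∷[]≈0 .at zero    = refl
  0∷[]≈0 .at (suc k) = refl

  +ᴾ-interchange : ∀ p r s u → (p +ᴾ r) +ᴾ (s +ᴾ u) ≈ᴾ (p +ᴾ s) +ᴾ (r +ᴾ u)
  +ᴾ-interchange p r s u .at k = begin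
    coeff ((p +ᴾ r) +ᴾ (s +ᴾ u)) k                      ≈⟨ expand p r s u ⟩
    (coeff p k + coeff r k) + (coeff s k + coeff u k)   ≈⟨ interchange _ _ _ _ ⟩
    (coeff p k + coeff s k) + (coeff r k + coeff u k)   ≈⟨ expand p s r u ⟨
    coeff ((p +ᴾ s) +ᴾ (r +ᴾ u)) k                      ∎
    where
    expand : ∀ p r s u → coeff ((p +ᴾ r) +ᴾ (s +ᴾ u)) k ≈
             (coeff p k + coeff r k) + (coeff s k + coeff u k)
    expand p r s u = trans (coeff-+ (p +ᴾ r) (s +ᴾ u) k) (+-cong (coeff-+ p r k) (coeff-+ s u k))

  *ᴾ-congˡ : ∀ p {r s} → r ≈ᴾ s → p *ᴾ r ≈ᴾ p *ᴾ s
  *ᴾ-congˡ []      e = reflᴾ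
  *ᴾ-congˡ (a ∷ p) e = +ᴾ-cong (scale-cong refl e) (∷-cong refl (*ᴾ-congˡ p e))

  *ᴾ-zeroʳ : ∀ p → p *ᴾ 0ᴾ ≈ᴾ 0ᴾ
  *ᴾ-zeroʳ []      = reflᴾ
  *ᴾ-zeroʳ (a ∷ p) = transᴾ (∷-cong refl (*ᴾ-zeroʳ p)) 0∷[]≈0

  *ᴾ-∷ʳ : ∀ p b r → p *ᴾ (b ∷ r) ≈ᴾ scale b p +ᴾ (0# ∷ (p *ᴾ r))
  *ᴾ-∷ʳ []      b r = symᴾ 0∷[]≈0
  *ᴾ-∷ʳ (a ∷ p) b r = ∷-cong (+-congʳ (*-comm a b))
    (transᴾ (+ᴾ-cong (reflᴾ {scale a r}) (*ᴾ-∷ʳ p b r)) (swap (scale a r) (scale b p) _))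
    where
    swap : ∀ p r s → p +ᴾ (r +ᴾ s) ≈ᴾ r +ᴾ (p +ᴾ s)
    swap p r s = transᴾ (symᴾ (+ᴾ-assoc p r s))
      (transᴾ (+ᴾ-cong (+ᴾ-comm p r) reflᴾ) (+ᴾ-assoc r p s))

  *ᴾ-comm : ∀ p r → p *ᴾ r ≈ᴾ r *ᴾ p
  *ᴾ-comm []      r = symᴾ (*ᴾ-zeroʳ r)
  *ᴾ-comm (a ∷ p) r = transᴾ
    (+ᴾ-cong reflᴾ (∷-cong refl (*ᴾ-comm p r)))
    (symᴾ (*ᴾ-∷ʳ r a p))

  *ᴾ-cong : ∀ {p p′ r r′} → p ≈ᴾ p′ → r ≈ᴾ r′ → p *ᴾ r ≈ᴾ p′ *ᴾ r′
  *ᴾ-cong {p} {p′} {r} {r′} e f =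
    transᴾ (*ᴾ-congˡ p f) (transᴾ (*ᴾ-comm p r′) (transᴾ (*ᴾ-congˡ r′ e) (*ᴾ-comm r′ p′)))

  *ᴾ-distribˡ : ∀ p r s → p *ᴾ (r +ᴾ s) ≈ᴾ p *ᴾ r +ᴾ p *ᴾ s
  *ᴾ-distribˡ []      r s = reflᴾ
  *ᴾ-distribˡ (a ∷ p) r s = transᴾ
    (+ᴾ-cong (scale-+ᴾ a r s)
      (∷-cong {b = 0# + 0#} (sym (+-identityˡ 0#)) (*ᴾ-distribˡ p r s)))
    (+ᴾ-interchange (scale a r) (scale a s) (0# ∷ (p *ᴾ r)) (0# ∷ (p *ᴾ s)))

  *ᴾ-distribʳ : ∀ s p r → (p +ᴾ r) *ᴾ s ≈ᴾ p *ᴾ s +ᴾ r *ᴾ s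
  *ᴾ-distribʳ s p r = transᴾ (*ᴾ-comm (p +ᴾ r) s)
    (transᴾ (*ᴾ-distribˡ s p r) (+ᴾ-cong (*ᴾ-comm s p) (*ᴾ-comm s r)))

  0∷-*ᴾ : ∀ p r → (0# ∷ p) *ᴾ r ≈ᴾ 0# ∷ (p *ᴾ r)
  0∷-*ᴾ p r = +ᴾ-cong (scale-0 r) reflᴾ

  scale-*ᴾ : ∀ a p r → scale a p *ᴾ r ≈ᴾ scale a (p *ᴾ r)
  scale-*ᴾ a []      r = reflᴾ
  scale-*ᴾ a (b ∷ p) r = transᴾ
    (+ᴾ-cong (scale-scale a b r) (∷-cong (sym (zeroʳ a)) (scale-*ᴾ a p r)))
    (symᴾ (scale-+ᴾ a (scale b r) (0# ∷ (p *ᴾ r))))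

  *ᴾ-assoc : ∀ p r s → (p *ᴾ r) *ᴾ s ≈ᴾ p *ᴾ (r *ᴾ s)
  *ᴾ-assoc []      r s = reflᴾ
  *ᴾ-assoc (a ∷ p) r s = transᴾ
    (*ᴾ-distribʳ s (scale a r) (0# ∷ (p *ᴾ r)))
    (+ᴾ-cong (scale-*ᴾ a r s)
      (transᴾ (0∷-*ᴾ (p *ᴾ r) s) (∷-cong refl (*ᴾ-assoc p r s))))

  *ᴾ-identityˡ : ∀ p → 1ᴾ *ᴾ p ≈ᴾ p
  *ᴾ-identityˡ p = transᴾ (+ᴾ-cong (scale-1 p) 0∷[]≈0) (+ᴾ-identityʳ p)

  commutativeRing : CommutativeRing c ℓ
  commutativeRing = record
    { Carrier = Poly ; _≈_ = _≈ᴾ_ ; _+_ = _+ᴾ_ ; _*_ = _*ᴾ_ ; -_ = -ᴾ_ ; 0# = 0ᴾ ; 1# = 1ᴾ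
    ; isCommutativeRing = record
      { isRing = record
        { +-isAbelianGroup = record
          { isGroup = record
            { isMonoid = record
              { isSemigroup = record
                { isMagma = record
                  { isEquivalence = record { refl = reflᴾ ; sym = symᴾ ; trans = transᴾ }
                  ; ∙-cong = +ᴾ-cong }
                ; assoc = +ᴾ-assoc }
              ; identity = (λ p → reflᴾ) , +ᴾ-identityʳ }
            ; inverse = -ᴾ-inverseˡ , λ p → transᴾ (+ᴾ-comm p (-ᴾ p)) (-ᴾ-inverseˡ p)
            ; ⁻¹-cong = -ᴾ-cong }
          ; comm = +ᴾ-comm }
        ; *-cong = *ᴾ-cong
        ; *-assoc = *ᴾ-assoc
        ; *-identity = *ᴾ-identityˡ , λ p → transᴾ (*ᴾ-comm p 1ᴾ) (*ᴾ-identityˡ p)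
        ; distrib = *ᴾ-distribˡ , *ᴾ-distribʳ }
      ; *-comm = *ᴾ-comm } }

  coeff₀-* : ∀ p r → coeff (p *ᴾ r) 0 ≈ coeff p 0 * coeff r 0
  coeff₀-* []      r = sym (zeroˡ _)
  coeff₀-* (a ∷ p) r = begin
    coeff (scale a r +ᴾ (0# ∷ (p *ᴾ r))) 0 ≈⟨ coeff-+ (scale a r) _ 0 ⟩
    coeff (scale a r) 0 + 0#               ≈⟨ +-identityʳ _ ⟩
    coeff (scale a r) 0                    ≈⟨ coeff-scale a r 0 ⟩
    a * coeff r 0                          ∎

  nontrivial : Nontrivial R → Nontrivial commutativeRing
  nontrivial 1≉0 e = 1≉0 (e .at 0)

  const-nonzero : ∀ {a} → ¬ a ≈ 0# → ¬ const a ≈ᴾ 0ᴾ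
  const-nonzero a≉0 e = a≉0 (e .at 0)

  X-nonzero : Nontrivial R → ¬ X ≈ᴾ 0ᴾ
  X-nonzero 1≉0 e = 1≉0 (e .at 1)

  1-pXr-nonzero : Nontrivial R → ∀ p r → ¬ 1ᴾ +ᴾ (-ᴾ (p *ᴾ (X *ᴾ r))) ≈ᴾ 0ᴾ
  1-pXr-nonzero 1≉0 p r e = 1≉0 (begin
    1#                                    ≈⟨ +-identityʳ 1# ⟨
    1# + 0#                               ≈⟨ +-congˡ -0#≈0# ⟨
    1# + - 0#                             ≈⟨ +-congˡ (-‿cong coeff₀≈0) ⟨
    1# + - coeff (p *ᴾ (X *ᴾ r)) 0        ≈⟨ +-congˡ (coeff-neg (p *ᴾ (X *ᴾ r)) 0) ⟨
    1# + coeff (-ᴾ (p *ᴾ (X *ᴾ r))) 0     ≈⟨ coeff-+ 1ᴾ (-ᴾ (p *ᴾ (X *ᴾ r))) 0 ⟨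
    coeff (1ᴾ +ᴾ (-ᴾ (p *ᴾ (X *ᴾ r)))) 0  ≈⟨ e .at 0 ⟩
    0#                                    ∎)
    where
    coeff₀≈0 : coeff (p *ᴾ (X *ᴾ r)) 0 ≈ 0#
    coeff₀≈0 = begin
      coeff (p *ᴾ (X *ᴾ r)) 0         ≈⟨ coeff₀-* p (X *ᴾ r) ⟩
      coeff p 0 * coeff (X *ᴾ r) 0    ≈⟨ *-congˡ (coeff₀-* X r) ⟩
      coeff p 0 * (0# * coeff r 0)    ≈⟨ *-congˡ (zeroˡ _) ⟩
      coeff p 0 * 0#                  ≈⟨ zeroʳ _ ⟩
      0#                              ∎

  noZeroDivisors : NoZeroDivisors R → NoZeroDivisors commutativeRing
  noZeroDivisors integral = go
    where
    tail : ∀ {p r} → p ≈ᴾ 0# ∷ r → p ≈ᴾ 0ᴾ → r ≈ᴾ 0ᴾ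
    tail e f .at k = trans (sym (e .at (suc k))) (f .at (suc k))

    go : NoZeroDivisors commutativeRing
    go []      r       e = inj₁ reflᴾ
    go (a ∷ p) []      e = inj₂ reflᴾ
    go (a ∷ p) (b ∷ r) e = [
        (λ a≈0 → Sum.map₁ (λ p≈0 → transᴾ (∷-cong a≈0 p≈0) 0∷[]≈0) (go p (b ∷ r) (tail
          (transᴾ (*ᴾ-cong {p = a ∷ p} {r = b ∷ r} (∷-cong a≈0 reflᴾ) reflᴾ) (0∷-*ᴾ p (b ∷ r))) e)))
      , (λ b≈0 → Sum.map₂ (λ r≈0 → transᴾ (∷-cong b≈0 r≈0) 0∷[]≈0) (go (a ∷ p) r (tail
          (transᴾ (*ᴾ-∷ʳ (a ∷ p) b r)
            (+ᴾ-cong (transᴾ (scale-cong b≈0 reflᴾ) (scale-0 (a ∷ p))) reflᴾ)) e)))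
      ]′ (integral a b (trans (sym (coeff₀-* (a ∷ p) (b ∷ r))) (e .at 0)))

------------------------------------------------------------------------
-- The field of fractions of an integral domain

module Fractions {c ℓ} (D : CommutativeRing c ℓ)
                 (integral : NoZeroDivisors D) (1≉0 : Nontrivial D) where

  open CommutativeRing D
  open RingProperties ring
    using (-‿distribˡ-*; [y-z]x≈yx-zx)
  open GroupProperties +-group using (x∙y⁻¹≈ε⇒x≈y; x≈y⇒x∙y⁻¹≈ε)
  open import Relation.Binary.Reasoning.Setoid setoid
  open Solver commutativeSemiring using (solve; _:+_; _:*_; _:=_; con)

  record Fraction : Set (c ⊔ ℓ) where
    constructor _/_⟨_⟩
    field
      num  : Carrier
      den  : Carrier
      den≉0 : ¬ den ≈ 0#

  open Fraction public

  infix 4 _≈ᶠ_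

  record _≈ᶠ_ (x y : Fraction) : Set ℓ where
    constructor mk≈
    field cross : num x * den y ≈ num y * den x

  open _≈ᶠ_ public

  *-nonzero : ∀ {a b} → ¬ a ≈ 0# → ¬ b ≈ 0# → ¬ a * b ≈ 0#
  *-nonzero a≉0 b≉0 ab≈0 with integral _ _ ab≈0
  ... | inj₁ a≈0 = a≉0 a≈0
  ... | inj₂ b≈0 = b≉0 b≈0

  *-cancelʳ : ∀ {a b d} → ¬ d ≈ 0# → a * d ≈ b * d → a ≈ b
  *-cancelʳ {a} {b} {d} d≉0 ad≈bd
    with integral (a - b) d (trans ([y-z]x≈yx-zx d a b) (x≈y⇒x∙y⁻¹≈ε ad≈bd))
  ... | inj₁ a-b≈0 = x∙y⁻¹≈ε⇒x≈y a b a-b≈0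
  ... | inj₂ d≈0   with () ← d≉0 d≈0

  infixl 6 _+ᶠ_
  infixl 7 _*ᶠ_
  infixr 8 -ᶠ_

  0ᶠ 1ᶠ : Fraction
  0ᶠ = 0# / 1# ⟨ 1≉0 ⟩
  1ᶠ = 1# / 1# ⟨ 1≉0 ⟩

  _+ᶠ_ _*ᶠ_ : Fraction → Fraction → Fraction
  (a / b ⟨ b≉0 ⟩) +ᶠ (a′ / b′ ⟨ b′≉0 ⟩) = (a * b′ + a′ * b) / (b * b′) ⟨ *-nonzero b≉0 b′≉0 ⟩
  (a / b ⟨ b≉0 ⟩) *ᶠ (a′ / b′ ⟨ b′≉0 ⟩) = (a * a′) / (b * b′) ⟨ *-nonzero b≉0 b′≉0 ⟩

  -ᶠ_ : Fraction → Fraction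
  -ᶠ (a / b ⟨ b≉0 ⟩) = (- a) / b ⟨ b≉0 ⟩

  _⁻¹⟨_⟩ : (x : Fraction) → ¬ num x ≈ 0# → Fraction
  (a / b ⟨ _ ⟩) ⁻¹⟨ a≉0 ⟩ = b / a ⟨ a≉0 ⟩

  reflᶠ : ∀ {x} → x ≈ᶠ x
  reflᶠ .cross = refl

  symᶠ : ∀ {x y} → x ≈ᶠ y → y ≈ᶠ x
  symᶠ e .cross = sym (e .cross)

  transᶠ : ∀ {x y z} → x ≈ᶠ y → y ≈ᶠ z → x ≈ᶠ z
  transᶠ {a / b ⟨ _ ⟩} {a′ / b′ ⟨ b′≉0 ⟩} {a″ / b″ ⟨ _ ⟩} e f .cross = *-cancelʳ b′≉0 (begin
    a * b″ * b′  ≈⟨ solve 3 (λ x y z → x :* y :* z := x :* z :* y) refl a b″ b′ ⟩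
    a * b′ * b″  ≈⟨ *-congʳ (e .cross) ⟩
    a′ * b * b″  ≈⟨ solve 3 (λ x y z → x :* y :* z := x :* z :* y) refl a′ b b″ ⟩
    a′ * b″ * b  ≈⟨ *-congʳ (f .cross) ⟩
    a″ * b′ * b  ≈⟨ solve 3 (λ x y z → x :* y :* z := x :* z :* y) refl a″ b′ b ⟩
    a″ * b * b′  ∎)

  +ᶠ-cong : ∀ {x y u v} → x ≈ᶠ y → u ≈ᶠ v → x +ᶠ u ≈ᶠ y +ᶠ v
  +ᶠ-cong {a / b ⟨ _ ⟩} {a′ / b′ ⟨ _ ⟩} {p / r ⟨ _ ⟩} {p′ / r′ ⟨ _ ⟩} e f .cross = begin
    (a * r + p * b) * (b′ * r′)
      ≈⟨ solve 6 (λ a b r p b′ r′ → (a :* r :+ p :* b) :* (b′ :* r′)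
                   := (a :* b′) :* (r :* r′) :+ (p :* r′) :* (b :* b′)) refl a b r p b′ r′ ⟩
    (a * b′) * (r * r′) + (p * r′) * (b * b′)
      ≈⟨ +-cong (*-congʳ (e .cross)) (*-congʳ (f .cross)) ⟩
    (a′ * b) * (r * r′) + (p′ * r) * (b * b′)
      ≈⟨ solve 6 (λ a′ b r p′ b′ r′ → (a′ :* b) :* (r :* r′) :+ (p′ :* r) :* (b :* b′)
                   := (a′ :* r′ :+ p′ :* b′) :* (b :* r)) refl a′ b r p′ b′ r′ ⟩
    (a′ * r′ + p′ * b′) * (b * r) ∎

  *ᶠ-cong : ∀ {x y u v} → x ≈ᶠ y → u ≈ᶠ v → x *ᶠ u ≈ᶠ y *ᶠ v
  *ᶠ-cong {a / b ⟨ _ ⟩} {a′ / b′ ⟨ _ ⟩} {p / r ⟨ _ ⟩} {p′ / r′ ⟨ _ ⟩} e f .cross = begin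
    (a * p) * (b′ * r′)   ≈⟨ solve 4 (λ a p b r → (a :* p) :* (b :* r) := (a :* b) :* (p :* r)) refl a p b′ r′ ⟩
    (a * b′) * (p * r′)   ≈⟨ *-cong (e .cross) (f .cross) ⟩
    (a′ * b) * (p′ * r)   ≈⟨ solve 4 (λ a b p r → (a :* b) :* (p :* r) := (a :* p) :* (b :* r)) refl a′ b p′ r ⟩
    (a′ * p′) * (b * r)   ∎

  -ᶠ-cong : ∀ {x y} → x ≈ᶠ y → -ᶠ x ≈ᶠ -ᶠ y
  -ᶠ-cong {a / b ⟨ _ ⟩} {a′ / b′ ⟨ _ ⟩} e .cross = begin
    - a * b′    ≈⟨ -‿distribˡ-* a b′ ⟨
    - (a * b′)  ≈⟨ -‿cong (e .cross) ⟩
    - (a′ * b)  ≈⟨ -‿distribˡ-* a′ b ⟩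
    - a′ * b    ∎

  +ᶠ-assoc : ∀ x y z → (x +ᶠ y) +ᶠ z ≈ᶠ x +ᶠ (y +ᶠ z)
  +ᶠ-assoc (a / b ⟨ _ ⟩) (a′ / b′ ⟨ _ ⟩) (a″ / b″ ⟨ _ ⟩) .cross =
    solve 6 (λ a b a′ b′ a″ b″ →
      ((a :* b′ :+ a′ :* b) :* b″ :+ a″ :* (b :* b′)) :* (b :* (b′ :* b″))
      := (a :* (b′ :* b″) :+ (a′ :* b″ :+ a″ :* b′) :* b) :* ((b :* b′) :* b″))
      refl a b a′ b′ a″ b″

  +ᶠ-comm : ∀ x y → x +ᶠ y ≈ᶠ y +ᶠ x
  +ᶠ-comm (a / b ⟨ _ ⟩) (a′ / b′ ⟨ _ ⟩) .cross =
    solve 4 (λ a b a′ b′ → (a :* b′ :+ a′ :* b) :* (b′ :* b) := (a′ :* b :+ a :* b′) :* (b :* b′))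
      refl a b a′ b′

  +ᶠ-identityˡ : ∀ x → 0ᶠ +ᶠ x ≈ᶠ x
  +ᶠ-identityˡ (a / b ⟨ _ ⟩) .cross =
    solve 2 (λ a b → (con 0 :* b :+ a :* con 1) :* b := a :* (con 1 :* b)) refl a b

  -ᶠ-inverseˡ : ∀ x → (-ᶠ x) +ᶠ x ≈ᶠ 0ᶠ
  -ᶠ-inverseˡ (a / b ⟨ _ ⟩) .cross = begin
    (- a * b + a * b) * 1#   ≈⟨ *-identityʳ _ ⟩
    - a * b + a * b          ≈⟨ distribʳ b (- a) a ⟨
    (- a + a) * b            ≈⟨ *-congʳ (-‿inverseˡ a) ⟩
    0# * b                   ≈⟨ zeroˡ b ⟩
    0#                       ≈⟨ zeroˡ (b * b) ⟨
    0# * (b * b)             ∎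

  *ᶠ-assoc : ∀ x y z → (x *ᶠ y) *ᶠ z ≈ᶠ x *ᶠ (y *ᶠ z)
  *ᶠ-assoc (a / b ⟨ _ ⟩) (a′ / b′ ⟨ _ ⟩) (a″ / b″ ⟨ _ ⟩) .cross =
    *-cong (*-assoc a a′ a″) (sym (*-assoc b b′ b″))

  *ᶠ-comm : ∀ x y → x *ᶠ y ≈ᶠ y *ᶠ x
  *ᶠ-comm (a / b ⟨ _ ⟩) (a′ / b′ ⟨ _ ⟩) .cross = *-cong (*-comm a a′) (*-comm b′ b)

  *ᶠ-identityˡ : ∀ x → 1ᶠ *ᶠ x ≈ᶠ x
  *ᶠ-identityˡ (a / b ⟨ _ ⟩) .cross =
    solve 2 (λ a b → (con 1 :* a) :* b := a :* (con 1 :* b)) refl a b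

  *ᶠ-distribˡ : ∀ x y z → x *ᶠ (y +ᶠ z) ≈ᶠ x *ᶠ y +ᶠ x *ᶠ z
  *ᶠ-distribˡ (a / b ⟨ _ ⟩) (a′ / b′ ⟨ _ ⟩) (a″ / b″ ⟨ _ ⟩) .cross =
    solve 6 (λ a b a′ b′ a″ b″ →
      (a :* (a′ :* b″ :+ a″ :* b′)) :* ((b :* b′) :* (b :* b″))
      := ((a :* a′) :* (b :* b″) :+ (a :* a″) :* (b :* b′)) :* (b :* (b′ :* b″)))
      refl a b a′ b′ a″ b″

  *ᶠ-inverseʳ : ∀ x (x≉0 : ¬ num x ≈ 0#) → x *ᶠ (x ⁻¹⟨ x≉0 ⟩) ≈ᶠ 1ᶠ
  *ᶠ-inverseʳ (a / b ⟨ _ ⟩) _ .cross =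
    solve 2 (λ a b → (a :* b) :* con 1 := con 1 :* (b :* a)) refl a b

  commutativeRingᶠ : CommutativeRing (c ⊔ ℓ) ℓ
  commutativeRingᶠ = record
    { Carrier = Fraction ; _≈_ = _≈ᶠ_ ; _+_ = _+ᶠ_ ; _*_ = _*ᶠ_ ; -_ = -ᶠ_ ; 0# = 0ᶠ ; 1# = 1ᶠ
    ; isCommutativeRing = record
      { isRing = record
        { +-isAbelianGroup = record
          { isGroup = record
            { isMonoid = record
              { isSemigroup = record
                { isMagma = record
                  { isEquivalence = record { refl = reflᶠ ; sym = symᶠ ; trans = transᶠ }
                  ; ∙-cong = +ᶠ-cong }
                ; assoc = +ᶠ-assoc }
              ; identity = +ᶠ-identityˡ , λ x → transᶠ (+ᶠ-comm x 0ᶠ) (+ᶠ-identityˡ x) }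
            ; inverse = -ᶠ-inverseˡ , λ x → transᶠ (+ᶠ-comm x (-ᶠ x)) (-ᶠ-inverseˡ x)
            ; ⁻¹-cong = -ᶠ-cong }
          ; comm = +ᶠ-comm }
        ; *-cong = *ᶠ-cong
        ; *-assoc = *ᶠ-assoc
        ; *-identity = *ᶠ-identityˡ , λ x → transᶠ (*ᶠ-comm x 1ᶠ) (*ᶠ-identityˡ x)
        ; distrib = *ᶠ-distribˡ , λ x y z → transᶠ (*ᶠ-comm (y +ᶠ z) x)
            (transᶠ (*ᶠ-distribˡ x y z) (+ᶠ-cong (*ᶠ-comm x y) (*ᶠ-comm x z))) }
      ; *-comm = *ᶠ-comm } }

------------------------------------------------------------------------
-- The field ℚ(q,t), as the fraction field of ℚ[q][t]

module ℚ[q]    = Polynomial ℚ.+-*-commutativeRing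
module ℚ[q][t] = Polynomial ℚ[q].commutativeRing

ℚ[q,t] : CommutativeRing 0ℓ 0ℓ
ℚ[q,t] = ℚ[q][t].commutativeRing

ℚ[q]-nontrivial : Nontrivial ℚ[q].commutativeRing
ℚ[q]-nontrivial = ℚ[q].nontrivial ℚ.1≢0

module ℚ⟨q,t⟩ = Fractions ℚ[q,t]
  (ℚ[q][t].noZeroDivisors (ℚ[q].noZeroDivisors ℚ-noZeroDivisors))
  (ℚ[q][t].nontrivial ℚ[q]-nontrivial)

K-commutativeRing : CommutativeRing 0ℓ 0ℓ
K-commutativeRing = ℚ⟨q,t⟩.commutativeRingᶠ

module K where
  open CommutativeRing K-commutativeRing public
  open Exp semiring public using (_^_)

K : Set
K = K.Carrier

module _ where
  open CommutativeRing ℚ[q,t]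
  open Exp semiring using (_^_)
  open ℚ⟨q,t⟩ using (_/_⟨_⟩)

  qᴾ tᴾ : Carrier
  qᴾ = ℚ[q][t].const ℚ[q].X
  tᴾ = ℚ[q][t].X

  ι : Carrier → K
  ι p = p / 1# ⟨ ℚ[q][t].nontrivial ℚ[q]-nontrivial ⟩

  q-nonzero : ¬ qᴾ ≈ 0#
  q-nonzero = ℚ[q][t].const-nonzero (ℚ[q].X-nonzero ℚ.1≢0)

  1-qᵃt¹⁺ᵇ-nonzero : ∀ a b → ¬ 1# - qᴾ ^ a * tᴾ ^ suc b ≈ 0#
  1-qᵃt¹⁺ᵇ-nonzero a b = ℚ[q][t].1-pXr-nonzero ℚ[q]-nontrivial (qᴾ ^ a) (tᴾ ^ b)

  q t q⁻¹ : K
  q   = ι qᴾ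
  t   = ι tᴾ
  q⁻¹ = q ℚ⟨q,t⟩.⁻¹⟨ q-nonzero ⟩

  [1-t]/[1-q^_t^1+_] : ℕ → ℕ → K
  [1-t]/[1-q^ a t^1+ b ] = (1# - tᴾ) / (1# - qᴾ ^ a * tᴾ ^ suc b) ⟨ 1-qᵃt¹⁺ᵇ-nonzero a b ⟩

q^ℤ_ : ℤ → K
q^ℤ (+ k)    = q K.^ k
q^ℤ -[1+ k ] = q⁻¹ K.^ suc k

------------------------------------------------------------------------
-- Laurent polynomials in x₁,…,xₙ over ℚ(q,t): finite formal sums of terms
-- c·x^e, with e ∈ ℤⁿ; equality compares the coefficients of all monomials.

Exponent : ℕ → Set
Exponent n = Vector ℤ n

Laurent : ℕ → Set
Laurent n = List (K × Exponent n)

module _ {n : ℕ} where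

  _≟ᵉ_ : (e e′ : Exponent n) → Dec (∀ k → e k ≡ e′ k)
  e ≟ᵉ e′ = Fin.all? λ k → e k ℤ.≟ e′ k

  coeff : Laurent n → Exponent n → K
  coeff []            m = K.0#
  coeff ((c , e) ∷ f) m = if does (e ≟ᵉ m) then c K.+ coeff f m else coeff f m

  infix  4 _≈ᴸ_
  infixl 6 _+ᴸ_ _-ᴸ_
  infixl 7 _*ᴸ_
  infixr 7 _•_

  _≈ᴸ_ : Rel (Laurent n) 0ℓ
  f ≈ᴸ g = ∀ m → coeff f m K.≈ coeff g m

  _+ᴸ_ _-ᴸ_ _*ᴸ_ : Laurent n → Laurent n → Laurent n
  _•_ : K → Laurent n → Laurent n

  f +ᴸ g = f ++ g
  c • f  = map (λ (d , e) → c K.* d , e) f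
  f -ᴸ g = f +ᴸ (K.- K.1#) • g
  _*ᴸ_   = cartesianProductWith λ (c , e) (d , e′) → c K.* d , λ k → e k ℤ.+ e′ k

  1ᴸ : Laurent n
  1ᴸ = [ K.1# , (λ _ → 0ℤ) ]

  -- xᵢ / xⱼ
  x_/x_ : Fin n → Fin n → Laurent n
  x i /x j = [ K.1# , (λ k → δ i k ℤ.- δ j k) ]
    where
    δ : Fin n → Fin n → ℤ
    δ i k = if does (i Fin.≟ k) then 1ℤ else 0ℤ

------------------------------------------------------------------------
-- The operators. Indices are shifted down by one: the variable xᵢ is
-- indexed by i - 1 in Fin n, and T j for j : Fin (n - 1) involves the
-- variables indexed by inject₁ j and suc j.
--
-- An operator is given by its graph. The Laurent polynomials form an
-- integral domain, so a quotient h = f / g is determined up to _≈ᴸ_ by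
-- g h = f, and T⁻¹ is the converse of the graph of T.

Operator : ℕ → Set₁
Operator n = Rel (Laurent n) 0ℓ

IsQuotient : ∀ {n} → Laurent n → Laurent n → Laurent n → Set
IsQuotient h f g = g *ᴸ h ≈ᴸ f

module _ {m : ℕ} where

  private
    n : ℕ
    n = suc m

  s : Fin m → Laurent n → Laurent n
  s j = map λ (c , e) → c , λ k → e (Perm.transpose (inject₁ j) (suc j) ⟨$⟩ʳ k)

  T : Fin m → Operator n
  T j f g = Σ[ h ∈ Laurent n ]
    (IsQuotient h (f -ᴸ s j f) (1ᴸ -ᴸ x inject₁ j /x suc j) × (g ≈ᴸ t • s j f +ᴸ (t K.- K.1#) • h))

  T^ : Sign → Fin m → Operator n
  T^ Sign.+ j = T j
  T^ Sign.- j = flip (T j)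

  -- Substituting (x₂,…,xₙ,q⁻¹x₁) for (x₁,…,xₙ) turns x₁^e₁⋯xₙ^eₙ into
  -- q^(-eₙ) x₁^eₙ x₂^e₁⋯xₙ^eₙ₋₁.
  π : Laurent n → Laurent n
  π = map λ (c , e) → c K.* q^ℤ (ℤ.- e (fromℕ m)) , λ { zero → e (fromℕ m) ; (suc k) → e (inject₁ k) }

  graph : (Laurent n → Laurent n) → Operator n
  graph F f g = g ≈ᴸ F f

  -- The composite of a list of operators, the first in the list acting first.
  composite : List (Operator n) → Operator n
  composite []       f g = g ≈ᴸ f
  composite (R ∷ Rs) f g = Σ[ h ∈ Laurent n ] (R f h × composite Rs h g)

  Inversion : Permutation′ n → Fin n → Fin n → Set
  Inversion τ a b = τ ⟨$⟩ˡ b Fin.< τ ⟨$⟩ˡ a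

  inversion? : ∀ τ a b → Dec (Inversion τ a b)
  inversion? τ a b = (τ ⟨$⟩ˡ b) Fin.<? (τ ⟨$⟩ˡ a)

  ε : Permutation′ n → Fin n → Fin m → Sign
  ε τ i j = if does (toℕ i ℕ.≤? toℕ j)
    then (if does (inversion? τ i (suc j))     then Sign.- else Sign.+)
    else (if does (inversion? τ (inject₁ j) i) then Sign.+ else Sign.-)

  #ε⁻ : Permutation′ n → Fin n → ℕ
  #ε⁻ τ i = length (filter (λ j → ε τ i j Sign.≟ Sign.-) (allFin m))

  Y : Permutation′ n → Fin n → Operator n
  Y τ i = composite
    (  map T^ε (filter (λ j → toℕ i ℕ.≤? toℕ j) (allFin m))
    ++ [ graph π ]
    ++ map T^ε (filter (λ j → toℕ j ℕ.<? toℕ i) (allFin m))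
    ++ [ graph (t K.^ #ε⁻ τ i •_) ])
    where
    T^ε : Fin m → Operator n
    T^ε j = T^ (ε τ i j) j

------------------------------------------------------------------------
-- Diagrams and fillings

WeakComposition : ℕ → Set
WeakComposition n = Vector ℕ n

enumerate : ∀ {n} {A : Fin n → Set} → (∀ i → List (A i)) → List (∀ i → A i)
enumerate {zero}  as = [ (λ ()) ]
enumerate {suc n} as = cartesianProductWith Fin.∀-cons (as zero) (enumerate (as ∘ suc))

module _ {n : ℕ} (γ : WeakComposition n) where

  -- (i , j) : Box is the box in column i and row toℕ j + 1, while
  -- (i , j) : Box^ is the box in column i and row toℕ j.
  Box Box^ : Set
  Box  = Σ[ i ∈ Fin n ] Fin (γ i)
  Box^ = Σ[ i ∈ Fin n ] Fin (suc (γ i))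

  boxes : List Box
  boxes = concatMap (λ i → map (i ,_) (allFin (γ i))) (allFin n)

  boxes^ : List Box^
  boxes^ = concatMap (λ i → map (i ,_) (allFin (suc (γ i)))) (allFin n)

  col : Box^ → Fin n
  col = proj₁

  row : Box^ → ℕ
  row (i , j) = toℕ j

  up : Box → Box^
  up (i , j) = i , suc j

  d : Box → Box^
  d (i , j) = i , inject₁ j

  leg : Box → ℕ
  leg u@(i , _) = γ i ∸ row (up u)

  InArm : Box → Box^ → Set
  InArm u@(i , _) v@(i′ , _) =
      (row v ≡ row (up u) × i′ Fin.< i × γ i′ ℕ.≤ γ i)
    ⊎ (row v ≡ row (d u)  × i Fin.< i′ × γ i′ ℕ.< γ i)

  inArm? : ∀ u v → Dec (InArm u v)
  inArm? u@(i , _) v@(i′ , _) =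
          (row v ℕ.≟ row (up u) ×-dec i′ Fin.<? i ×-dec γ i′ ℕ.≤? γ i)
    ⊎-dec (row v ℕ.≟ row (d u)  ×-dec i Fin.<? i′ ×-dec γ i′ ℕ.<? γ i)

  arm : Box → List Box^
  arm u = filter (inArm? u) boxes^

  Attacking : Box^ → Box^ → Set
  Attacking x y = (row x ≡ row y × col x ≢ col y)
                ⊎ (row x ≡ suc (row y) × col x Fin.< col y)

  attacking? : ∀ x y → Dec (Attacking x y)
  attacking? x y = (row x ℕ.≟ row y ×-dec ¬? (col x Fin.≟ col y))
             ⊎-dec (row x ℕ.≟ suc (row y) ×-dec col x Fin.<? col y)

  Filling : Set
  Filling = (i : Fin n) → Fin (γ i) → Fin n

  fillings : List Filling
  fillings = enumerate λ i → enumerate λ _ → allFin n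

  augment : Permutation′ n → Filling → Box^ → Fin n
  augment τ σ (i , zero)  = τ ⟨$⟩ʳ i
  augment τ σ (i , suc j) = σ i j

  NonAttacking : (Box^ → Fin n) → Set
  NonAttacking σ^ = ∀ x y → Attacking x y → σ^ x ≢ σ^ y

  nonAttacking? : ∀ σ^ → Dec (NonAttacking σ^)
  nonAttacking? σ^ = all^? λ x → all^? λ y → attacking? x y →-dec ¬? (σ^ x Fin.≟ σ^ y)
    where
    all^? : {P : Box^ → Set} → (∀ x → Dec (P x)) → Dec (∀ x → P x)
    all^? P? = map′ (λ p (i , j) → p i j) (λ p i j → p (i , j))
      (Fin.all? λ i → Fin.all? λ j → P? (i , j))

  maj : (Box^ → Fin n) → ℕ
  maj σ^ = sum (map (λ u → suc (leg u))
    (filter (λ u → σ^ (d u) Fin.<? σ^ (up u)) boxes))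

  χ : (Box^ → Fin n) → Box^ → Box^ → ℕ
  χ σ^ x y = if does (σ^ y Fin.<? σ^ x) then 1 else 0

  -- The list of the v ∈ arm u for which the triple (u , v , d u) is a
  -- coinversion triple; χ_uv + χ_vw - χ_uw = 0 is stated without subtraction.
  coinversions : (Box^ → Fin n) → Box → List Box^
  coinversions σ^ u =
    filter (λ v → χ σ^ (up u) v ℕ.+ χ σ^ v (d u) ℕ.≟ χ σ^ (up u) (d u)) (arm u)

  coinvtrip : (Box^ → Fin n) → ℕ
  coinvtrip σ^ = sum (map (length ∘ coinversions σ^) boxes)

  weight : (Box^ → Fin n) → K
  weight σ^ = q K.^ maj σ^ K.* t K.^ coinvtrip σ^ K.*
    foldr K._*_ K.1# (map (λ u → [1-t]/[1-q^ suc (leg u) t^1+ length (arm u) ])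
      (filter (λ u → ¬? (σ^ (up u) Fin.≟ σ^ (d u))) boxes))

  monomial : Filling → Exponent n
  monomial σ k = + length (filter (λ (i , j) → σ i j Fin.≟ k) boxes)

  E : Permutation′ n → Laurent n
  E τ = map (λ σ → weight (augment τ σ) , monomial σ)
    (filter (λ σ → nonAttacking? (augment τ σ)) fillings)

{-# OPTIONS --safe #-}
module Submission where

-- Read a filling row by row, each row from left to right. The part already read is
-- seen by the rest only through a queue: the last entry of every column together with
-- the number of boxes still above it. The column at the front is dropped if it is
-- complete; otherwise it receives an entry u, which must avoid the rest of the queue,
-- and moves to the back. The arm of the new box consists of the columns of the queue
-- with fewer boxes left, so its weight is a function of the queue, and E_{γ,τ} = F(Q)
-- for the queue Q of the pairs (γ_i, τ(i)), where F is defined by this recursion.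
--
-- Induction along the recursion shows that T_j F(Q) is a power of t times F(s_j Q)
-- whenever j precedes j + 1 in Q, the case distinctions reducing to T x_j T = t x_{j+1}
-- and (T - t)(T + 1) = 0, and that π F(Q) is a power of q times F of the queue with
-- entries shifted cyclically. Hence the factors of Y_i^τ permute the basements: the
-- first ones carry i up to n, π turns it into 1, the last ones carry it back to i, and
-- the signs ε_j are exactly those for which each step is of this kind.

open import Defs using (Exponent; _≟ᵉ_)
open import Algebra.Bundles using (CommutativeRing; CommutativeMonoid)
import Algebra.Properties.CommutativeMonoid.Sum as Sum
import Algebra.Properties.CommutativeSemigroup as CommutativeSemigroupProperties
import Algebra.Properties.Ring as RingProperties
import Algebra.Properties.Semiring.Exp as Exp
import Algebra.Solver.Ring.NaturalCoefficients.Default as Solver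
open import Data.Bool.Base using (Bool; true; false; if_then_else_; not; _∧_)
open import Data.Fin.Base as Fin using (Fin; zero; suc; toℕ; inject₁; fromℕ; fromℕ<; punchIn; punchOut)
import Data.Fin.Permutation as FinPerm
open FinPerm using (Permutation′; _⟨$⟩ʳ_; _⟨$⟩ˡ_; inverseˡ; inverseʳ)
import Data.Fin.Properties as Fin
open import Data.Fin.Relation.Unary.Top using (view; ‵fromℕ; ‵inject₁; view-fromℕ; view-inject₁)
open import Data.Integer.Base as ℤ using (ℤ; +_; -[1+_]; 0ℤ; 1ℤ)
import Data.Integer.Properties as ℤ
import Data.Integer.Tactic.RingSolver as ℤSolver
open import Data.List.Base using
  (List; []; _∷_; _++_; [_]; map; _∷ʳ_; cartesianProductWith; foldr; filter; concatMap; allFin; tabulate; length)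
import Data.List.Properties as List
open import Data.List.Membership.Propositional using (_∈_)
open import Data.List.Membership.Propositional.Properties
  using (∈-allFin; ∈-filter⁺; ∈-filter⁻; ∈-map⁺; ∈-map⁻; ∈-++⁺ˡ; ∈-++⁺ʳ; ∈-++⁻)
open import Data.List.Membership.Propositional.Properties.WithK using (unique∧set⇒bag)
open import Data.List.Relation.Binary.BagAndSetEquality using (∼bag⇒↭)
open import Data.List.Relation.Binary.Permutation.Propositional as ↭ using (_↭_)
import Data.List.Relation.Binary.Permutation.Propositional.Properties as ↭
open import Data.List.Relation.Binary.Pointwise as Pointwise using (Pointwise; []; _∷_)
open import Data.List.Relation.Unary.All as All using (All; []; _∷_)
import Data.List.Relation.Unary.All.Properties as All
open import Data.List.Relation.Unary.AllPairs as AllPairs using (AllPairs; []; _∷_)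
import Data.List.Relation.Unary.AllPairs.Properties as AllPairs
open import Data.List.Relation.Unary.Any using (Any; here; there)
open import Data.List.Relation.Unary.Unique.Propositional using (Unique)
import Data.List.Relation.Unary.Unique.Propositional.Properties as Unique
open import Data.Nat.Base as ℕ using (ℕ; zero; suc; _∸_; _≤_)
open import Data.Nat.ListAction using () renaming (sum to sumℕ)
import Data.Nat.Properties as ℕ
open import Data.Product.Base using (_×_; _,_; proj₁; proj₂; ∃-syntax; Σ-syntax; map₂)
import Data.Product.Properties as Product
open import Data.Sign.Base as Sign using (Sign)
open import Data.Sum.Base using (_⊎_; inj₁; inj₂)
open import Data.Vec.Functional using (Vector; removeAt)
open import Function.Base using (_∘_; id)
open import Function.Bundles using (mk⇔)
open import Function.Definitions using (Injective)
open import Level using (0ℓ)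
open import Relation.Binary.Bundles using (Setoid)
open import Relation.Binary.Definitions using (tri<; tri≈; tri>)
open import Relation.Binary.PropositionalEquality as ≡ using (_≡_; _≢_; _≗_)
import Relation.Binary.Reasoning.Setoid as SetoidReasoning
open import Relation.Nullary using (¬_; Dec; does; yes; no; contradiction; ¬?; _×-dec_; _⊎-dec_)
open import Relation.Nullary.Decidable using (dec-true; dec-false; does-⇔)
open import Relation.Unary using (Pred; Decidable)

open CommutativeSemigroupProperties ℕ.+-commutativeSemigroup using () renaming (x∙yz≈y∙xz to +-swap)

-- The obstacle to the induction on queues is that a step can change which of j and j + 1 the queue
-- contains: dropping a completed column may remove one of them, and a new entry may restore it. The
-- statement for two entries is therefore proved together with one for queues with j + 1 in place of
-- j, T F = t F′, and one for queues with neither, T F = t F. A new entry is appended at the back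
-- and multiplied by its variable; this reverses the order of the two values, and T x_j T = t
-- x_{j+1} undoes the reversal. The factor (1 - t) / (1 - q^{l+1} t^{a+1}) is what makes the
-- quadratic relation applicable when a column passes from one of the two values to the other.
--
-- T is handled as the relation from A + x_j B to tA + x_{j+1} B with A, B symmetric in x_j,
-- x_{j+1}, which is visibly additive and involves no division. Of ℚ(q,t) only the inverses of q and
-- t and one identity for the factor enter, so the argument runs over any commutative ring with
-- these data. The identities for F hold for every bound on the number of steps, so the same bound
-- serves all basements. The eigenvalue is not computed: each step only asserts that some scalar
-- exists.

module RingIdentities {c ℓ} (R : CommutativeRing c ℓ) where
  open CommutativeRing R
  open RingProperties ring using (-1*x≈-x; -‿involutive)
  open Solver commutativeSemiring using (solve; _:+_; _:*_; _:=_; con)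

  interchange : ∀ a b c d → (a + b) + (c + d) ≈ (a + c) + (b + d)
  interchange = solve 4 (λ a b c d → (a :+ b) :+ (c :+ d) := (a :+ c) :+ (b :+ d)) refl

  -- Coefficientwise form of the sheared quadratic relation, with f = p + x₁ and Tf = tp + x₂. This
  -- identity and the next exhibit the same symmetric part p + (x₁ + x₂) + (k + t)p in source and
  -- target, with remainders kx₁ and kx₂.
  shear₁ : ∀ {a k t} p x₁ x₂ → a ≈ 1# + k →
           a * (p + x₁) + (t * p + x₂) ≈ (p + (x₁ + x₂) + (k + t) * p) + k * x₁
  shear₁ {a} {k} {t} p x₁ x₂ e = trans (+-congʳ (*-congʳ e))
    (solve 5 (λ k t p x₁ x₂ → (con 1 :+ k) :* (p :+ x₁) :+ (t :* p :+ x₂)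
      := (p :+ (x₁ :+ x₂) :+ (k :+ t) :* p) :+ k :* x₁) refl k t p x₁ x₂)

  shear₂ : ∀ {b k t} p x₁ x₂ → b * t ≈ k + t →
           t * ((p + x₁) + b * (t * p + x₂)) ≈ t * (p + (x₁ + x₂) + (k + t) * p) + k * x₂
  shear₂ {b} {k} {t} p x₁ x₂ e = trans
    (solve 5 (λ b t p x₁ x₂ → t :* ((p :+ x₁) :+ b :* (t :* p :+ x₂))
      := t :* p :+ t :* x₁ :+ (b :* t) :* (t :* p :+ x₂)) refl b t p x₁ x₂)
    (trans (+-congˡ (*-congʳ e))
    (solve 5 (λ k t p x₁ x₂ → t :* p :+ t :* x₁ :+ (k :+ t) :* (t :* p :+ x₂)
      := t :* (p :+ (x₁ :+ x₂) :+ (k :+ t) :* p) :+ k :* x₂) refl k t p x₁ x₂))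

  [-1]²≈1 : - 1# * - 1# ≈ 1#
  [-1]²≈1 = trans (-1*x≈-x (- 1#)) (-‿involutive 1#)

  -- The relation defining f, multiplied out into the division-free shape of `FactorIdentity`.
  clear-denominator : ∀ {f s p t} → s ≈ p * t → f * (1# + - s) ≈ 1# + - t → p * f * t + 1# ≈ f + t
  clear-denominator {f} {s} {p} {t} s≈ e = begin
    p * f * t + 1#                                ≈⟨ +-congʳ (solve 3 (λ p f t → p :* f :* t := f :* (p :* t)) refl p f t) ⟩
    f * (p * t) + 1#                              ≈⟨ +-cong (*-congˡ s≈) (trans (+-congˡ (-‿inverseˡ t)) (+-identityʳ 1#)) ⟨
    f * s + (1# + (- t + t))                      ≈⟨ +-congˡ (+-assoc _ _ _) ⟨
    f * s + ((1# + - t) + t)                      ≈⟨ +-congˡ (+-congʳ e) ⟨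
    f * s + (f * (1# + - s) + t)                  ≈⟨ solve 4 (λ f s m t → f :* s :+ (f :* (con 1 :+ m) :+ t) := f :* (s :+ m) :+ (f :+ t)) refl f s (- s) t ⟩
    f * (s + - s) + (f + t)                       ≈⟨ +-congʳ (trans (*-congˡ (-‿inverseʳ s)) (zeroʳ f)) ⟩
    0# + (f + t)                                  ≈⟨ +-identityˡ _ ⟩
    f + t                                         ∎
    where open SetoidReasoning setoid

  -- For h = -x₂B and f = A + x₁B this is t(s f) + (t - 1)h = tA + x₂B.
  demazure : ∀ t a x → t * a + x ≈ t * (a + x) + (t + - 1#) * (- 1# * x)
  demazure t a x = sym (begin
    t * (a + x) + (t + - 1#) * (- 1# * x)
      ≈⟨ solve 4 (λ t m a x → t :* (a :+ x) :+ (t :+ m) :* (m :* x)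
         := (t :* a :+ (m :* m) :* x) :+ t :* ((con 1 :+ m) :* x)) refl t (- 1#) a x ⟩
    (t * a + - 1# * - 1# * x) + t * ((1# + - 1#) * x)
      ≈⟨ +-cong (+-congˡ (trans (*-congʳ [-1]²≈1) (*-identityˡ x)))
           (trans (*-congˡ (trans (*-congʳ (-‿inverseʳ 1#)) (zeroˡ x))) (zeroʳ t)) ⟩
    (t * a + x) + 0# ≈⟨ +-identityʳ _ ⟩
    t * a + x ∎)
    where open SetoidReasoning setoid

  -- This is (1 - x_a/x_b)(-x_b B) = f - sf at one monomial, where a, x₁, x₂ are the coefficients of
  -- A, x_a B, x_b B and f = A + x_a B.
  quotient : ∀ a x₁ x₂ → 1# * (- 1# * x₂) + (- 1# * 1#) * (- 1# * x₁)
                       ≈ (a + x₁) + - 1# * (a + x₂)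
  quotient a x₁ x₂ = begin
    1# * (- 1# * x₂) + (- 1# * 1#) * (- 1# * x₁)
      ≈⟨ solve 3 (λ m x₁ x₂ → con 1 :* (m :* x₂) :+ (m :* con 1) :* (m :* x₁)
          := (m :* m) :* x₁ :+ m :* x₂) refl (- 1#) x₁ x₂ ⟩
    (- 1# * - 1#) * x₁ + - 1# * x₂
      ≈⟨ +-congʳ (trans (*-congʳ [-1]²≈1) (*-identityˡ x₁)) ⟩
    x₁ + - 1# * x₂
      ≈⟨ +-identityˡ _ ⟨
    0# + (x₁ + - 1# * x₂)
      ≈⟨ +-congʳ (trans (*-congʳ (-‿inverseʳ 1#)) (zeroˡ a)) ⟨
    (1# + - 1#) * a + (x₁ + - 1# * x₂)
      ≈⟨ solve 4 (λ m a x₁ x₂ → (con 1 :+ m) :* a :+ (x₁ :+ m :* x₂)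
           := (a :+ x₁) :+ m :* (a :+ x₂)) refl (- 1#) a x₁ x₂ ⟩
    (a + x₁) + - 1# * (a + x₂) ∎
    where open SetoidReasoning setoid

Inverse : (R : CommutativeRing 0ℓ 0ℓ) (x y : CommutativeRing.Carrier R) → Set
Inverse R x y = x * y ≈ 1#
  where open CommutativeRing R

-- With Q = q^h t^k this reads Q f t + 1 = f + t, that is, f = (1 - t) / (1 - Q t).
FactorIdentity : (R : CommutativeRing 0ℓ 0ℓ) (q t : CommutativeRing.Carrier R) →
                 (ℕ → ℕ → CommutativeRing.Carrier R) → Set
FactorIdentity R q t fac = ∀ h k → q ^ h * t ^ k * fac h k * t + 1# ≈ fac h k + t
  where
  open CommutativeRing R
  open Exp semiring using (_^_)

-- Laurent polynomials over a commutative ring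

-- At R = ℚ(q,t) the operations below are definitionally those of Defs, except that
-- coeff and π agree with theirs only propositionally and up to ≋.
module LaurentPolynomials (R : CommutativeRing 0ℓ 0ℓ) where

  module K where
    open CommutativeRing R public
    open Exp semiring public using (_^_)

  K : Set
  K = K.Carrier

  Laurent : ℕ → Set
  Laurent n = List (K × Exponent n)

  module _ {n : ℕ} where

    coeff : Laurent n → Exponent n → K
    coeff []            m = K.0#
    coeff ((c , e) ∷ f) m = if does (e ≟ᵉ m) then c K.+ coeff f m else coeff f m

    infixl 6 _+ᴸ_
    infixr 7 _•_

    _+ᴸ_ : Laurent n → Laurent n → Laurent n
    _+ᴸ_ = _++_

    _•_ : K → Laurent n → Laurent n
    c • f  = map (λ (d , e) → c K.* d , e) f

    1ᴸ : Laurent n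
    1ᴸ = [ K.1# , (λ _ → 0ℤ) ]

    infix 4 _≋_

    -- A record rather than a function type, so that f and g can be inferred from the type of a
    -- proof.
    record _≋_ (f g : Laurent n) : Set where
      constructor mk≋
      field at : ∀ m → coeff f m K.≈ coeff g m

    open _≋_ public

    ≋-refl : ∀ {f} → f ≋ f
    ≋-refl .at m = K.refl

    ≋-sym : ∀ {f g} → f ≋ g → g ≋ f
    ≋-sym e .at m = K.sym (e .at m)

    ≋-trans : ∀ {f g h} → f ≋ g → g ≋ h → f ≋ h
    ≋-trans e e′ .at m = K.trans (e .at m) (e′ .at m)

    ≋-reflexive : ∀ {f g} → f ≡ g → f ≋ g
    ≋-reflexive ≡.refl = ≋-refl

    ≋-setoid : Setoid 0ℓ 0ℓ
    ≋-setoid = record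
      { Carrier = Laurent n ; _≈_ = _≋_
      ; isEquivalence = record { refl = ≋-refl ; sym = ≋-sym ; trans = ≋-trans } }

    ≟ᵉ-cong : ∀ {e e′ m m′ : Exponent n} →
              (e ≗ m → e′ ≗ m′) → (e′ ≗ m′ → e ≗ m) → does (e ≟ᵉ m) ≡ does (e′ ≟ᵉ m′)
    ≟ᵉ-cong {e} {e′} {m} {m′} to from = does-⇔ (mk⇔ to from) (e ≟ᵉ m) (e′ ≟ᵉ m′)

    private
      prepend : Bool → K → K → K
      prepend b c r = if b then c K.+ r else r

      prepend-cong : ∀ {b b′ c r r′} → b ≡ b′ → r K.≈ r′ → prepend b c r K.≈ prepend b′ c r′
      prepend-cong {true}  ≡.refl r≈r′ = K.+-congˡ r≈r′
      prepend-cong {false} ≡.refl r≈r′ = r≈r′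

      prepend-+ : ∀ b {c r r₁ r₂} → r K.≈ r₁ K.+ r₂ → prepend b c r K.≈ prepend b c r₁ K.+ r₂
      prepend-+ true  e = K.trans (K.+-congˡ e) (K.sym (K.+-assoc _ _ _))
      prepend-+ false e = e

      prepend-* : ∀ {P : Set} {b k c c′ r r′} (P? : Dec P) → b ≡ does P? →
                  (P → c K.≈ k K.* c′) → r K.≈ k K.* r′ →
                  prepend b c r K.≈ k K.* prepend (does P?) c′ r′
      prepend-* {k = k} (yes p) ≡.refl c≈ r≈ = K.trans (K.+-cong (c≈ p) r≈) (K.sym (K.distribˡ k _ _))
      prepend-* (no _)  ≡.refl c≈ r≈ = r≈

    coeff-cong : ∀ f {m m′} → m ≗ m′ → coeff f m K.≈ coeff f m′
    coeff-cong []            p = K.refl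
    coeff-cong ((c , e) ∷ f) p = prepend-cong
      (≟ᵉ-cong (λ r k → ≡.trans (r k) (p k)) (λ r k → ≡.trans (r k) (≡.sym (p k))))
      (coeff-cong f p)

    coeff-+ : ∀ (f g : Laurent n) m → coeff (f +ᴸ g) m K.≈ coeff f m K.+ coeff g m
    coeff-+ []            g m = K.sym (K.+-identityˡ _)
    coeff-+ ((c , e) ∷ f) g m = prepend-+ (does (e ≟ᵉ m)) (coeff-+ f g m)

    -- A term of the image lies over m exactly if its origin lies over m′, so the same terms are
    -- collected on both sides. Scaling, multiplication by a monomial, exchange of variables and the
    -- cyclic shift are all instances.
    coeff-map : (G : K → Exponent n → K) (φ : Exponent n → Exponent n) {k : K} {m m′ : Exponent n} →
                (∀ e → e ≗ m′ → φ e ≗ m) → (∀ e → φ e ≗ m → e ≗ m′) →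
                (∀ c e → e ≗ m′ → G c e K.≈ k K.* c) →
                ∀ f → coeff (map (λ (c , e) → G c e , φ e) f) m K.≈ k K.* coeff f m′
    coeff-map G φ {k} to from G≈ [] = K.sym (K.zeroʳ k)
    coeff-map G φ {k} {m} {m′} to from G≈ ((c , e) ∷ f) = prepend-* (e ≟ᵉ m′)
      (≟ᵉ-cong (from e) (to e)) (G≈ c e) (coeff-map G φ to from G≈ f)

    -- Exponents are functions, so lists that agree term by term cannot be identified by
    -- propositional equality; this is the substitute.
    ≋-pointwise : ∀ {f g : Laurent n} → Pointwise (λ (c , e) (c′ , e′) → c ≡ c′ × e ≗ e′) f g → f ≋ g
    ≋-pointwise [] .at m = K.refl
    ≋-pointwise (_∷_ {x = c , e} {y = c′ , e′} (c≡ , e≗) p) .at m = K.trans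
      (prepend-cong (≟ᵉ-cong {e} {e′} {m} {m} (λ r k → ≡.trans (≡.sym (e≗ k)) (r k)) (λ r k → ≡.trans (e≗ k) (r k)))
        (≋-pointwise p .at m))
      (K.reflexive (≡.cong (λ c → prepend (does (e′ ≟ᵉ m)) c _) c≡))

    coeff-• : ∀ k (f : Laurent n) m → coeff (k • f) m K.≈ k K.* coeff f m
    coeff-• k f m = coeff-map (λ c _ → k K.* c) id (λ _ p → p) (λ _ p → p) (λ _ _ _ → K.refl) f

    coeff-map-exponents : (φ : Exponent n → Exponent n) {m m′ : Exponent n} →
                          (∀ e → e ≗ m′ → φ e ≗ m) → (∀ e → φ e ≗ m → e ≗ m′) →
                          ∀ f → coeff (map (λ (c , e) → c , φ e) f) m K.≈ coeff f m′
    coeff-map-exponents φ to from f = K.trans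
      (coeff-map (λ c _ → c) φ to from (λ c _ _ → K.sym (K.*-identityˡ c)) f) (K.*-identityˡ _)

    +-cong : ∀ {f f′ g g′ : Laurent n} → f ≋ f′ → g ≋ g′ → f +ᴸ g ≋ f′ +ᴸ g′
    +-cong {f} {f′} {g} {g′} p r .at m = begin
      coeff (f +ᴸ g) m            ≈⟨ coeff-+ f g m ⟩
      coeff f m K.+ coeff g m     ≈⟨ K.+-cong (p .at m) (r .at m) ⟩
      coeff f′ m K.+ coeff g′ m   ≈⟨ coeff-+ f′ g′ m ⟨
      coeff (f′ +ᴸ g′) m          ∎
      where open SetoidReasoning K.setoid

    +-comm : ∀ (f g : Laurent n) → f +ᴸ g ≋ g +ᴸ f
    +-comm f g .at m = K.trans (coeff-+ f g m) (K.trans (K.+-comm _ _) (K.sym (coeff-+ g f m)))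

    +-commutativeMonoid : CommutativeMonoid 0ℓ 0ℓ
    +-commutativeMonoid = record
      { Carrier = Laurent n ; _≈_ = _≋_ ; _∙_ = _+ᴸ_ ; ε = []
      ; isCommutativeMonoid = record
        { isMonoid = record
          { isSemigroup = record
            { isMagma = record
              { isEquivalence = Setoid.isEquivalence ≋-setoid ; ∙-cong = +-cong }
            ; assoc = λ f g h → ≋-reflexive (List.++-assoc f g h) }
          ; identity = (λ f → ≋-refl) , λ f → ≋-reflexive (List.++-identityʳ f) }
        ; comm = +-comm } }

    •-cong : ∀ {a b} {f g : Laurent n} → a K.≈ b → f ≋ g → a • f ≋ b • g
    •-cong {a} {b} {f} {g} p r .at m = K.trans (coeff-• a f m)
      (K.trans (K.*-cong p (r .at m)) (K.sym (coeff-• b g m)))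

    •-distrib-+ : ∀ a (f g : Laurent n) → a • (f +ᴸ g) ≋ a • f +ᴸ a • g
    •-distrib-+ a f g = ≋-reflexive (List.map-++ _ f g)

    •-assoc : ∀ a b (f : Laurent n) → (a K.* b) • f ≋ a • (b • f)
    •-assoc a b f .at m = begin
      coeff ((a K.* b) • f) m   ≈⟨ coeff-• (a K.* b) f m ⟩
      a K.* b K.* coeff f m     ≈⟨ K.*-assoc a b _ ⟩
      a K.* (b K.* coeff f m)   ≈⟨ K.*-congˡ (coeff-• b f m) ⟨
      a K.* coeff (b • f) m     ≈⟨ coeff-• a (b • f) m ⟨
      coeff (a • (b • f)) m     ∎
      where open SetoidReasoning K.setoid

    •-comm : ∀ a b (f : Laurent n) → a • (b • f) ≋ b • (a • f)
    •-comm a b f = ≋-trans (≋-sym (•-assoc a b f))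
      (≋-trans (•-cong (K.*-comm a b) ≋-refl) (•-assoc b a f))

    1• : ∀ (f : Laurent n) → K.1# • f ≋ f
    1• f .at m = K.trans (coeff-• K.1# f m) (K.*-identityˡ _)

    0• : ∀ (f : Laurent n) → K.0# • f ≋ []
    0• f .at m = K.trans (coeff-• K.0# f m) (K.zeroˡ _)

    singleton : ∀ {c c′} {e e′ : Exponent n} → c K.≈ c′ → e ≗ e′ → [ c , e ] ≋ [ c′ , e′ ]
    singleton {c} {c′} {e} {e′} p r .at m = K.trans
      (prepend-cong {c = c} (≟ᵉ-cong {e} {e′} {m} {m} (λ s k → ≡.trans (≡.sym (r k)) (s k)) (λ s k → ≡.trans (r k) (s k))) K.refl)
      (prepend-congˡ (does (e′ ≟ᵉ m)))
      where
      prepend-congˡ : ∀ b → prepend b c K.0# K.≈ prepend b c′ K.0#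
      prepend-congˡ true  = K.+-congʳ p
      prepend-congˡ false = K.refl

    singleton-zero : ∀ {c} {e : Exponent n} → c K.≈ K.0# → [ c , e ] ≋ []
    singleton-zero {c} {e} p .at m = vanish (does (e ≟ᵉ m))
      where
      vanish : ∀ b → prepend b c K.0# K.≈ K.0#
      vanish true  = K.trans (K.+-identityʳ c) p
      vanish false = K.refl

    δ : Fin n → Exponent n
    δ u k = if does (u Fin.≟ k) then 1ℤ else 0ℤ

    -- Multiplication by the variable x_u.
    X : Fin n → Laurent n → Laurent n
    X u = map λ (c , e) → c , λ k → δ u k ℤ.+ e k

    coeff-X : ∀ u f m → coeff (X u f) m K.≈ coeff f (λ k → m k ℤ.- δ u k)
    coeff-X u f m = coeff-map-exponents _ to from f
      where
      cancel : ∀ d e → d ℤ.+ (e ℤ.- d) ≡ e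
      cancel = ℤSolver.solve-∀
      cancel′ : ∀ d e → e ≡ d ℤ.+ e ℤ.- d
      cancel′ = ℤSolver.solve-∀
      to : ∀ e → e ≗ (λ k → m k ℤ.- δ u k) → (λ k → δ u k ℤ.+ e k) ≗ m
      to e p k = ≡.trans (≡.cong (λ z → δ u k ℤ.+ z) (p k)) (cancel (δ u k) (m k))
      from : ∀ e → (λ k → δ u k ℤ.+ e k) ≗ m → e ≗ (λ k → m k ℤ.- δ u k)
      from e p k = ≡.trans (cancel′ (δ u k) (e k)) (≡.cong (λ z → z ℤ.- δ u k) (p k))

    X-cong : ∀ u {f g} → f ≋ g → X u f ≋ X u g
    X-cong u {f} {g} p .at m = K.trans (coeff-X u f m) (K.trans (p .at _) (K.sym (coeff-X u g m)))

    X-+ : ∀ u f g → X u (f +ᴸ g) ≋ X u f +ᴸ X u g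
    X-+ u f g = ≋-reflexive (List.map-++ _ f g)

    X-• : ∀ u a f → X u (a • f) ≋ a • X u f
    X-• u a f = ≋-reflexive (≡.trans (≡.sym (List.map-∘ f)) (List.map-∘ f))

    X-comm : ∀ u v f → X u (X v f) ≋ X v (X u f)
    X-comm u v f .at m = begin
      coeff (X u (X v f)) m                    ≈⟨ coeff-X u (X v f) m ⟩
      coeff (X v f) (λ k → m k ℤ.- δ u k)        ≈⟨ coeff-X v f _ ⟩
      coeff f (λ k → m k ℤ.- δ u k ℤ.- δ v k)      ≈⟨ coeff-cong f (λ k → swap (m k) (δ u k) (δ v k)) ⟩
      coeff f (λ k → m k ℤ.- δ v k ℤ.- δ u k)      ≈⟨ coeff-X u f _ ⟨
      coeff (X u f) (λ k → m k ℤ.- δ v k)        ≈⟨ coeff-X v (X u f) m ⟨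
      coeff (X v (X u f)) m                    ∎
      where
      open SetoidReasoning K.setoid
      swap : ∀ a b c → a ℤ.- b ℤ.- c ≡ a ℤ.- c ℤ.- b
      swap = ℤSolver.solve-∀

  module ≋-Reasoning {n} = SetoidReasoning (≋-setoid {n})

-- Demazure–Lusztig operators

transpose-left : ∀ {n} (i k : Fin n) → FinPerm.transpose i k ⟨$⟩ʳ i ≡ k
transpose-left i k rewrite dec-true (i Fin.≟ i) ≡.refl = ≡.refl

transpose-right : ∀ {n} (i k : Fin n) → FinPerm.transpose i k ⟨$⟩ʳ k ≡ i
transpose-right i k with k Fin.≟ i
... | yes k≡i = k≡i
... | no  _ rewrite dec-true (k Fin.≟ k) ≡.refl = ≡.refl

transpose-other : ∀ {n} {i k u : Fin n} → u ≢ i → u ≢ k → FinPerm.transpose i k ⟨$⟩ʳ u ≡ u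
transpose-other {i = i} {k} {u} u≢i u≢k
  rewrite dec-false (u Fin.≟ i) u≢i | dec-false (u Fin.≟ k) u≢k = ≡.refl

module DemazureLusztig (R : CommutativeRing 0ℓ 0ℓ) {m : ℕ} (j : Fin m)
  (t t⁻¹ : CommutativeRing.Carrier R) (t⁻¹t≈1 : Inverse R t⁻¹ t) where

  open LaurentPolynomials R
  open RingIdentities R

  n : ℕ
  n = suc m

  a b : Fin n
  a = inject₁ j
  b = suc j

  Other : Fin n → Set
  Other u = u ≢ a × u ≢ b

  a≢b : a ≢ b
  a≢b a≡b = ℕ.1+n≢n (≡.trans (≡.sym (≡.cong toℕ a≡b)) (Fin.toℕ-inject₁ j))

  open Sum (+-commutativeMonoid {n}) using (sum; sum-cong-≋)

  σ : Permutation′ n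
  σ = FinPerm.transpose a b

  s : Laurent n → Laurent n
  s = map λ (c , e) → c , λ k → e (σ ⟨$⟩ʳ k)

  coeff-s : ∀ f m → coeff (s f) m K.≈ coeff f (λ k → m (σ ⟨$⟩ˡ k))
  coeff-s f m = coeff-map-exponents _
    (λ e p k → ≡.trans (p _) (≡.cong m (FinPerm.inverseˡ σ)))
    (λ e p k → ≡.trans (≡.cong e (≡.sym (FinPerm.inverseʳ σ))) (p _)) f

  s-cong : ∀ {f g} → f ≋ g → s f ≋ s g
  s-cong {f} {g} p .at m = K.trans (coeff-s f m) (K.trans (p .at _) (K.sym (coeff-s g m)))

  s-+ : ∀ f g → s (f +ᴸ g) ≋ s f +ᴸ s g
  s-+ f g = ≋-reflexive (List.map-++ _ f g)

  s-• : ∀ c f → s (c • f) ≋ c • s f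
  s-• c f = ≋-reflexive (≡.trans (≡.sym (List.map-∘ f)) (List.map-∘ f))

  s-X : ∀ u v f → σ ⟨$⟩ʳ v ≡ u → s (X u f) ≋ X v (s f)
  s-X u v f σv≡u .at m = begin
    coeff (s (X u f)) m                               ≈⟨ coeff-s (X u f) m ⟩
    coeff (X u f) (λ k → m (σ ⟨$⟩ˡ k))                ≈⟨ coeff-X u f _ ⟩
    coeff f (λ k → m (σ ⟨$⟩ˡ k) ℤ.- δ u k)            ≈⟨ coeff-cong f (λ k → ≡.cong (λ d → m (σ ⟨$⟩ˡ k) ℤ.- (if d then 1ℤ else 0ℤ)) (same k)) ⟩
    coeff f (λ k → m (σ ⟨$⟩ˡ k) ℤ.- δ v (σ ⟨$⟩ˡ k))   ≈⟨ coeff-s f _ ⟨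
    coeff (s f) (λ k → m k ℤ.- δ v k)                 ≈⟨ coeff-X v (s f) m ⟨
    coeff (X v (s f)) m                               ∎
    where
    open SetoidReasoning K.setoid
    same : ∀ k → does (u Fin.≟ k) ≡ does (v Fin.≟ σ ⟨$⟩ˡ k)
    same k = does-⇔ (mk⇔
      (λ u≡k → ≡.trans (≡.sym (FinPerm.inverseˡ σ)) (≡.cong (σ ⟨$⟩ˡ_) (≡.trans σv≡u u≡k)))
      (λ v≡ → ≡.trans (≡.sym σv≡u) (≡.trans (≡.cong (σ ⟨$⟩ʳ_) v≡) (FinPerm.inverseʳ σ))))
      (u Fin.≟ k) (v Fin.≟ σ ⟨$⟩ˡ k)

  s-Xa : ∀ f → s (X a f) ≋ X b (s f)
  s-Xa f = s-X a b f (transpose-right a b)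

  s-Xb : ∀ f → s (X b f) ≋ X a (s f)
  s-Xb f = s-X b a f (transpose-left a b)

  s-Xother : ∀ u f → Other u → s (X u f) ≋ X u (s f)
  s-Xother u f (u≢a , u≢b) = s-X u u f (transpose-other u≢a u≢b)

  Symmetric : Laurent n → Set
  Symmetric f = s f ≋ f

  symmetric-+ : ∀ {f g} → Symmetric f → Symmetric g → Symmetric (f +ᴸ g)
  symmetric-+ {f} {g} p r = ≋-trans (s-+ f g) (+-cong p r)

  symmetric-• : ∀ c {f} → Symmetric f → Symmetric (c • f)
  symmetric-• c {f} p = ≋-trans (s-• c f) (•-cong K.refl p)

  symmetric-X : ∀ u {f} → Other u → Symmetric f → Symmetric (X u f)
  symmetric-X u {f} o p = ≋-trans (s-Xother u f o) (X-cong u p)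

  symmetric-XaXb : ∀ {f} → Symmetric f → Symmetric (X a (X b f))
  symmetric-XaXb {f} p = ≋-trans (s-Xa (X b f)) (≋-trans (X-cong b (≋-trans (s-Xb f) (X-cong a p))) (X-comm b a f))

  symmetric-Xa+Xb : ∀ {f} → Symmetric f → Symmetric (X a f +ᴸ X b f)
  symmetric-Xa+Xb {f} p = ≋-trans (s-+ (X a f) (X b f))
    (≋-trans (+-cong (≋-trans (s-Xa f) (X-cong b p)) (≋-trans (s-Xb f) (X-cong a p))) (+-comm (X b f) (X a f)))

  -- The graph of the Demazure–Lusztig operator: every Laurent polynomial is
  -- A + x_a B with A and B symmetric in x_a, x_b, and T 1 = t, T x_a = x_b.
  infix 4 _↦_

  record _↦_ (f g : Laurent n) : Set where
    field
      A B     : Laurent n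
      A-sym   : Symmetric A
      B-sym   : Symmetric B
      source  : f ≋ A +ᴸ X a B
      target  : g ≋ t • A +ᴸ X b B

  open _↦_

  ↦-resp : ∀ {f f′ g g′} → f ≋ f′ → g ≋ g′ → f ↦ g → f′ ↦ g′
  ↦-resp p r T = record
    { A = A T ; B = B T ; A-sym = A-sym T ; B-sym = B-sym T
    ; source = ≋-trans (≋-sym p) (source T) ; target = ≋-trans (≋-sym r) (target T) }

  ↦-symmetric : ∀ {f} → Symmetric f → f ↦ t • f
  ↦-symmetric {f} p = record
    { A = f ; B = [] ; A-sym = p ; B-sym = ≋-refl
    ; source = ≋-sym (≋-reflexive (List.++-identityʳ f))
    ; target = ≋-sym (≋-reflexive (List.++-identityʳ (t • f))) }

  ↦-zero : [] ↦ []
  ↦-zero = ↦-symmetric {[]} ≋-refl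

  ↦-one : 1ᴸ ↦ t • 1ᴸ
  ↦-one = ↦-symmetric {1ᴸ} ≋-refl

  +-interchange : ∀ (f g h k : Laurent n) → (f +ᴸ g) +ᴸ (h +ᴸ k) ≋ (f +ᴸ h) +ᴸ (g +ᴸ k)
  +-interchange f g h k .at m = begin
    coeff ((f +ᴸ g) +ᴸ (h +ᴸ k)) m   ≈⟨ expand f g h k ⟩
    (coeff f m K.+ coeff g m) K.+ (coeff h m K.+ coeff k m) ≈⟨ interchange _ _ _ _ ⟩
    (coeff f m K.+ coeff h m) K.+ (coeff g m K.+ coeff k m) ≈⟨ expand f h g k ⟨
    coeff ((f +ᴸ h) +ᴸ (g +ᴸ k)) m   ∎
    where
    open SetoidReasoning K.setoid
    expand : ∀ f g h k → coeff ((f +ᴸ g) +ᴸ (h +ᴸ k)) m K.≈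
             (coeff f m K.+ coeff g m) K.+ (coeff h m K.+ coeff k m)
    expand f g h k = K.trans (coeff-+ (f +ᴸ g) (h +ᴸ k) m) (K.+-cong (coeff-+ f g m) (coeff-+ h k m))

  ↦-+ : ∀ {f f′ g g′} → f ↦ g → f′ ↦ g′ → f +ᴸ f′ ↦ g +ᴸ g′
  ↦-+ T T′ = record
    { A = A T +ᴸ A T′ ; B = B T +ᴸ B T′
    ; A-sym = symmetric-+ {A T} {A T′} (A-sym T) (A-sym T′) ; B-sym = symmetric-+ {B T} {B T′} (B-sym T) (B-sym T′)
    ; source = ≋-trans (+-cong (source T) (source T′)) (≋-trans (+-interchange (A T) _ (A T′) _)
        (+-cong ≋-refl (≋-sym (X-+ a (B T) (B T′)))))
    ; target = ≋-trans (+-cong (target T) (target T′)) (≋-trans (+-interchange (t • A T) _ (t • A T′) _)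
        (+-cong (≋-sym (•-distrib-+ t (A T) _)) (≋-sym (X-+ b (B T) (B T′))))) }

  ↦-• : ∀ c {f g} → f ↦ g → c • f ↦ c • g
  ↦-• c T = record
    { A = c • A T ; B = c • B T ; A-sym = symmetric-• c (A-sym T) ; B-sym = symmetric-• c (B-sym T)
    ; source = ≋-trans (•-cong K.refl (source T)) (≋-trans (•-distrib-+ c (A T) _)
        (+-cong ≋-refl (≋-sym (X-• a c (B T)))))
    ; target = ≋-trans (•-cong K.refl (target T)) (≋-trans (•-distrib-+ c (t • A T) _)
        (+-cong (•-comm c t (A T)) (≋-sym (X-• b c (B T))))) }

  -- A variable other than x_a and x_b is itself symmetric, so T is linear over it.
  ↦-X : ∀ {u f g} → Other u → f ↦ g → X u f ↦ X u g
  ↦-X {u} o T = record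
    { A = X u (A T) ; B = X u (B T) ; A-sym = symmetric-X u o (A-sym T) ; B-sym = symmetric-X u o (B-sym T)
    ; source = ≋-trans (X-cong u (source T)) (≋-trans (X-+ u (A T) _) (+-cong ≋-refl (X-comm u a (B T))))
    ; target = ≋-trans (X-cong u (target T)) (≋-trans (X-+ u (t • A T) _)
        (+-cong (X-• u t (A T)) (X-comm u b (B T)))) }

  t-cancel : ∀ (f : Laurent n) → t⁻¹ • (t • f) ≋ f
  t-cancel f = ≋-trans (≋-sym (•-assoc t⁻¹ t f)) (≋-trans (•-cong t⁻¹t≈1 ≋-refl) (1• f))

  ↦-cancel : ∀ {f g} → t • f ↦ t • g → f ↦ g
  ↦-cancel {f} {g} T = ↦-resp (t-cancel f) (t-cancel g) (↦-• t⁻¹ T)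

  -- T x_a T = t x_b
  ↦-twist : ∀ {f g} → f ↦ g → X a g ↦ t • X b f
  ↦-twist {f} {g} T = record
    -- From g = tA + x_b B one gets x_a g = x_a x_b B + x_a (tA): the roles of A and B are
    -- exchanged.
    { A = X a (X b (B T)) ; B = t • A T
    ; A-sym = symmetric-XaXb (B-sym T) ; B-sym = symmetric-• t (A-sym T)
    ; source = ≋-trans (X-cong a (target T)) (≋-trans (X-+ a (t • A T) _) (+-comm (X a (t • A T)) _))
    ; target = begin
        t • X b f                                   ≈⟨ •-cong K.refl (X-cong b (source T)) ⟩
        t • X b (A T +ᴸ X a (B T))                  ≈⟨ •-cong K.refl (X-+ b (A T) _) ⟩
        t • (X b (A T) +ᴸ X b (X a (B T)))          ≈⟨ •-distrib-+ t (X b (A T)) _ ⟩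
        t • X b (A T) +ᴸ t • X b (X a (B T))        ≈⟨ +-comm (t • X b (A T)) _ ⟩
        t • X b (X a (B T)) +ᴸ t • X b (A T)        ≈⟨ +-cong (•-cong K.refl (X-comm b a (B T))) (≋-sym (X-• b t (A T))) ⟩
        t • X a (X b (B T)) +ᴸ X b (t • A T)        ∎ }
    where open ≋-Reasoning

  -- The quadratic relation (T - t)(T + 1) = 0, with the scalars shifted.
  ↦-shear : ∀ {f g} (c d k : K) → c K.≈ K.1# K.+ k → d K.* t K.≈ k K.+ t →
            f ↦ g → c • f +ᴸ g ↦ t • (f +ᴸ d • g)
  ↦-shear {f} {g} c d k c≈ dt≈ T = record
    { A = A′ ; B = k • B T
    ; A-sym = symmetric-+ {P +ᴸ (xa +ᴸ xb)} {(k K.+ t) • P} (symmetric-+ {P} {xa +ᴸ xb} (A-sym T) (symmetric-Xa+Xb (B-sym T)))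
        (symmetric-• (k K.+ t) (A-sym T))
    ; B-sym = symmetric-• k (B-sym T)
    ; source = ≋-trans (+-cong (•-cong K.refl (source T)) (target T)) eq₁
    ; target = ≋-trans (•-cong K.refl (+-cong (source T) (•-cong K.refl (target T)))) eq₂ }
    where
    open SetoidReasoning K.setoid
    P A′ xa xb : Laurent n
    P = A T
    xa = X a (B T)
    xb = X b (B T)
    -- The source is (1 + k + t)P + (x_a + x_b)B + k x_a B; all but the last term is symmetric.
    A′ = P +ᴸ (xa +ᴸ xb) +ᴸ (k K.+ t) • P
    A′-coeff : ∀ m → coeff A′ m K.≈ coeff P m K.+ (coeff xa m K.+ coeff xb m) K.+ (k K.+ t) K.* coeff P m
    A′-coeff m = K.trans (coeff-+ (P +ᴸ (xa +ᴸ xb)) _ m)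
      (K.+-cong (K.trans (coeff-+ P _ m) (K.+-congˡ (coeff-+ xa xb m))) (coeff-• _ P m))
    tP+xb : ∀ m → coeff (t • P +ᴸ xb) m K.≈ t K.* coeff P m K.+ coeff xb m
    tP+xb m = K.trans (coeff-+ (t • P) xb m) (K.+-congʳ (coeff-• t P m))
    eq₁ : c • (P +ᴸ xa) +ᴸ (t • P +ᴸ xb) ≋ A′ +ᴸ X a (k • B T)
    eq₁ .at m = begin
      coeff (c • (P +ᴸ xa) +ᴸ (t • P +ᴸ xb)) m
        ≈⟨ coeff-+ (c • (P +ᴸ xa)) _ m ⟩
      coeff (c • (P +ᴸ xa)) m K.+ coeff (t • P +ᴸ xb) m
        ≈⟨ K.+-cong (K.trans (coeff-• c (P +ᴸ xa) m) (K.*-congˡ (coeff-+ P xa m))) (tP+xb m) ⟩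
      c K.* (coeff P m K.+ coeff xa m) K.+ (t K.* coeff P m K.+ coeff xb m)
        ≈⟨ shear₁ _ _ _ c≈ ⟩
      (coeff P m K.+ (coeff xa m K.+ coeff xb m) K.+ (k K.+ t) K.* coeff P m) K.+ k K.* coeff xa m
        ≈⟨ K.+-cong (A′-coeff m) (coeff-• k xa m) ⟨
      coeff A′ m K.+ coeff (k • xa) m
        ≈⟨ K.+-congˡ (X-• a k (B T) .at m) ⟨
      coeff A′ m K.+ coeff (X a (k • B T)) m
        ≈⟨ coeff-+ A′ _ m ⟨
      coeff (A′ +ᴸ X a (k • B T)) m ∎
    eq₂ : t • ((P +ᴸ xa) +ᴸ d • (t • P +ᴸ xb)) ≋ t • A′ +ᴸ X b (k • B T)
    eq₂ .at m = begin
      coeff (t • ((P +ᴸ xa) +ᴸ d • (t • P +ᴸ xb))) m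
        ≈⟨ coeff-• t ((P +ᴸ xa) +ᴸ d • (t • P +ᴸ xb)) m ⟩
      t K.* coeff ((P +ᴸ xa) +ᴸ d • (t • P +ᴸ xb)) m
        ≈⟨ K.*-congˡ (K.trans (coeff-+ (P +ᴸ xa) _ m) (K.+-cong (coeff-+ P xa m)
             (K.trans (coeff-• d (t • P +ᴸ xb) m) (K.*-congˡ (tP+xb m))))) ⟩
      t K.* ((coeff P m K.+ coeff xa m) K.+ d K.* (t K.* coeff P m K.+ coeff xb m))
        ≈⟨ shear₂ _ _ _ dt≈ ⟩
      t K.* (coeff P m K.+ (coeff xa m K.+ coeff xb m) K.+ (k K.+ t) K.* coeff P m) K.+ k K.* coeff xb m
        ≈⟨ K.+-cong (K.trans (coeff-• t A′ m) (K.*-congˡ (A′-coeff m))) (coeff-• k xb m) ⟨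
      coeff (t • A′) m K.+ coeff (k • xb) m
        ≈⟨ K.+-congˡ (X-• b k (B T) .at m) ⟨
      coeff (t • A′) m K.+ coeff (X b (k • B T)) m
        ≈⟨ coeff-+ (t • A′) _ m ⟨
      coeff (t • A′ +ᴸ X b (k • B T)) m ∎

  ↦-sum : ∀ {k} (f g : Vector (Laurent n) k) → (∀ i → f i ↦ g i) → sum f ↦ sum g
  ↦-sum {zero}  f g Tf = ↦-zero
  ↦-sum {suc k} f g Tf = ↦-+ (Tf zero) (↦-sum (f ∘ suc) (g ∘ suc) (Tf ∘ suc))

module _ (M : CommutativeMonoid 0ℓ 0ℓ) where

  open CommutativeMonoid M
  open Sum M using (sum; sum-remove)
  open SetoidReasoning setoid

  sum-remove₂ : ∀ {m} (i k : Fin (suc (suc m))) (i≢k : i ≢ k) f →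
                sum f ≈ (f i ∙ f k) ∙ sum (removeAt (removeAt f i) (punchOut i≢k))
  sum-remove₂ i k i≢k f = begin
    sum f                                                 ≈⟨ sum-remove {i = i} f ⟩
    f i ∙ sum (removeAt f i)                              ≈⟨ ∙-congˡ (sum-remove {i = punchOut i≢k} (removeAt f i)) ⟩
    f i ∙ (f (punchIn i (punchOut i≢k)) ∙ sum rest)       ≡⟨ ≡.cong (λ z → f i ∙ (f z ∙ sum rest)) (Fin.punchIn-punchOut i≢k) ⟩
    f i ∙ (f k ∙ sum rest)                                ≈⟨ assoc _ _ _ ⟨
    (f i ∙ f k) ∙ sum rest                                ∎
    where
    rest : Vector Carrier _
    rest = removeAt (removeAt f i) (punchOut i≢k)

-- The queue recursion

indicator : Bool → ℕ
indicator true  = 1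
indicator false = 0

coinversion-cong : ∀ {x y z x′ y′ z′} → x ≡ x′ → y ≡ y′ → z ≡ z′ →
                   does (x ℕ.+ y ℕ.≟ z) ≡ does (x′ ℕ.+ y′ ℕ.≟ z′)
coinversion-cong ≡.refl ≡.refl ≡.refl = ≡.refl

-- The last entry read in each column, paired with the number of boxes above it;
-- the column to be continued next is at the front.
Queue : ℕ → Set
Queue n = List (ℕ × Fin n)

module _ {n : ℕ} where

  χᵛ : Fin n → Fin n → ℕ
  χᵛ u v = if does (v Fin.<? u) then 1 else 0

  coinversion : Fin n → Fin n → Fin n → Bool
  coinversion u v w = does (χᵛ u v ℕ.+ χᵛ v w ℕ.≟ χᵛ u w)

  fresh : Fin n → Queue n → Bool
  fresh u []            = true
  fresh u ((_ , v) ∷ r) = not (does (u Fin.≟ v)) ∧ fresh u r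

  armCount : ℕ → Queue n → ℕ
  armCount h []             = 0
  armCount h ((h′ , v) ∷ r) = indicator (does (h′ ℕ.<? h)) ℕ.+ armCount h r

  coinvCount : ℕ → Fin n → Fin n → Queue n → ℕ
  coinvCount h u w []             = 0
  coinvCount h u w ((h′ , v) ∷ r) =
    indicator (does (h′ ℕ.<? h) ∧ coinversion u v w) ℕ.+ coinvCount h u w r

  Fresh : Fin n → Queue n → Set
  Fresh u = All λ (_ , v) → u ≢ v

  fresh-true : ∀ {u r} → Fresh u r → fresh u r ≡ true
  fresh-true []                      = ≡.refl
  fresh-true {u} {(_ , v) ∷ r} (u≢v ∷ f) rewrite dec-false (u Fin.≟ v) u≢v = fresh-true f

  true-fresh : ∀ {u} r → fresh u r ≡ true → Fresh u r
  true-fresh             []            _ = []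
  true-fresh {u = u} ((_ , v) ∷ r) e with u Fin.≟ v
  ... | no u≢v = u≢v ∷ true-fresh r e

  χᵛ-self : ∀ u → χᵛ u u ≡ 0
  χᵛ-self u rewrite dec-false (u Fin.<? u) (ℕ.<-irrefl ≡.refl) = ≡.refl

  χᵛ-total : ∀ {u v} → u ≢ v → χᵛ u v ℕ.+ χᵛ v u ≡ 1
  χᵛ-total {u} {v} u≢v with u Fin.<? v
  ... | yes u<v = ≡.cong₂ (λ x y → (if x then 1 else 0) ℕ.+ (if y then 1 else 0))
    (dec-false (v Fin.<? u) (ℕ.<-asym u<v)) (dec-true (u Fin.<? v) u<v)
  ... | no  u≮v = ≡.cong₂ (λ x y → (if x then 1 else 0) ℕ.+ (if y then 1 else 0))
    (dec-true (v Fin.<? u) (ℕ.≤∧≢⇒< (ℕ.≮⇒≥ u≮v) (u≢v ∘ ≡.sym ∘ Fin.toℕ-injective))) (dec-false (u Fin.<? v) u≮v)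

  -- Exactly one of χ_uv and χ_vu is 1, so their sum never equals χ_uu = 0.
  coinversion-self : ∀ {u v} → u ≢ v → coinversion u v u ≡ false
  coinversion-self {u} {v} u≢v rewrite χᵛ-total u≢v | χᵛ-self u = ≡.refl

  coinvCount-self : ∀ h {u r} → Fresh u r → coinvCount h u u r ≡ 0
  coinvCount-self h [] = ≡.refl
  coinvCount-self h {u} {(h′ , v) ∷ r} (u≢v ∷ f)
    rewrite coinversion-self u≢v | coinvCount-self h f with does (h′ ℕ.<? h)
  ... | true  = ≡.refl
  ... | false = ≡.refl

module QueueRecursion (R : CommutativeRing 0ℓ 0ℓ)
  (q t : CommutativeRing.Carrier R) (fac : ℕ → ℕ → CommutativeRing.Carrier R) (n : ℕ) where

  open LaurentPolynomials R
  open Sum (+-commutativeMonoid {n}) using (sum) public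

  boxWeight stepWeight : ℕ → Fin n → Queue n → Fin n → K
  boxWeight h w r u =
    q K.^ (if does (w Fin.<? u) then h else 0) K.* t K.^ coinvCount h u w r K.*
    (if does (u Fin.≟ w) then K.1# else fac h (armCount h r))
  stepWeight h w r u = if fresh u r then boxWeight h w r u else K.0#

  -- The first argument bounds the number of steps; the value is 0 when it is exhausted.
  F : ℕ → Queue n → Laurent n
  F zero    _                 = []
  F (suc k) []                = 1ᴸ
  F (suc k) ((zero  , w) ∷ r) = F k r
  F (suc k) ((suc h , w) ∷ r) = sum λ u → stepWeight (suc h) w r u • X u (F k (r ∷ʳ (h , u)))

  sum-• : ∀ c {N} (f : Vector (Laurent n) N) → c • sum f ≋ sum λ u → c • f u
  sum-• c {zero}  f = ≋-refl
  sum-• c {suc N} f = ≋-trans (•-distrib-+ c (f zero) (sum (f ∘ suc))) (+-cong ≋-refl (sum-• c (f ∘ suc)))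

  -- The common pattern of the weight comparisons in the exchange argument: freshness, descent, arm
  -- and repetition agree, and only the number of coinversions is shifted.
  stepWeight-scale : ∀ c {h u u′ w w′ r r′} →
    fresh u r ≡ fresh u′ r′ → does (w Fin.<? u) ≡ does (w′ Fin.<? u′) →
    coinvCount h u w r ≡ c ℕ.+ coinvCount h u′ w′ r′ → armCount h r ≡ armCount h r′ →
    does (u Fin.≟ w) ≡ does (u′ Fin.≟ w′) →
    stepWeight h w r u K.≈ t K.^ c K.* stepWeight h w′ r′ u′
  stepWeight-scale c {h} {u} {u′} {w} {w′} {r} {r′} p₁ p₂ p₃ p₄ p₅
    rewrite p₁ | p₂ | p₃ | p₄ | p₅ with fresh u′ r′
  ... | false = K.sym (K.zeroʳ _)
  ... | true  = begin
    Q K.* t K.^ (c ℕ.+ d) K.* e             ≈⟨ K.*-congʳ (K.*-congˡ (Exp.^-homo-* K.semiring t c d)) ⟩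
    Q K.* (t K.^ c K.* t K.^ d) K.* e       ≈⟨ K.*-congʳ (swap Q _ _) ⟩
    t K.^ c K.* (Q K.* t K.^ d) K.* e       ≈⟨ K.*-assoc _ _ _ ⟩
    t K.^ c K.* (Q K.* t K.^ d K.* e)       ∎
    where
    open SetoidReasoning K.setoid
    Q = q K.^ (if does (w′ Fin.<? u′) then h else 0)
    d = coinvCount h u′ w′ r′
    e = if does (u′ Fin.≟ w′) then K.1# else fac h (armCount h r′)
    swap : ∀ x y z → x K.* (y K.* z) K.≈ y K.* (x K.* z)
    swap x y z = K.trans (K.sym (K.*-assoc x y z)) (K.trans (K.*-congʳ (K.*-comm x y)) (K.*-assoc y x z))

  -- Repeating the entry below is free: it makes no descent, no coinversion and no factor.
  stepWeight-self : ∀ h w r → Fresh w r → stepWeight h w r w K.≈ K.1#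
  stepWeight-self h w r f
    rewrite fresh-true f | dec-false (w Fin.<? w) (ℕ.<-irrefl ≡.refl) | coinvCount-self h f
          | dec-true (w Fin.≟ w) ≡.refl = K.trans (K.*-identityʳ _) (K.*-identityˡ _)

  stepWeight-stale : ∀ h w r u → fresh u r ≡ false → stepWeight h w r u K.≈ K.0#
  stepWeight-stale h w r u f rewrite f = K.refl

-- Exchanging two adjacent entries of the queue

module BasementExchange (R : CommutativeRing 0ℓ 0ℓ)
  (q t t⁻¹ : CommutativeRing.Carrier R) (t⁻¹t≈1 : Inverse R t⁻¹ t)
  (fac : ℕ → ℕ → CommutativeRing.Carrier R)
  (fac-eq : FactorIdentity R q t fac)
  {m : ℕ} (j : Fin m) where

  open LaurentPolynomials R
  open QueueRecursion R q t fac (suc m)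
  open DemazureLusztig R j t t⁻¹ t⁻¹t≈1

  private
    j<b : toℕ a ℕ.< toℕ b
    j<b rewrite Fin.toℕ-inject₁ j = ℕ.≤-refl

  -- As b is the successor of a, no third value lies between them, and both compare alike with every
  -- other value.
  a<v≡b<v : ∀ {v} → Other v → does (a Fin.<? v) ≡ does (b Fin.<? v)
  a<v≡b<v {v} (_ , v≢b) = does-⇔ (mk⇔
    (λ a<v → ℕ.≤∧≢⇒< (≡.subst (ℕ._< toℕ v) (Fin.toℕ-inject₁ j) a<v) (v≢b ∘ ≡.sym ∘ Fin.toℕ-injective))
    (ℕ.<-trans j<b)) (a Fin.<? v) (b Fin.<? v)

  v<a≡v<b : ∀ {v} → Other v → does (v Fin.<? a) ≡ does (v Fin.<? b)
  v<a≡v<b {v} (v≢a , _) = does-⇔ (mk⇔ (λ v<a → ℕ.<-trans v<a j<b)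
    (λ v<b → ℕ.≤∧≢⇒< (≡.subst (toℕ v ℕ.≤_) (≡.sym (Fin.toℕ-inject₁ j)) (ℕ.≤-pred v<b)) (v≢a ∘ Fin.toℕ-injective)))
    (v Fin.<? a) (v Fin.<? b)

  b<a≡false : does (b Fin.<? a) ≡ false
  b<a≡false = dec-false (b Fin.<? a) (ℕ.<-asym j<b)

  a<b≡true : does (a Fin.<? b) ≡ true
  a<b≡true = dec-true (a Fin.<? b) j<b

  χᵛ-va≡vb : ∀ {v} → Other v → χᵛ v a ≡ χᵛ v b
  χᵛ-va≡vb o = ≡.cong (λ d → if d then 1 else 0) (a<v≡b<v o)

  χᵛ-av≡bv : ∀ {v} → Other v → χᵛ a v ≡ χᵛ b v
  χᵛ-av≡bv o = ≡.cong (λ d → if d then 1 else 0) (v<a≡v<b o)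

  χᵛ-ab : χᵛ a b ≡ 0
  χᵛ-ab = ≡.cong (λ d → if d then 1 else 0) b<a≡false

  χᵛ-ba : χᵛ b a ≡ 1
  χᵛ-ba = ≡.cong (λ d → if d then 1 else 0) a<b≡true

  coinversion-mid : ∀ {u w} → Other u → Other w → coinversion u b w ≡ coinversion u a w
  coinversion-mid {u} {w} o o′ = coinversion-cong (≡.sym (χᵛ-va≡vb o)) (≡.sym (χᵛ-av≡bv o′)) (≡.refl {x = χᵛ u w})

  coinversion-top : ∀ {v w} → Other v → Other w → coinversion a v w ≡ coinversion b v w
  coinversion-top {v} {w} o o′ = coinversion-cong (χᵛ-av≡bv o) (≡.refl {x = χᵛ v w}) (χᵛ-av≡bv o′)

  coinversion-bottom : ∀ {u v} → Other u → Other v → coinversion u v b ≡ coinversion u v a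
  coinversion-bottom {u} {v} o o′ = coinversion-cong (≡.refl {x = χᵛ u v}) (≡.sym (χᵛ-va≡vb o′)) (≡.sym (χᵛ-va≡vb o))

  -- Since a third value compares alike with a and b, a triple containing both is decided by where
  -- the two stand. In this and the next five lemmas, exchanging them turns a coinversion triple
  -- into one that is not, or back.
  coinversion-abw : ∀ {w} → Other w → coinversion a b w ≡ true
  coinversion-abw {w} o = ≡.trans (coinversion-cong χᵛ-ab (≡.refl {x = χᵛ b w}) (χᵛ-av≡bv o))
    (dec-true (χᵛ b w ℕ.≟ χᵛ b w) ≡.refl)

  coinversion-baw : ∀ {w} → Other w → coinversion b a w ≡ false
  coinversion-baw {w} o = ≡.trans (coinversion-cong χᵛ-ba (χᵛ-av≡bv o) (≡.refl {x = χᵛ b w}))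
    (dec-false (suc (χᵛ b w) ℕ.≟ χᵛ b w) ℕ.1+n≢n)

  coinversion-uab : ∀ {u} → Other u → coinversion u a b ≡ true
  coinversion-uab {u} o = ≡.trans (coinversion-cong (χᵛ-va≡vb o) χᵛ-ab (≡.refl {x = χᵛ u b}))
    (dec-true (χᵛ u b ℕ.+ 0 ℕ.≟ χᵛ u b) (ℕ.+-identityʳ _))

  coinversion-uba : ∀ {u} → Other u → coinversion u b a ≡ false
  coinversion-uba {u} o = ≡.trans (coinversion-cong (≡.refl {x = χᵛ u b}) χᵛ-ba (χᵛ-va≡vb o))
    (dec-false (χᵛ u b ℕ.+ 1 ℕ.≟ χᵛ u b) (ℕ.1+n≢n ∘ ≡.trans (ℕ.+-comm 1 _)))

  coinversion-bva : ∀ {v} → Other v → coinversion b v a ≡ true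
  coinversion-bva {v} o = ≡.trans (coinversion-cong (≡.sym (χᵛ-av≡bv o)) (≡.refl {x = χᵛ v a}) χᵛ-ba)
    (≡.cong (λ k → does (k ℕ.≟ 1)) (χᵛ-total (proj₁ o ∘ ≡.sym)))

  coinversion-avb : ∀ {v} → Other v → coinversion a v b ≡ false
  coinversion-avb {v} o = ≡.trans (coinversion-cong (≡.refl {x = χᵛ a v}) (≡.sym (χᵛ-va≡vb o)) χᵛ-ab)
    (≡.cong (λ k → does (k ℕ.≟ 0)) (χᵛ-total (proj₁ o ∘ ≡.sym)))

  None : Queue n → Set
  None = All λ (_ , v) → Other v

  -- The direction, b in the first queue and a in the second, is what remains of `Two` when its
  -- front column is complete and dropped.
  data One (k : ℕ) : Queue n → Queue n → Set where
    here  : ∀ {r} → None r → One k ((k , b) ∷ r) ((k , a) ∷ r)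
    there : ∀ {h v r r′} → Other v → One k r r′ → One k ((h , v) ∷ r) ((h , v) ∷ r′)

  data Two (k l : ℕ) : Queue n → Queue n → Set where
    here  : ∀ {r r′} → One l r r′ → Two k l ((k , a) ∷ r) ((k , b) ∷ r′)
    there : ∀ {h v r r′} → Other v → Two k l r r′ → Two k l ((h , v) ∷ r) ((h , v) ∷ r′)

  none-∷ʳ : ∀ {h u r} → None r → Other u → None (r ∷ʳ (h , u))
  none-∷ʳ p o = All.∷ʳ⁺ p o

  one-∷ʳ : ∀ {k h u r r′} → One k r r′ → Other u → One k (r ∷ʳ (h , u)) (r′ ∷ʳ (h , u))
  one-∷ʳ (here p)     o = here (none-∷ʳ p o)
  one-∷ʳ (there o′ p) o = there o′ (one-∷ʳ p o)

  two-∷ʳ : ∀ {k l h u r r′} → Two k l r r′ → Other u → Two k l (r ∷ʳ (h , u)) (r′ ∷ʳ (h , u))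
  two-∷ʳ (here p)     o = here (one-∷ʳ p o)
  two-∷ʳ (there o′ p) o = there o′ (two-∷ʳ p o)

  none⇒one : ∀ {h r} → None r → One h (r ∷ʳ (h , b)) (r ∷ʳ (h , a))
  none⇒one []      = here []
  none⇒one (o ∷ p) = there o (none⇒one p)

  -- Each queue receives the value it lacks. The pair so formed leads from r′ to r, against the
  -- direction of `One`; `↦-twist` is what turns it around again.
  one⇒two : ∀ {k h r r′} → One k r r′ → Two k h (r′ ∷ʳ (h , b)) (r ∷ʳ (h , a))
  one⇒two (here p)    = here (none⇒one p)
  one⇒two (there o p) = there o (one⇒two p)

  none⇒fresh-a : ∀ {r} → None r → Fresh a r
  none⇒fresh-a = All.map λ (v≢a , _) → v≢a ∘ ≡.sym

  none⇒fresh-b : ∀ {r} → None r → Fresh b r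
  none⇒fresh-b = All.map λ (_ , v≢b) → v≢b ∘ ≡.sym

  one⇒fresh-a : ∀ {k r r′} → One k r r′ → Fresh a r
  one⇒fresh-a (here p)          = a≢b ∷ none⇒fresh-a p
  one⇒fresh-a (there (v≢a , _) p) = v≢a ∘ ≡.sym ∷ one⇒fresh-a p

  one⇒fresh-b : ∀ {k r r′} → One k r r′ → Fresh b r′
  one⇒fresh-b (here p)          = a≢b ∘ ≡.sym ∷ none⇒fresh-b p
  one⇒fresh-b (there (_ , v≢b) p) = v≢b ∘ ≡.sym ∷ one⇒fresh-b p

  one⇒stale-b : ∀ {k r r′} → One k r r′ → fresh b r ≡ false
  one⇒stale-b (here p) rewrite dec-true (b Fin.≟ b) ≡.refl = ≡.refl
  one⇒stale-b (there {v = v} (_ , v≢b) p) rewrite dec-false (b Fin.≟ v) (v≢b ∘ ≡.sym) = one⇒stale-b p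

  one⇒stale-a : ∀ {k r r′} → One k r r′ → fresh a r′ ≡ false
  one⇒stale-a (here p) rewrite dec-true (a Fin.≟ a) ≡.refl = ≡.refl
  one⇒stale-a (there {v = v} (v≢a , _) p) rewrite dec-false (a Fin.≟ v) (v≢a ∘ ≡.sym) = one⇒stale-a p

  two⇒stale-a : ∀ {k l r r′} → Two k l r r′ → fresh a r ≡ false × fresh a r′ ≡ false
  two⇒stale-a (here p) rewrite dec-true (a Fin.≟ a) ≡.refl | dec-false (a Fin.≟ b) a≢b = ≡.refl , one⇒stale-a p
  two⇒stale-a (there {v = v} (v≢a , _) p) rewrite dec-false (a Fin.≟ v) (v≢a ∘ ≡.sym) = two⇒stale-a p

  two⇒stale-b : ∀ {k l r r′} → Two k l r r′ → fresh b r ≡ false × fresh b r′ ≡ false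
  two⇒stale-b (here p) rewrite dec-true (b Fin.≟ b) ≡.refl | dec-false (b Fin.≟ a) (a≢b ∘ ≡.sym) = one⇒stale-b p , ≡.refl
  two⇒stale-b (there {v = v} (_ , v≢b) p) rewrite dec-false (b Fin.≟ v) (v≢b ∘ ≡.sym) = two⇒stale-b p

  one-fresh : ∀ {k r r′ u} → Other u → One k r r′ → fresh u r ≡ fresh u r′
  one-fresh {u = u} (u≢a , u≢b) (here p)
    rewrite dec-false (u Fin.≟ a) u≢a | dec-false (u Fin.≟ b) u≢b = ≡.refl
  one-fresh {u = u} o (there {v = v} _ p) = ≡.cong (not (does (u Fin.≟ v)) ∧_) (one-fresh o p)

  two-fresh : ∀ {k l r r′ u} → Other u → Two k l r r′ → fresh u r ≡ fresh u r′
  two-fresh {u = u} (u≢a , u≢b) (here p)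
    rewrite dec-false (u Fin.≟ a) u≢a | dec-false (u Fin.≟ b) u≢b = one-fresh (u≢a , u≢b) p
  two-fresh {u = u} o (there {v = v} _ p) = ≡.cong (not (does (u Fin.≟ v)) ∧_) (two-fresh o p)

  one-armCount : ∀ h {k r r′} → One k r r′ → armCount h r ≡ armCount h r′
  one-armCount h (here p)           = ≡.refl
  one-armCount h (there {h′} _ p)   = ≡.cong (indicator (does (h′ ℕ.<? h)) ℕ.+_) (one-armCount h p)

  two-armCount : ∀ h {k l r r′} → Two k l r r′ → armCount h r ≡ armCount h r′
  two-armCount h {k} (here p)       = ≡.cong (indicator (does (k ℕ.<? h)) ℕ.+_) (one-armCount h p)
  two-armCount h (there {h′} _ p)   = ≡.cong (indicator (does (h′ ℕ.<? h)) ℕ.+_) (two-armCount h p)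

  none-coinvCount : ∀ h {u w u′ w′ r} → (∀ {v} → Other v → coinversion u v w ≡ coinversion u′ v w′) →
                    None r → coinvCount h u w r ≡ coinvCount h u′ w′ r
  none-coinvCount h eq []                     = ≡.refl
  none-coinvCount h eq (_∷_ {x = h′ , v} o p) =
    ≡.cong₂ (λ c k → indicator (does (h′ ℕ.<? h) ∧ c) ℕ.+ k) (eq o) (none-coinvCount h eq p)

  none-coinvCount-true : ∀ h {u w r} → (∀ {v} → Other v → coinversion u v w ≡ true) →
                         None r → coinvCount h u w r ≡ armCount h r
  none-coinvCount-true h eq []                     = ≡.refl
  none-coinvCount-true h eq (_∷_ {x = h′ , v} o p) rewrite eq o =
    ≡.cong₂ (λ c k → indicator c ℕ.+ k) (∧-true (does (h′ ℕ.<? h))) (none-coinvCount-true h eq p)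
    where
    ∧-true : ∀ x → x ∧ true ≡ x
    ∧-true true  = ≡.refl
    ∧-true false = ≡.refl

  none-coinvCount-false : ∀ h {u w r} → (∀ {v} → Other v → coinversion u v w ≡ false) →
                          None r → coinvCount h u w r ≡ 0
  none-coinvCount-false h eq []                     = ≡.refl
  none-coinvCount-false h eq (_∷_ {x = h′ , v} o p) rewrite eq o =
    ≡.cong₂ (λ c k → indicator c ℕ.+ k) (∧-false (does (h′ ℕ.<? h))) (none-coinvCount-false h eq p)
    where
    ∧-false : ∀ x → x ∧ false ≡ false
    ∧-false true  = ≡.refl
    ∧-false false = ≡.refl

  -- All triples but the one through the entry b or a agree. Their number c is kept existential so
  -- that one splitting serves a change of the top value, a change of the bottom value, and no
  -- change.
  one-coinvCount : ∀ h {k u w u′ w′ r r′} → (∀ {v} → Other v → coinversion u v w ≡ coinversion u′ v w′) →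
    One k r r′ → ∃[ c ]
      (coinvCount h u w r ≡ indicator (does (k ℕ.<? h) ∧ coinversion u b w) ℕ.+ c ×
       coinvCount h u′ w′ r′ ≡ indicator (does (k ℕ.<? h) ∧ coinversion u′ a w′) ℕ.+ c)
  one-coinvCount h {k} {u} {w} {u′} {w′} eq (here {r} p) = coinvCount h u w r , ≡.refl ,
    ≡.cong (indicator (does (k ℕ.<? h) ∧ coinversion u′ a w′) ℕ.+_) (≡.sym (none-coinvCount h eq p))
  one-coinvCount h {u = u} {w} {u′} {w′} eq (there {h = h′} {v} o p) with one-coinvCount h eq p
  ... | c , e₁ , e₂ = x ℕ.+ c
    , ≡.trans (≡.cong₂ (λ d k → indicator (does (h′ ℕ.<? h) ∧ d) ℕ.+ k) (eq o) e₁) (+-swap x _ c)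
    , ≡.trans (≡.cong (x ℕ.+_) e₂) (+-swap x _ c)
    where
    x = indicator (does (h′ ℕ.<? h) ∧ coinversion u′ v w′)

  one-coinvCount-same : ∀ h {k u w r r′} → Other u → Other w → One k r r′ →
                        coinvCount h u w r ≡ coinvCount h u w r′
  one-coinvCount-same h {k} {u} {w} o o′ p with one-coinvCount h {k} {u} {w} {u} {w} (λ _ → ≡.refl) p
  ... | c , e₁ , e₂ = ≡.trans e₁ (≡.trans
    (≡.cong (λ d → indicator (does (k ℕ.<? h) ∧ d) ℕ.+ c) (coinversion-mid o o′)) (≡.sym e₂))

  two-coinvCount : ∀ h {k l u w r r′} → Other u → Other w → Two k l r r′ →
                   coinvCount h u w r ≡ coinvCount h u w r′
  two-coinvCount h {k} o o′ (here p) = ≡.cong₂ (λ d e → indicator (does (k ℕ.<? h) ∧ d) ℕ.+ e)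
    (≡.sym (coinversion-mid o o′)) (one-coinvCount-same h o o′ p)
  two-coinvCount h {u = u} {w} o o′ (there {h = h′} {v} _ p) =
    ≡.cong (indicator (does (h′ ℕ.<? h) ∧ coinversion u v w) ℕ.+_) (two-coinvCount h o o′ p)

  -- The contribution of the triple whose middle box is the entry with k boxes left: it is present
  -- only if that column belongs to the arm of a box opened with h boxes left.
  penalty : ℕ → ℕ → ℕ
  penalty k h = indicator (does (k ℕ.<? h))

  private
    shift-by : ∀ {x y c d e p} → x ≡ indicator (p ∧ d) ℕ.+ c → y ≡ indicator (p ∧ e) ℕ.+ c →
               d ≡ true → e ≡ false → x ≡ indicator p ℕ.+ y
    shift-by {p = true}  ≡.refl ≡.refl ≡.refl ≡.refl = ≡.refl
    shift-by {p = false} ≡.refl ≡.refl ≡.refl ≡.refl = ≡.refl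

  one-coinvCount-top : ∀ h {k w r r′} → Other w → One k r r′ →
                       coinvCount h a w r ≡ penalty k h ℕ.+ coinvCount h b w r′
  one-coinvCount-top h {k} {w} o p with one-coinvCount h {k} {a} {w} {b} {w} (λ o′ → coinversion-top o′ o) p
  ... | c , e₁ , e₂ = shift-by e₁ e₂ (coinversion-abw o) (coinversion-baw o)

  one-coinvCount-bottom : ∀ h {k u r r′} → Other u → One k r r′ →
                          coinvCount h u b r′ ≡ penalty k h ℕ.+ coinvCount h u a r
  one-coinvCount-bottom h {k} {u} o p
    with one-coinvCount h {k} {u} {a} {u} {b} (λ o′ → ≡.sym (coinversion-bottom o o′)) p
  ... | c , e₁ , e₂ = shift-by e₂ e₁ (coinversion-uab o) (coinversion-uba o)

  -- T acts summand by summand except on the entries a and b, whose terms it mixes; these two are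
  -- only mapped as a pair.
  ↦-sum₂ : ∀ {N} (i k : Fin N) → i ≢ k → (f g : Vector (Laurent n) N) →
           (∀ u → u ≢ i → u ≢ k → f u ↦ g u) → f i +ᴸ f k ↦ g i +ᴸ g k → sum f ↦ sum g
  ↦-sum₂ {suc zero}    zero zero i≢k f g T T₂ = contradiction ≡.refl i≢k
  ↦-sum₂ {suc (suc N)} i k i≢k f g T T₂ = ↦-resp
    (≋-sym (sum-remove₂ +-commutativeMonoid i k i≢k f)) (≋-sym (sum-remove₂ +-commutativeMonoid i k i≢k g))
    (↦-+ T₂ (↦-sum _ _ λ u → T _ (Fin.punchInᵢ≢i i _)
      λ e → Fin.punchInᵢ≢i (punchOut i≢k) u
        (Fin.punchIn-injective i _ _ (≡.trans e (≡.sym (Fin.punchIn-punchOut i≢k))))))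

  ↦-cancel^ : ∀ p {f g} → t K.^ p • f ↦ t K.^ p • g → f ↦ g
  ↦-cancel^ zero    {f} {g} T = ↦-resp (1• f) (1• g) T
  ↦-cancel^ (suc p) {f} {g} T =
    ↦-cancel^ p (↦-cancel (↦-resp (•-assoc t (t K.^ p) f) (•-assoc t (t K.^ p) g) T))

  -- The exponent of t in the exchange of two queue entries, the earlier with k boxes left and the
  -- later with h.
  ascent : ℕ → ℕ → ℕ
  ascent k h = indicator (does (k ℕ.≤? h))

  -- Exactly one of k < h + 1 and h + 1 ≤ k holds, so the exponents add up to 1.
  ascent-penalty : ∀ k h → t K.^ ascent (suc h) k K.* t K.^ penalty k (suc h) K.≈ t
  ascent-penalty k h with k ℕ.<? suc h
  ... | yes k<h = K.trans (K.*-cong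
      (K.reflexive (≡.cong (λ d → t K.^ indicator d) (dec-false (suc h ℕ.≤? k) (ℕ.<⇒≱ k<h))))
      (K.reflexive (≡.cong (λ d → t K.^ indicator d) (dec-true (k ℕ.<? suc h) k<h))))
    (K.trans (K.*-identityˡ _) (K.*-identityʳ t))
  ... | no  k≮h = K.trans (K.*-cong
      (K.reflexive (≡.cong (λ d → t K.^ indicator d) (dec-true (suc h ℕ.≤? k) (ℕ.≮⇒≥ k≮h))))
      (K.reflexive (≡.cong (λ d → t K.^ indicator d) (dec-false (k ℕ.<? suc h) k≮h))))
    (K.trans (K.*-identityʳ _) (K.*-identityʳ t))

  penalty-ascent : ∀ k h → penalty k (suc h) ≡ ascent k h
  penalty-ascent k h = ≡.cong indicator (does-⇔ (mk⇔ ℕ.≤-pred ℕ.s≤s) (k ℕ.<? suc h) (k ℕ.≤? h))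

  scaled : ∀ c {u f g} → Other u → f ↦ t • g → c • X u f ↦ t • (c • X u g)
  scaled c {u} {f} {g} o T = ↦-resp ≋-refl
    (≋-trans (•-cong K.refl (X-• u t g)) (•-comm c t (X u g))) (↦-• c (↦-X o T))

  stepWeight-ab : ∀ {h w r} → Other w → None r → stepWeight h w r a K.≈ stepWeight h w r b
  stepWeight-ab {h} {w} {r} o@(w≢a , w≢b) p = K.trans (stepWeight-scale 0 {h} {a} {b} {w} {w} {r} {r}
    (≡.trans (fresh-true (none⇒fresh-a p)) (≡.sym (fresh-true (none⇒fresh-b p))))
    (v<a≡v<b o) (none-coinvCount h (λ o′ → coinversion-top o′ o) p) ≡.refl
    (≡.trans (dec-false (a Fin.≟ w) (w≢a ∘ ≡.sym)) (≡.sym (dec-false (b Fin.≟ w) (w≢b ∘ ≡.sym)))))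
    (K.*-identityˡ _)

  stepWeight-from-ab : ∀ {h u r} → Other u → None r → stepWeight h b r u K.≈ stepWeight h a r u
  stepWeight-from-ab {h} {u} {r} o@(u≢a , u≢b) p = K.trans (stepWeight-scale 0 {h} {u} {u} {b} {a} {r} {r} ≡.refl
    (≡.sym (a<v≡b<v o)) (none-coinvCount h (λ o′ → coinversion-bottom o o′) p) ≡.refl
    (≡.trans (dec-false (u Fin.≟ b) u≢b) (≡.sym (dec-false (u Fin.≟ a) u≢a))))
    (K.*-identityˡ _)

  stepWeight-one : ∀ {h k u w r r′} → Other u → Other w → One k r r′ →
                   stepWeight h w r u K.≈ stepWeight h w r′ u
  stepWeight-one {h} {k} {u} {w} {r} {r′} o o′ p = K.trans (stepWeight-scale 0 {h} {u} {u} {w} {w} {r} {r′}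
    (one-fresh o p) ≡.refl (one-coinvCount-same h o o′ p) (one-armCount h p) ≡.refl) (K.*-identityˡ _)

  stepWeight-two : ∀ {h k l u w r r′} → Other u → Other w → Two k l r r′ →
                   stepWeight h w r u K.≈ stepWeight h w r′ u
  stepWeight-two {h} {k} {l} {u} {w} {r} {r′} o o′ p = K.trans (stepWeight-scale 0 {h} {u} {u} {w} {w} {r} {r′}
    (two-fresh o p) ≡.refl (two-coinvCount h o o′ p) (two-armCount h p) ≡.refl) (K.*-identityˡ _)

  stepWeight-one-top : ∀ {h k w r r′} → Other w → One k r r′ →
                       stepWeight h w r a K.≈ t K.^ penalty k h K.* stepWeight h w r′ b
  stepWeight-one-top {h} {k} {w} {r} {r′} o@(w≢a , w≢b) p =
    stepWeight-scale (penalty k h) {h} {a} {b} {w} {w} {r} {r′}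
    (≡.trans (fresh-true (one⇒fresh-a p)) (≡.sym (fresh-true (one⇒fresh-b p))))
    (v<a≡v<b o) (one-coinvCount-top h o p) (one-armCount h p)
    (≡.trans (dec-false (a Fin.≟ w) (w≢a ∘ ≡.sym)) (≡.sym (dec-false (b Fin.≟ w) (w≢b ∘ ≡.sym))))

  stepWeight-one-bottom : ∀ {h k u r r′} → Other u → One k r r′ →
                          stepWeight h b r′ u K.≈ t K.^ penalty k h K.* stepWeight h a r u
  stepWeight-one-bottom {h} {k} {u} {r} {r′} o@(u≢a , u≢b) p =
    stepWeight-scale (penalty k h) {h} {u} {u} {b} {a} {r′} {r}
    (≡.sym (one-fresh o p)) (≡.sym (a<v≡b<v o)) (one-coinvCount-bottom h o p) (≡.sym (one-armCount h p))
    (≡.trans (dec-false (u Fin.≟ b) u≢b) (≡.sym (dec-false (u Fin.≟ a) u≢a)))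

  stepWeight-b-to-a : ∀ {h r} → None r → stepWeight h b r a K.≈ fac h (armCount h r)
  stepWeight-b-to-a {h} {r} p = begin
    stepWeight h b r a
      ≡⟨ ≡.cong (λ d → if d then boxWeight h b r a else K.0#) (fresh-true (none⇒fresh-a p)) ⟩
    boxWeight h b r a
      ≡⟨ ≡.cong₂ (λ d k → q K.^ (if d then h else 0) K.* t K.^ k K.*
           (if does (a Fin.≟ b) then K.1# else fac h (armCount h r))) b<a≡false
           (none-coinvCount-false h coinversion-avb p) ⟩
    K.1# K.* K.1# K.* (if does (a Fin.≟ b) then K.1# else fac h (armCount h r))
      ≡⟨ ≡.cong (λ d → K.1# K.* K.1# K.* (if d then K.1# else fac h (armCount h r))) (dec-false (a Fin.≟ b) a≢b) ⟩
    K.1# K.* K.1# K.* fac h (armCount h r)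
      ≈⟨ K.trans (K.*-congʳ (K.*-identityˡ _)) (K.*-identityˡ _) ⟩
    fac h (armCount h r) ∎
    where open SetoidReasoning K.setoid

  -- From a up to b there is a descent and every triple is a coinversion; from b up to a there is
  -- neither. Hence the two weights differ by q^h t^`armCount`.
  stepWeight-a-to-b : ∀ {h r} → None r →
    stepWeight h a r b K.≈ q K.^ h K.* t K.^ armCount h r K.* fac h (armCount h r)
  stepWeight-a-to-b {h} {r} p = begin
    stepWeight h a r b
      ≡⟨ ≡.cong (λ d → if d then boxWeight h a r b else K.0#) (fresh-true (none⇒fresh-b p)) ⟩
    boxWeight h a r b
      ≡⟨ ≡.cong₂ (λ d k → q K.^ (if d then h else 0) K.* t K.^ k K.*
           (if does (b Fin.≟ a) then K.1# else fac h (armCount h r))) a<b≡true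
           (none-coinvCount-true h coinversion-bva p) ⟩
    q K.^ h K.* t K.^ armCount h r K.* (if does (b Fin.≟ a) then K.1# else fac h (armCount h r))
      ≡⟨ ≡.cong (λ d → q K.^ h K.* t K.^ armCount h r K.* (if d then K.1# else fac h (armCount h r)))
           (dec-false (b Fin.≟ a) (a≢b ∘ ≡.sym)) ⟩
    q K.^ h K.* t K.^ armCount h r K.* fac h (armCount h r) ∎
    where open SetoidReasoning K.setoid

  -- `FactorIdentity` with 1 subtracted, as `↦-shear` requires it.
  fac-shear : ∀ h k → q K.^ h K.* t K.^ k K.* fac h k K.* t K.≈ (fac h k K.+ K.- K.1#) K.+ t
  fac-shear h k = begin
    x                                    ≈⟨ K.+-identityʳ x ⟨
    x K.+ K.0#                           ≈⟨ K.+-congˡ (K.-‿inverseʳ K.1#) ⟨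
    x K.+ (K.1# K.+ K.- K.1#)            ≈⟨ K.+-assoc _ _ _ ⟨
    x K.+ K.1# K.+ K.- K.1#              ≈⟨ K.+-congʳ (fac-eq h k) ⟩
    fac h k K.+ t K.+ K.- K.1#           ≈⟨ K.+-assoc _ _ _ ⟩
    fac h k K.+ (t K.+ K.- K.1#)         ≈⟨ K.+-congˡ (K.+-comm _ _) ⟩
    fac h k K.+ (K.- K.1# K.+ t)         ≈⟨ K.+-assoc _ _ _ ⟨
    (fac h k K.+ K.- K.1#) K.+ t         ∎
    where
    open SetoidReasoning K.setoid
    x = q K.^ h K.* t K.^ k K.* fac h k K.* t

  x≈1+[x-1] : ∀ x → x K.≈ K.1# K.+ (x K.+ K.- K.1#)
  x≈1+[x-1] x = begin
    x                              ≈⟨ K.+-identityʳ x ⟨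
    x K.+ K.0#                     ≈⟨ K.+-congˡ (K.-‿inverseˡ K.1#) ⟨
    x K.+ (K.- K.1# K.+ K.1#)      ≈⟨ K.+-assoc _ _ _ ⟨
    (x K.+ K.- K.1#) K.+ K.1#      ≈⟨ K.+-comm _ _ ⟩
    K.1# K.+ (x K.+ K.- K.1#)      ∎
    where open SetoidReasoning K.setoid

  mutual

    -- T x_a F_a = x_b F_b for the queues F_a, F_b obtained by appending a, b.
    append-none : ∀ k h {r} → None r → X a (F k (r ∷ʳ (h , a))) ↦ X b (F k (r ∷ʳ (h , b)))
    append-none k h {r} p = ↦-cancel (↦-resp (X-• a t (F k (r ∷ʳ (h , a)))) ≋-refl
      (↦-twist (exchange₁ k (none⇒one p))))

    -- The lengthened queues are exchanged from r′ to r with exponent `ascent l h`. Twisting turns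
    -- this around and leaves the power of t on the source, where it is the `penalty` of the column
    -- with l boxes left.
    append-one : ∀ k h {l r r′} → One l r r′ →
      t K.^ penalty l (suc h) • X a (F k (r ∷ʳ (h , a))) ↦ t • X b (F k (r′ ∷ʳ (h , b)))
    append-one k h {l} {r} p = ↦-resp
      (≋-trans (X-• a _ (F k (r ∷ʳ (h , a))))
        (•-cong (K.reflexive (≡.cong (t K.^_) (≡.sym (penalty-ascent l h)))) ≋-refl)) ≋-refl
      (↦-twist (exchange₂ k (one⇒two p)))

    -- The entries a and b have equal weights here and T carries one of their terms to the other, so
    -- T multiplies their sum by t, as it does every other summand.
    exchange₀ : ∀ k {r} → None r → F k r ↦ t • F k r
    exchange₀ zero    p = ↦-zero
    exchange₀ (suc k) [] = ↦-one
    exchange₀ (suc k) {(zero , w) ∷ r} (o ∷ p) = exchange₀ k p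
    exchange₀ (suc k) {(suc h , w) ∷ r} (o ∷ p) = ↦-resp ≋-refl (≋-sym (sum-• t {n} f))
      (↦-sum₂ a b a≢b f _
        (λ u u≢a u≢b → scaled (stepWeight (suc h) w r u) (u≢a , u≢b) (exchange₀ k (none-∷ʳ p (u≢a , u≢b))))
        (↦-resp pair (≋-trans (•-cong K.refl pair′) (•-distrib-+ t (f a) (f b)))
          (↦-resp ≋-refl (•-comm c t (fa +ᴸ K.1# • fb)) (↦-• c
            -- With k = 0 the sheared relation is T(f + Tf) = t(f + Tf).
            (↦-shear K.1# K.1# K.0# (K.sym (K.+-identityʳ _))
              (K.trans (K.*-identityˡ t) (K.sym (K.+-identityˡ t))) (append-none k h p))))))
      where
      c : K
      c = stepWeight (suc h) w r b
      f : Fin n → Laurent n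
      f u = stepWeight (suc h) w r u • X u (F k (r ∷ʳ (h , u)))
      fa fb : Laurent n
      fa = X a (F k (r ∷ʳ (h , a)))
      fb = X b (F k (r ∷ʳ (h , b)))
      pair : c • (K.1# • fa +ᴸ fb) ≋ f a +ᴸ f b
      pair = ≋-trans (•-distrib-+ c (K.1# • fa) fb)
        (+-cong (•-cong (K.sym (stepWeight-ab o p)) (1• fa)) ≋-refl)
      pair′ : c • (fa +ᴸ K.1# • fb) ≋ f a +ᴸ f b
      pair′ = ≋-trans (•-distrib-+ c fa (K.1# • fb))
        (+-cong (•-cong (K.sym (stepWeight-ab o p)) ≋-refl) (•-cong K.refl (1• fb)))

    exchange₁ : ∀ k {l r r′} → One l r r′ → F k r ↦ t • F k r′
    exchange₁ zero    p = ↦-zero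
    exchange₁ (suc k) {zero} (here p) = exchange₀ k p
    exchange₁ (suc k) {suc h} (here {r} p) = ↦-resp ≋-refl (≋-sym (sum-• t {n} g))
      (↦-sum₂ a b a≢b f _
        (λ u u≢a u≢b → ↦-resp ≋-refl
          (•-cong K.refl (•-cong (stepWeight-from-ab (u≢a , u≢b) p) (≋-refl {f = X u (F k (r ∷ʳ (h , u)))})))
          (scaled (stepWeight (suc h) b r u) (u≢a , u≢b) (exchange₀ k (none-∷ʳ p (u≢a , u≢b)))))
        (↦-resp
          (+-cong (•-cong (K.sym (stepWeight-b-to-a p)) ≋-refl)
            (≋-sym (≋-trans (•-cong (stepWeight-self (suc h) b r (none⇒fresh-b p)) ≋-refl) (1• fb))))
          (≋-trans (•-cong K.refl (+-cong
            (≋-sym (≋-trans (•-cong (stepWeight-self (suc h) a r (none⇒fresh-a p)) ≋-refl) (1• fa)))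
            (•-cong (K.sym (stepWeight-a-to-b p)) ≋-refl))) (•-distrib-+ t (g a) (g b)))
          -- The front column repeats its value at weight 1 or passes to the other one: from b to a
          -- with the factor, from a to b with q^(h+1) t^A times it. These are the coefficients c
          -- and d of the sheared relation, and `FactorIdentity` is the condition that links them.
          (↦-shear (fac (suc h) A) _ _ (x≈1+[x-1] _) (fac-shear (suc h) A) (append-none k h p))))
      where
      A : ℕ
      A = armCount (suc h) r
      f g : Fin n → Laurent n
      f u = stepWeight (suc h) b r u • X u (F k (r ∷ʳ (h , u)))
      g u = stepWeight (suc h) a r u • X u (F k (r ∷ʳ (h , u)))
      fa fb : Laurent n
      fa = X a (F k (r ∷ʳ (h , a)))
      fb = X b (F k (r ∷ʳ (h , b)))
    exchange₁ (suc k) (there {zero} o p) = exchange₁ k p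
    exchange₁ (suc k) {l} (there {suc h} {w} {r} {r′} o p) = ↦-resp ≋-refl (≋-sym (sum-• t {n} g))
      (↦-sum₂ a b a≢b f _
        (λ u u≢a u≢b → ↦-resp ≋-refl
          (•-cong K.refl (•-cong (stepWeight-one (u≢a , u≢b) o p) (≋-refl {f = X u (F k (r′ ∷ʳ (h , u)))})))
          (scaled (stepWeight (suc h) w r u) (u≢a , u≢b) (exchange₁ k (one-∷ʳ p (u≢a , u≢b)))))
        -- As r holds b and r′ holds a, only the entry a survives in the source and only b in the
        -- target; their weights differ by t^`penalty`.
        (↦-resp
          (≋-trans (≋-sym (≋-trans (•-cong (K.trans (stepWeight-one-top o p) (K.*-comm _ c)) ≋-refl) (•-assoc c _ fa)))
            (≋-trans (≋-sym (≋-reflexive (List.++-identityʳ (f a))))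
              (+-cong (≋-refl {f = f a}) (≋-sym (≋-trans (•-cong (stepWeight-stale (suc h) w r b (one⇒stale-b p)) ≋-refl) (0• _))))))
          (≋-trans (•-comm c t fb) (+-cong (≋-sym (≋-trans (•-cong K.refl
            (≋-trans (•-cong (stepWeight-stale (suc h) w r′ a (one⇒stale-a p)) ≋-refl) (0• (X a (F k (r′ ∷ʳ (h , a))))))) ≋-refl)) (≋-refl {f = t • g b})))
          (↦-• c (append-one k h p))))
      where
      c : K
      c = stepWeight (suc h) w r′ b
      f g : Fin n → Laurent n
      f u = stepWeight (suc h) w r  u • X u (F k (r  ∷ʳ (h , u)))
      g u = stepWeight (suc h) w r′ u • X u (F k (r′ ∷ʳ (h , u)))
      fa fb : Laurent n
      fa = X a (F k (r  ∷ʳ (h , a)))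
      fb = X b (F k (r′ ∷ʳ (h , b)))

    -- Reading other columns leaves the exponent alone; it is settled when the column of a is
    -- continued or dropped. If a is repeated, `append-one` gives t^(1 - `penalty`). If another
    -- value is entered, `exchange₁` gives t and the ratio of the two weights takes off t^`penalty`.
    -- If the column is complete, the exponent is 1.
    exchange₂ : ∀ k {l l′ r r′} → Two l l′ r r′ → F k r ↦ t K.^ ascent l l′ • F k r′
    exchange₂ zero    p = ↦-zero
    exchange₂ (suc k) {zero} (here {r} {r′} p) =
      ↦-resp ≋-refl (•-cong (K.sym (K.*-identityʳ t)) ≋-refl) (exchange₁ k p)
    exchange₂ (suc k) {suc h} {l} (here {r} {r′} p) = ↦-resp ≋-refl (≋-sym (sum-• T^e {n} g))
      (↦-sum₂ a b a≢b f _
        (λ u u≢a u≢b → ↦-resp ≋-refl (other u (u≢a , u≢b))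
          (scaled (stepWeight (suc h) a r u) (u≢a , u≢b) (exchange₁ k (one-∷ʳ p (u≢a , u≢b)))))
        (↦-resp
          (≋-trans (≋-sym (≋-trans (•-cong (stepWeight-self (suc h) a r (one⇒fresh-a p)) ≋-refl) (1• fa)))
            (≋-trans (≋-sym (≋-reflexive (List.++-identityʳ (f a))))
              (+-cong (≋-refl {f = f a}) (≋-sym (≋-trans (•-cong (stepWeight-stale (suc h) a r b (one⇒stale-b p)) ≋-refl) (0• _))))))
          (≋-trans (•-cong K.refl (≋-sym (≋-trans (•-cong (stepWeight-self (suc h) b r′ (one⇒fresh-b p)) ≋-refl) (1• fb))))
            (+-cong (≋-sym (≋-trans (•-cong K.refl
            (≋-trans (•-cong (stepWeight-stale (suc h) b r′ a (one⇒stale-a p)) ≋-refl) (0• (X a (F k (r′ ∷ʳ (h , a))))))) ≋-refl)) (≋-refl {f = T^e • g b})))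
          (↦-cancel^ (penalty l (suc h)) (↦-resp ≋-refl
            (≋-trans (•-cong (K.trans (K.sym (ascent-penalty l h)) (K.*-comm _ _)) ≋-refl) (•-assoc _ T^e fb))
            (append-one k h p)))))
      where
      T^e : K
      T^e = t K.^ ascent (suc h) l
      f g : Fin n → Laurent n
      f u = stepWeight (suc h) a r  u • X u (F k (r  ∷ʳ (h , u)))
      g u = stepWeight (suc h) b r′ u • X u (F k (r′ ∷ʳ (h , u)))
      fa fb : Laurent n
      fa = X a (F k (r  ∷ʳ (h , a)))
      fb = X b (F k (r′ ∷ʳ (h , b)))
      other : ∀ u → Other u → t • (stepWeight (suc h) a r u • X u (F k (r′ ∷ʳ (h , u)))) ≋ T^e • g u
      other u o = begin
        t • (c • z)                   ≈⟨ •-cong (ascent-penalty l h) ≋-refl ⟨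
        (T^e K.* T^p) • (c • z)       ≈⟨ •-assoc T^e T^p (c • z) ⟩
        T^e • (T^p • (c • z))         ≈⟨ •-cong K.refl (•-assoc T^p c z) ⟨
        T^e • ((T^p K.* c) • z)       ≈⟨ •-cong K.refl (•-cong (stepWeight-one-bottom o p) (≋-refl {f = z})) ⟨
        T^e • g u                     ∎
        where
        open ≋-Reasoning
        c T^p : K
        c = stepWeight (suc h) a r u
        T^p = t K.^ penalty l (suc h)
        z : Laurent n
        z = X u (F k (r′ ∷ʳ (h , u)))
    exchange₂ (suc k) (there {zero} o p) = exchange₂ k p
    exchange₂ (suc k) {l} {l′} (there {suc h} {w} {r} {r′} o p) = ↦-resp ≋-refl (≋-sym (sum-• T^e {n} g))
      (↦-sum₂ a b a≢b f _
        (λ u u≢a u≢b → ↦-resp ≋-refl (other u (u≢a , u≢b))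
          (↦-• (stepWeight (suc h) w r u) (↦-X (u≢a , u≢b) (exchange₂ k (two-∷ʳ p (u≢a , u≢b))))))
        -- Both values already stand in the rest of the queue, so neither can be entered again.
        (↦-resp
          (≋-sym (+-cong (vanish r a (proj₁ (two⇒stale-a p))) (vanish r b (proj₁ (two⇒stale-b p)))))
          (≋-sym (+-cong (•-cong K.refl (vanish r′ a (proj₂ (two⇒stale-a p))))
                         (•-cong K.refl (vanish r′ b (proj₂ (two⇒stale-b p))))))
          ↦-zero))
      where
      T^e : K
      T^e = t K.^ ascent l l′
      f g : Fin n → Laurent n
      f u = stepWeight (suc h) w r  u • X u (F k (r  ∷ʳ (h , u)))
      g u = stepWeight (suc h) w r′ u • X u (F k (r′ ∷ʳ (h , u)))
      vanish : ∀ r u → fresh u r ≡ false → stepWeight (suc h) w r u • X u (F k (r ∷ʳ (h , u))) ≋ []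
      vanish r u e = ≋-trans (•-cong (stepWeight-stale (suc h) w r u e) ≋-refl) (0• _)
      other : ∀ u → Other u →
        stepWeight (suc h) w r u • X u (T^e • F k (r′ ∷ʳ (h , u))) ≋ T^e • g u
      other u o′ = begin
        c • X u (T^e • z)    ≈⟨ •-cong (stepWeight-two o′ o p) (X-• u T^e z) ⟩
        c′ • (T^e • X u z)   ≈⟨ •-comm c′ T^e (X u z) ⟩
        T^e • g u            ∎
        where
        open ≋-Reasoning
        c c′ : K
        c  = stepWeight (suc h) w r u
        c′ = stepWeight (suc h) w r′ u
        z : Laurent n
        z = F k (r′ ∷ʳ (h , u))

-- Comparison with the operator defined by a quotient

module DividedDifference (R : CommutativeRing 0ℓ 0ℓ) {m : ℕ} (j : Fin m)
  (t t⁻¹ : CommutativeRing.Carrier R) (t⁻¹t≈1 : Inverse R t⁻¹ t) where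

  open LaurentPolynomials R
  open DemazureLusztig R j t t⁻¹ t⁻¹t≈1
  open _↦_
  open RingIdentities R

  infixl 7 _*ᴸ_
  _*ᴸ_ : Laurent n → Laurent n → Laurent n
  _*ᴸ_ = cartesianProductWith λ (c , e) (d , e′) → c K.* d , λ k → e k ℤ.+ e′ k

  1-xa/xb : Laurent n
  1-xa/xb = 1ᴸ +ᴸ (K.- K.1#) • [ K.1# , (λ k → δ a k ℤ.- δ b k) ]

  -- For f = A + x_a B the difference f - sf is (x_a - x_b)B = (1 - x_a/x_b)(-x_b B), so the
  -- quotient h is the explicit polynomial -x_b B.
  ↦-graph : ∀ {f g} → f ↦ g → Σ[ h ∈ Laurent n ]
    (1-xa/xb *ᴸ h ≋ f +ᴸ (K.- K.1#) • s f) × (g ≋ t • s f +ᴸ (t K.+ K.- K.1#) • h)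
  ↦-graph {f} {g} T = h , mk≋ is-quotient , mk≋ is-value
    where
    open SetoidReasoning K.setoid
    xa xb h : Laurent n
    xa = X a (B T)
    xb = X b (B T)
    h = (K.- K.1#) • xb
    f-coeff : ∀ m → coeff f m K.≈ coeff (A T) m K.+ coeff xa m
    f-coeff m = K.trans (source T .at m) (coeff-+ (A T) xa m)
    sf-coeff : ∀ m → coeff (s f) m K.≈ coeff (A T) m K.+ coeff xb m
    sf-coeff m = K.trans (≋-trans (s-cong (source T)) (≋-trans (s-+ (A T) xa)
      (+-cong (A-sym T) (≋-trans (s-Xa (B T)) (X-cong b (B-sym T))))) .at m) (coeff-+ (A T) xb m)
    -- The monomial m divided by x_a/x_b: the one that the second term of 1 - x_a/x_b carries to m.
    m′ : Exponent n → Exponent n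
    m′ m k = m k ℤ.- δ a k ℤ.+ δ b k
    move : ∀ x y z → x ℤ.- y ℤ.+ (z ℤ.- x ℤ.+ y) ≡ z
    move = ℤSolver.solve-∀
    move⁻¹ : ∀ x y z → z ≡ (x ℤ.- y ℤ.+ z) ℤ.- x ℤ.+ y
    move⁻¹ = ℤSolver.solve-∀
    move-xb : ∀ x y z → z ℤ.- x ℤ.+ y ℤ.- y ≡ z ℤ.- x
    move-xb = ℤSolver.solve-∀
    xb-shift : ∀ m → coeff xb (m′ m) K.≈ coeff xa m
    xb-shift m = begin
      coeff xb (m′ m)                              ≈⟨ coeff-X b (B T) (m′ m) ⟩
      coeff (B T) (λ k → m′ m k ℤ.- δ b k)         ≈⟨ coeff-cong (B T) (λ k → move-xb (δ a k) (δ b k) (m k)) ⟩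
      coeff (B T) (λ k → m k ℤ.- δ a k)            ≈⟨ coeff-X a (B T) m ⟨
      coeff xa m                                   ∎
    is-quotient : ∀ m → coeff (1-xa/xb *ᴸ h) m K.≈ coeff (f +ᴸ (K.- K.1#) • s f) m
    is-quotient m = begin
      coeff (1-xa/xb *ᴸ h) m
        ≈⟨ K.trans (coeff-+ h₁ (h₂ ++ []) m) (K.+-congˡ (K.trans (coeff-+ h₂ [] m) (K.+-identityʳ _))) ⟩
      coeff h₁ m K.+ coeff h₂ m
        ≈⟨ K.+-cong
             (coeff-map (λ c _ → K.1# K.* c) (λ e k → 0ℤ ℤ.+ e k)
               (λ e p k → ≡.trans (ℤ.+-identityˡ _) (p k)) (λ e p k → ≡.trans (≡.sym (ℤ.+-identityˡ _)) (p k))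
               (λ _ _ _ → K.refl) h)
             (coeff-map (λ c _ → K.- K.1# K.* K.1# K.* c) (λ e k → δ a k ℤ.- δ b k ℤ.+ e k)
               (λ e p k → ≡.trans (≡.cong (λ z → δ a k ℤ.- δ b k ℤ.+ z) (p k)) (move (δ a k) (δ b k) (m k)))
               (λ e p k → ≡.trans (move⁻¹ (δ a k) (δ b k) (e k)) (≡.cong (λ z → z ℤ.- δ a k ℤ.+ δ b k) (p k)))
               (λ _ _ _ → K.refl) h) ⟩
      K.1# K.* coeff h m K.+ K.- K.1# K.* K.1# K.* coeff h (m′ m)
        ≈⟨ K.+-cong (K.*-congˡ (coeff-• _ xb m))
             (K.*-congˡ (K.trans (coeff-• _ xb (m′ m)) (K.*-congˡ (xb-shift m)))) ⟩
      K.1# K.* (K.- K.1# K.* coeff xb m) K.+ K.- K.1# K.* K.1# K.* (K.- K.1# K.* coeff xa m)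
        ≈⟨ quotient (coeff (A T) m) _ _ ⟩
      (coeff (A T) m K.+ coeff xa m) K.+ K.- K.1# K.* (coeff (A T) m K.+ coeff xb m)
        ≈⟨ K.+-cong (f-coeff m) (K.trans (coeff-• _ (s f) m) (K.*-congˡ (sf-coeff m))) ⟨
      coeff f m K.+ coeff ((K.- K.1#) • s f) m
        ≈⟨ coeff-+ f _ m ⟨
      coeff (f +ᴸ (K.- K.1#) • s f) m ∎
      where
      h₁ h₂ : Laurent n
      h₁ = map (λ (d , e) → K.1# K.* d , λ k → 0ℤ ℤ.+ e k) h
      h₂ = map (λ (d , e) → K.- K.1# K.* K.1# K.* d , λ k → δ a k ℤ.- δ b k ℤ.+ e k) h
    is-value : ∀ m → coeff g m K.≈ coeff (t • s f +ᴸ (t K.+ K.- K.1#) • h) m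
    is-value m = begin
      coeff g m
        ≈⟨ K.trans (target T .at m) (K.trans (coeff-+ (t • A T) xb m) (K.+-congʳ (coeff-• t (A T) m))) ⟩
      t K.* coeff (A T) m K.+ coeff xb m
        ≈⟨ demazure t _ _ ⟩
      t K.* (coeff (A T) m K.+ coeff xb m) K.+ (t K.+ K.- K.1#) K.* (K.- K.1# K.* coeff xb m)
        ≈⟨ K.+-cong (K.trans (coeff-• t (s f) m) (K.*-congˡ (sf-coeff m)))
             (K.trans (coeff-• _ h m) (K.*-congˡ (coeff-• _ xb m))) ⟨
      coeff (t • s f) m K.+ coeff ((t K.+ K.- K.1#) • h) m
        ≈⟨ coeff-+ (t • s f) _ m ⟨
      coeff (t • s f +ᴸ (t K.+ K.- K.1#) • h) m ∎

-- The cyclic shift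

-- The cyclic decrement: π sends x_(unrotate k) to a multiple of x_k.
unrotate : ∀ {m} → Fin (suc m) → Fin (suc m)
unrotate {m} zero    = fromℕ m
unrotate     (suc i) = inject₁ i

rotate : ∀ {m} → Fin (suc m) → Fin (suc m)
rotate u with view u
... | ‵fromℕ     = zero
... | ‵inject₁ i = suc i

unrotate-rotate : ∀ {m} (u : Fin (suc m)) → unrotate (rotate u) ≡ u
unrotate-rotate u with view u
... | ‵fromℕ     = ≡.refl
... | ‵inject₁ i = ≡.refl

rotate-unrotate : ∀ {m} (u : Fin (suc m)) → rotate (unrotate u) ≡ u
rotate-unrotate {m} zero    rewrite view-fromℕ m   = ≡.refl
rotate-unrotate     (suc i) rewrite view-inject₁ i = ≡.refl

unrotate-injective : ∀ {m} {u v : Fin (suc m)} → unrotate u ≡ unrotate v → u ≡ v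
unrotate-injective {u = u} {v} e =
  ≡.trans (≡.sym (rotate-unrotate u)) (≡.trans (≡.cong rotate e) (rotate-unrotate v))

unrotate-≟ : ∀ {m} (u v : Fin (suc m)) → does (unrotate u Fin.≟ unrotate v) ≡ does (u Fin.≟ v)
unrotate-≟ u v = does-⇔ (mk⇔ unrotate-injective (≡.cong unrotate)) (unrotate u Fin.≟ unrotate v) (u Fin.≟ v)

χᵛ-unrotate : ∀ {m} (u v : Fin m) → χᵛ (unrotate (suc u)) (unrotate (suc v)) ≡ χᵛ (Fin.suc u) (suc v)
χᵛ-unrotate u v = ≡.cong (λ d → if d then 1 else 0) (does-⇔
  (mk⇔ (λ p → ℕ.s≤s (≡.subst₂ ℕ._<_ (Fin.toℕ-inject₁ v) (Fin.toℕ-inject₁ u) p))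
       (λ p → ≡.subst₂ ℕ._<_ (≡.sym (Fin.toℕ-inject₁ v)) (≡.sym (Fin.toℕ-inject₁ u)) (ℕ.≤-pred p)))
  (inject₁ v Fin.<? inject₁ u) (suc v Fin.<? suc u))

private
  fromℕ-top : ∀ {m} (u : Fin m) → does (fromℕ m Fin.<? inject₁ u) ≡ false × does (inject₁ u Fin.<? fromℕ m) ≡ true
  fromℕ-top {m} u = dec-false (fromℕ m Fin.<? inject₁ u) (ℕ.<⇒≱ (ℕ.s≤s (ℕ.<⇒≤ lt)))
                  , dec-true (inject₁ u Fin.<? fromℕ m) lt
    where
    lt : toℕ (inject₁ u) ℕ.< toℕ (fromℕ m)
    lt rewrite Fin.toℕ-inject₁ u | Fin.toℕ-fromℕ m = Fin.toℕ<n u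

χᵛ-top-bottom : ∀ {m} (u : Fin m) → χᵛ (unrotate zero) (unrotate (suc u)) ≡ 1
χᵛ-top-bottom u = ≡.cong (λ d → if d then 1 else 0) (proj₂ (fromℕ-top u))

χᵛ-bottom-top : ∀ {m} (u : Fin m) → χᵛ (unrotate (suc u)) (unrotate zero) ≡ 0
χᵛ-bottom-top u = ≡.cong (λ d → if d then 1 else 0) (proj₁ (fromℕ-top u))

-- Away from u = v, being a coinversion depends only on the cyclic order of the three entries.
coinversion-unrotate : ∀ {m} (u v w : Fin (suc m)) → u ≢ v →
  coinversion (unrotate u) (unrotate v) (unrotate w) ≡ coinversion u v w
coinversion-unrotate zero zero w u≢v = contradiction ≡.refl u≢v
coinversion-unrotate zero (suc v) zero u≢v = ≡.trans (coinversion-self (u≢v ∘ unrotate-injective)) (≡.sym (coinversion-self u≢v))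
coinversion-unrotate zero (suc v) (suc w) u≢v =
  coinversion-cong (χᵛ-top-bottom v) (χᵛ-unrotate v w) (χᵛ-top-bottom w)
coinversion-unrotate {m} (suc u) zero zero u≢v =
  coinversion-cong (χᵛ-bottom-top u) (χᵛ-self (fromℕ m)) (χᵛ-bottom-top u)
coinversion-unrotate (suc u) zero (suc w) u≢v =
  coinversion-cong (χᵛ-bottom-top u) (χᵛ-top-bottom w) (χᵛ-unrotate u w)
coinversion-unrotate (suc u) (suc v) zero u≢v = ≡.trans
  (coinversion-cong (χᵛ-unrotate u v) (χᵛ-bottom-top v) (χᵛ-bottom-top u))
  (≡.trans (≡.cong (λ k → does (k ℕ.≟ 0)) (ℕ.+-identityʳ x)) (≡.cong (λ k → does (k ℕ.≟ 1)) (ℕ.+-comm 1 x)))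
  where
  x : ℕ
  x = χᵛ (Fin.suc u) (suc v)
coinversion-unrotate (suc u) (suc v) (suc w) u≢v =
  coinversion-cong (χᵛ-unrotate u v) (χᵛ-unrotate v w) (χᵛ-unrotate u w)

fresh-unrotate : ∀ {m} (u : Fin (suc m)) r → fresh (unrotate u) (map (map₂ unrotate) r) ≡ fresh u r
fresh-unrotate u []            = ≡.refl
fresh-unrotate u ((_ , v) ∷ r) = ≡.cong₂ (λ d e → not d ∧ e) (unrotate-≟ u v) (fresh-unrotate u r)

armCount-unrotate : ∀ {m} h (r : Queue (suc m)) → armCount h (map (map₂ unrotate) r) ≡ armCount h r
armCount-unrotate h []             = ≡.refl
armCount-unrotate h ((h′ , v) ∷ r) = ≡.cong (indicator (does (h′ ℕ.<? h)) ℕ.+_) (armCount-unrotate h r)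

coinvCount-unrotate : ∀ {m} h (u w : Fin (suc m)) r → Fresh u r →
  coinvCount h (unrotate u) (unrotate w) (map (map₂ unrotate) r) ≡ coinvCount h u w r
coinvCount-unrotate h u w []             []        = ≡.refl
coinvCount-unrotate h u w ((h′ , v) ∷ r) (u≢v ∷ f) = ≡.cong₂ (λ d k → indicator (does (h′ ℕ.<? h) ∧ d) ℕ.+ k)
  (coinversion-unrotate u v w u≢v) (coinvCount-unrotate h u w r f)

-- The exponent of q⁻¹ produced by π. Making the smallest value the largest creates or destroys the
-- descents next to it, and each x_n in the monomial yields a q⁻¹; along a column these changes
-- telescope, leaving the number of boxes above a smallest entry.
bottomHeight : ∀ {m} → Queue (suc m) → ℕ
bottomHeight []                  = 0
bottomHeight ((h , zero)  ∷ r) = h ℕ.+ bottomHeight r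
bottomHeight ((h , suc _) ∷ r) = bottomHeight r

bottomHeight-∷ʳ : ∀ {m} (r : Queue (suc m)) h u →
  bottomHeight (r ∷ʳ (h , u)) ≡ bottomHeight [ h , u ] ℕ.+ bottomHeight r
bottomHeight-∷ʳ []                 h u = ≡.sym (ℕ.+-identityʳ _)
bottomHeight-∷ʳ ((h′ , zero)  ∷ r) h u = ≡.trans (≡.cong (h′ ℕ.+_) (bottomHeight-∷ʳ r h u))
  (+-swap h′ (bottomHeight [ h , u ]) (bottomHeight r))
bottomHeight-∷ʳ ((h′ , suc _) ∷ r) h u = bottomHeight-∷ʳ r h u

module Rotation (R : CommutativeRing 0ℓ 0ℓ)
  (q q⁻¹ t : CommutativeRing.Carrier R) (qq⁻¹≈1 : Inverse R q q⁻¹) (fac : ℕ → ℕ → CommutativeRing.Carrier R) (m : ℕ) where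

  open LaurentPolynomials R
  open QueueRecursion R q t fac (suc m)
  open Sum (+-commutativeMonoid {suc m}) using (sum-init-last; sum-cong-≋)

  n : ℕ
  n = suc m

  q^ℤ_ : ℤ → K
  q^ℤ (+ k)    = q K.^ k
  q^ℤ -[1+ k ] = q⁻¹ K.^ suc k

  q^ℤ-pred : ∀ z → q^ℤ (ℤ.pred z) K.≈ q⁻¹ K.* q^ℤ z
  q^ℤ-pred (+ zero)  = K.refl
  q^ℤ-pred (+ suc k) = K.sym (K.trans (K.sym (K.*-assoc q⁻¹ q _))
    (K.trans (K.*-congʳ (K.trans (K.*-comm q⁻¹ q) qq⁻¹≈1)) (K.*-identityˡ _)))
  q^ℤ-pred -[1+ k ]  = K.refl

  π : Laurent n → Laurent n
  π = map λ (c , e) → c K.* q^ℤ (ℤ.- e (fromℕ m)) , e ∘ unrotate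

  coeff-π : ∀ f e → coeff (π f) e K.≈ q^ℤ (ℤ.- e zero) K.* coeff f (e ∘ rotate)
  coeff-π f e = coeff-map (λ c e′ → c K.* q^ℤ (ℤ.- e′ (fromℕ m))) (_∘ unrotate)
    (λ e′ p k → ≡.trans (p (unrotate k)) (≡.cong e (rotate-unrotate k)))
    (λ e′ p k → ≡.trans (≡.cong e′ (≡.sym (unrotate-rotate k))) (p (rotate k)))
    (λ c e′ p → K.trans (K.*-comm c _) (K.*-congʳ (K.reflexive
      (≡.cong (λ z → q^ℤ (ℤ.- z)) (≡.trans (p (unrotate zero)) (≡.cong e (rotate-unrotate zero)))))))
    f

  π-cong : ∀ {f g} → f ≋ g → π f ≋ π g
  π-cong {f} {g} p .at e = K.trans (coeff-π f e) (K.trans (K.*-congˡ (p .at _)) (K.sym (coeff-π g e)))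

  π-• : ∀ c f → π (c • f) ≋ c • π f
  π-• c f .at e = begin
    coeff (π (c • f)) e         ≈⟨ K.trans (coeff-π (c • f) e) (K.*-congˡ (coeff-• c f _)) ⟩
    Q K.* (c K.* y)             ≈⟨ K.trans (K.sym (K.*-assoc Q c y)) (K.trans (K.*-congʳ (K.*-comm Q c)) (K.*-assoc c Q y)) ⟩
    c K.* (Q K.* y)             ≈⟨ K.trans (coeff-• c (π f) e) (K.*-congˡ (coeff-π f e)) ⟨
    coeff (c • π f) e           ∎
    where
    open SetoidReasoning K.setoid
    Q y : K
    Q = q^ℤ (ℤ.- e zero)
    y = coeff f (e ∘ rotate)

  π-sum : ∀ {N} (f : Vector (Laurent n) N) → π (sum f) ≋ sum (π ∘ f)
  π-sum {zero}  f = ≋-refl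
  π-sum {suc N} f = ≋-trans (≋-reflexive (List.map-++ _ (f zero) (sum (f ∘ suc)))) (+-cong ≋-refl (π-sum (f ∘ suc)))

  -- π replaces x_n by q⁻¹ x₁; no other variable acquires a scalar.
  q⁻[_] : Fin n → K
  q⁻[ zero  ] = q⁻¹
  q⁻[ suc _ ] = K.1#

  π-X : ∀ u f → π (X (unrotate u) f) ≋ q⁻[ u ] • X u (π f)
  π-X u f .at e = begin
    coeff (π (X (unrotate u) f)) e
      ≈⟨ K.trans (coeff-π (X (unrotate u) f) e) (K.*-congˡ (coeff-X (unrotate u) f _)) ⟩
    q^ℤ (ℤ.- e zero) K.* coeff f (λ k → e (rotate k) ℤ.- δ (unrotate u) k)
      ≈⟨ K.*-cong (scalar u) (coeff-cong f λ k → ≡.cong (λ z → e (rotate k) ℤ.- z) (δ-rotate k)) ⟩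
    (q⁻[ u ] K.* q^ℤ (ℤ.- (e zero ℤ.- δ u zero))) K.* coeff f (λ k → e (rotate k) ℤ.- δ u (rotate k))
      ≈⟨ K.*-assoc _ _ _ ⟩
    q⁻[ u ] K.* (q^ℤ (ℤ.- (e zero ℤ.- δ u zero)) K.* coeff f (λ k → e (rotate k) ℤ.- δ u (rotate k)))
      ≈⟨ K.*-congˡ (coeff-π f (λ k → e k ℤ.- δ u k)) ⟨
    q⁻[ u ] K.* coeff (π f) (λ k → e k ℤ.- δ u k)
      ≈⟨ K.*-congˡ (coeff-X u (π f) e) ⟨
    q⁻[ u ] K.* coeff (X u (π f)) e
      ≈⟨ coeff-• _ (X u (π f)) e ⟨
    coeff (q⁻[ u ] • X u (π f)) e ∎
    where
    open SetoidReasoning K.setoid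
    δ-rotate : ∀ k → δ (unrotate u) k ≡ δ u (rotate k)
    δ-rotate k = ≡.cong (λ d → if d then 1ℤ else 0ℤ) (does-⇔
      (mk⇔ (λ e → ≡.trans (≡.sym (rotate-unrotate u)) (≡.cong rotate e))
           (λ e → ≡.trans (≡.cong unrotate e) (unrotate-rotate k)))
      (unrotate u Fin.≟ k) (u Fin.≟ rotate k))
    pred-eq : ∀ z → ℤ.- z ≡ -[1+ 0 ] ℤ.+ (ℤ.- (z ℤ.- 1ℤ))
    pred-eq = ℤSolver.solve-∀
    scalar : ∀ u → q^ℤ (ℤ.- e zero) K.≈ q⁻[ u ] K.* q^ℤ (ℤ.- (e zero ℤ.- δ u zero))
    scalar zero    = K.trans (K.reflexive (≡.cong q^ℤ_ (pred-eq (e zero)))) (q^ℤ-pred (ℤ.- (e zero ℤ.- 1ℤ)))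
    scalar (suc _) = K.sym (K.trans (K.*-identityˡ _)
      (K.reflexive (≡.cong (λ z → q^ℤ (ℤ.- z)) (ℤ.+-identityʳ (e zero)))))

  -- The share of a single column in q⁻¹ to the power `bottomHeight`.
  boundary : ℕ → Fin n → K
  boundary h zero    = q⁻¹ K.^ h
  boundary h (suc _) = K.1#

  boundary-suc : ∀ h u → q⁻[ u ] K.* boundary h u K.≈ boundary (suc h) u
  boundary-suc h zero    = K.refl
  boundary-suc h (suc _) = K.*-identityˡ _

  boundary-bottomHeight : ∀ h u r → boundary h u K.* q⁻¹ K.^ bottomHeight r K.≈ q⁻¹ K.^ bottomHeight ((h , u) ∷ r)
  boundary-bottomHeight h zero    r = K.sym (Exp.^-homo-* K.semiring q⁻¹ h (bottomHeight r))
  boundary-bottomHeight h (suc _) r = K.*-identityˡ _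

  qq⁻¹^ : ∀ h → q K.^ h K.* q⁻¹ K.^ h K.≈ K.1#
  qq⁻¹^ zero    = K.*-identityˡ _
  qq⁻¹^ (suc h) = begin
    (q K.* q K.^ h) K.* (q⁻¹ K.* q⁻¹ K.^ h)   ≈⟨ Interchange.interchange q (q K.^ h) q⁻¹ _ ⟩
    (q K.* q⁻¹) K.* (q K.^ h K.* q⁻¹ K.^ h)   ≈⟨ K.*-cong qq⁻¹≈1 (qq⁻¹^ h) ⟩
    K.1# K.* K.1#                             ≈⟨ K.*-identityˡ _ ⟩
    K.1#                                      ∎
    where
    open SetoidReasoning K.setoid
    module Interchange = CommutativeSemigroupProperties K.*-commutativeSemigroup

  -- The descents of a column change only where its entry becomes, or ceases to be, maximal.
  descent-unrotate : ∀ h u w →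
    q K.^ (if does (unrotate w Fin.<? unrotate u) then h else 0) K.* boundary h u K.≈
    q K.^ (if does (w Fin.<? u) then h else 0) K.* boundary h w
  descent-unrotate h zero zero = K.*-congʳ (K.reflexive (≡.cong (λ d → q K.^ (if d then h else 0))
    (dec-false (fromℕ m Fin.<? fromℕ m) (ℕ.<-irrefl ≡.refl))))
  descent-unrotate h zero (suc w) = K.trans (K.trans (K.*-congʳ (K.reflexive
    (≡.cong (λ d → q K.^ (if d then h else 0)) (proj₂ (fromℕ-top w))))) (qq⁻¹^ h)) (K.sym (K.*-identityˡ _))
  descent-unrotate h (suc u) zero = K.trans (K.trans (K.*-congʳ (K.reflexive
    (≡.cong (λ d → q K.^ (if d then h else 0)) (proj₁ (fromℕ-top u))))) (K.*-identityˡ _)) (K.sym (qq⁻¹^ h))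
  descent-unrotate h (suc u) (suc w) = K.*-congʳ (K.reflexive (≡.cong (λ d → q K.^ (if d then h else 0))
    (does-⇔ (mk⇔ (λ p → ℕ.s≤s (≡.subst₂ ℕ._<_ (Fin.toℕ-inject₁ w) (Fin.toℕ-inject₁ u) p))
                 (λ p → ≡.subst₂ ℕ._<_ (≡.sym (Fin.toℕ-inject₁ w)) (≡.sym (Fin.toℕ-inject₁ u)) (ℕ.≤-pred p)))
            (inject₁ w Fin.<? inject₁ u) (suc w Fin.<? suc u))))

  stepWeight-unrotate : ∀ h u w r →
    stepWeight h (unrotate w) (map (map₂ unrotate) r) (unrotate u) K.* boundary h u K.≈
    stepWeight h w r u K.* boundary h w
  stepWeight-unrotate h u w r rewrite fresh-unrotate u r with fresh u r in fr
  -- The coinversions are compared only for a fresh entry, since the cyclic argument requires u ≢ v;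
  -- otherwise both weights vanish.
  ... | false = K.trans (K.zeroˡ _) (K.sym (K.zeroˡ _))
  ... | true  = begin
    d↓ K.* t K.^ coinvCount h (unrotate u) (unrotate w) r↓ K.* (if does (unrotate u Fin.≟ unrotate w) then K.1# else fac h (armCount h r↓)) K.* boundary h u
      ≈⟨ K.*-congʳ (K.*-cong (K.*-congˡ (K.reflexive (≡.cong (t K.^_) (coinvCount-unrotate h u w r (true-fresh r fr)))))
           (K.reflexive (≡.cong₂ (λ e k → if e then K.1# else fac h k) (unrotate-≟ u w) (armCount-unrotate h r)))) ⟩
    d↓ K.* x K.* y K.* boundary h u   ≈⟨ move d↓ x y _ ⟩
    d↓ K.* boundary h u K.* (x K.* y) ≈⟨ K.*-congʳ (descent-unrotate h u w) ⟩
    d′ K.* boundary h w K.* (x K.* y) ≈⟨ move d′ x y _ ⟨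
    d′ K.* x K.* y K.* boundary h w   ∎
    where
    open SetoidReasoning K.setoid
    r↓ : Queue n
    r↓ = map (map₂ unrotate) r
    d↓ d′ x y : K
    d↓ = q K.^ (if does (unrotate w Fin.<? unrotate u) then h else 0)
    d′ = q K.^ (if does (w Fin.<? u) then h else 0)
    x = t K.^ coinvCount h u w r
    y = if does (u Fin.≟ w) then K.1# else fac h (armCount h r)
    move : ∀ d x y c → d K.* x K.* y K.* c K.≈ d K.* c K.* (x K.* y)
    move d x y c = K.trans (K.*-congʳ (K.*-assoc d x y))
      (K.trans (K.*-assoc d _ c) (K.trans (K.*-congˡ (K.*-comm _ c)) (K.sym (K.*-assoc d c _))))

  sum-unrotate : ∀ (f : Fin n → Laurent n) → sum f ≋ sum (f ∘ unrotate)
  sum-unrotate f = ≋-trans (sum-init-last f) (+-comm (sum (f ∘ inject₁)) (f (fromℕ m)))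

  π-F : ∀ k r → π (F k (map (map₂ unrotate) r)) ≋ q⁻¹ K.^ bottomHeight r • F k r
  π-F zero    r                 = ≋-refl
  π-F (suc k) []                = ≋-refl
  π-F (suc k) ((zero  , zero)  ∷ r) = π-F k r
  π-F (suc k) ((zero  , suc _) ∷ r) = π-F k r
  π-F (suc k) ((suc h , w) ∷ r) = begin
    π (sum f↓)                      ≈⟨ ≋-trans (π-cong (sum-unrotate f↓)) (π-sum (f↓ ∘ unrotate)) ⟩
    sum (λ u → π (f↓ (unrotate u))) ≈⟨ sum-cong-≋ term ⟩
    sum (λ u → N • f u)             ≈⟨ sum-• N f ⟨
    N • sum f                       ∎
    where
    open ≋-Reasoning
    r↓ : Queue n
    r↓ = map (map₂ unrotate) r
    f↓ f : Fin n → Laurent n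
    f↓ u = stepWeight (suc h) (unrotate w) r↓ u • X u (F k (r↓ ∷ʳ (h , u)))
    f  u = stepWeight (suc h) w r u • X u (F k (r ∷ʳ (h , u)))
    N : K
    N = q⁻¹ K.^ bottomHeight ((suc h , w) ∷ r)
    term : ∀ u → π (f↓ (unrotate u)) ≋ N • f u
    term u = begin
      π (c↓ • X (unrotate u) (F k (r↓ ∷ʳ (h , unrotate u))))
        ≈⟨ ≋-trans (π-• c↓ _) (•-cong K.refl (π-X u _)) ⟩
      c↓ • (q⁻[ u ] • X u (π (F k (r↓ ∷ʳ (h , unrotate u)))))
        ≡⟨ ≡.cong (λ l → c↓ • (q⁻[ u ] • X u (π (F k l)))) (≡.sym (List.map-++ (map₂ unrotate) r [ h , u ])) ⟩
      c↓ • (q⁻[ u ] • X u (π (F k (map (map₂ unrotate) (r ∷ʳ (h , u))))))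
        ≈⟨ •-cong K.refl (•-cong K.refl (≋-trans (X-cong u (π-F k (r ∷ʳ (h , u)))) (X-• u M z))) ⟩
      c↓ • (q⁻[ u ] • (M • X u z))
        ≈⟨ ≋-trans (•-assoc c↓ _ _) (•-cong K.refl (•-assoc q⁻[ u ] M _)) ⟨
      (c↓ K.* (q⁻[ u ] K.* M)) • X u z
        ≈⟨ •-cong scalar ≋-refl ⟩
      (N K.* stepWeight (suc h) w r u) • X u z
        ≈⟨ •-assoc N _ _ ⟩
      N • f u ∎
      where
      z : Laurent n
      z = F k (r ∷ʳ (h , u))
      c↓ M B c : K
      c↓ = stepWeight (suc h) (unrotate w) r↓ (unrotate u)
      c = stepWeight (suc h) w r u
      M = q⁻¹ K.^ bottomHeight (r ∷ʳ (h , u))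
      B = q⁻¹ K.^ bottomHeight r
      M≈ : M K.≈ boundary h u K.* B
      M≈ = K.trans (K.reflexive (≡.cong (q⁻¹ K.^_) (bottomHeight-∷ʳ r h u)))
        (K.trans (Exp.^-homo-* K.semiring q⁻¹ (bottomHeight [ h , u ]) (bottomHeight r))
          (K.*-congʳ (K.trans (K.sym (boundary-bottomHeight h u [])) (K.*-identityʳ _))))
      -- The scalar of x_u raises `boundary h u` to `boundary (suc h) u`, and the change of weight
      -- turns that into `boundary (suc h) w`, the share the column had before the step.
      scalar : c↓ K.* (q⁻[ u ] K.* M) K.≈ N K.* c
      scalar = K.trans (K.*-congˡ (K.trans (K.*-congˡ M≈) (K.trans (K.sym (K.*-assoc _ _ B)) (K.*-congʳ (boundary-suc h u)))))
        (K.trans (K.sym (K.*-assoc c↓ _ B)) (K.trans (K.*-congʳ (stepWeight-unrotate (suc h) u w r))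
          (K.trans (K.*-assoc c _ B) (K.trans (K.*-congˡ (boundary-bottomHeight (suc h) w r)) (K.*-comm c N)))))

open import Defs using
  ( WeakComposition; Box; Box^; boxes; boxes^; col; row; up; d; leg; InArm; inArm?; arm
  ; Attacking; Filling; fillings; enumerate; augment; NonAttacking; nonAttacking?
  ; maj; χ; coinversions; coinvtrip; monomial; inversion?; ε; #ε⁻)

-- Sums over fillings

put : ∀ {n} {A : Fin n → Set} → (∀ i → A i) → ∀ i → A i → ∀ i → A i
put {suc n} f zero    a = Fin.∀-cons a (f ∘ suc)
put {suc n} f (suc i) a = Fin.∀-cons (f zero) (put (f ∘ suc) i a)

put-same : ∀ {n} {A : Fin n → Set} (f : ∀ i → A i) i a → put f i a i ≡ a
put-same f zero    a = ≡.refl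
put-same f (suc i) a = put-same (f ∘ suc) i a

put-other : ∀ {n} {A : Fin n → Set} (f : ∀ i → A i) i a {k} → k ≢ i → put f i a k ≡ f k
put-other f zero    a {zero}  k≢i = contradiction ≡.refl k≢i
put-other f zero    a {suc k} k≢i = ≡.refl
put-other f (suc i) a {zero}  k≢i = ≡.refl
put-other f (suc i) a {suc k} k≢i = put-other (f ∘ suc) i a (k≢i ∘ ≡.cong suc)

module FillingSums (R : CommutativeRing 0ℓ 0ℓ) {n : ℕ} (γ : WeakComposition n) where

  open LaurentPolynomials R

  L : Set
  L = Laurent n

  open Sum (+-commutativeMonoid {n}) using (sum; sum-cong-≋; ∑-comm)

  sumOver : ∀ {A : Set} → List A → (A → L) → L
  sumOver xs φ = foldr (λ x → φ x +ᴸ_) [] xs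

  sumOver-++ : ∀ {A : Set} (xs ys : List A) φ → sumOver (xs ++ ys) φ ≡ sumOver xs φ +ᴸ sumOver ys φ
  sumOver-++ []       ys φ = ≡.refl
  sumOver-++ (x ∷ xs) ys φ = ≡.trans (≡.cong (φ x ++_) (sumOver-++ xs ys φ)) (≡.sym (List.++-assoc (φ x) _ _))

  sumOver-map : ∀ {A B : Set} (g : A → B) xs φ → sumOver (map g xs) φ ≡ sumOver xs (φ ∘ g)
  sumOver-map g []       φ = ≡.refl
  sumOver-map g (x ∷ xs) φ = ≡.cong (φ (g x) ++_) (sumOver-map g xs φ)

  sumOver-cong : ∀ {A : Set} (xs : List A) {φ ψ} → (∀ x → φ x ≋ ψ x) → sumOver xs φ ≋ sumOver xs ψ
  sumOver-cong []       p = ≋-refl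
  sumOver-cong (x ∷ xs) p = +-cong (p x) (sumOver-cong xs p)

  sumOver-product : ∀ {A B C : Set} (g : A → B → C) xs ys φ →
    sumOver (cartesianProductWith g xs ys) φ ≡ sumOver xs λ x → sumOver ys (φ ∘ g x)
  sumOver-product g []       ys φ = ≡.refl
  sumOver-product g (x ∷ xs) ys φ = ≡.trans (sumOver-++ (map (g x) ys) _ φ)
    (≡.cong₂ _++_ (sumOver-map (g x) ys φ) (sumOver-product g xs ys φ))

  sumOver-filter : ∀ {A : Set} {P : Pred A 0ℓ} (P? : Decidable P) (g : A → _) xs →
    map g (filter P? xs) ≡ sumOver xs λ x → if does (P? x) then [ g x ] else []
  sumOver-filter P? g []       = ≡.refl
  sumOver-filter P? g (x ∷ xs) with does (P? x)
  ... | true  = ≡.cong (g x ∷_) (sumOver-filter P? g xs)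
  ... | false = sumOver-filter P? g xs

  sumOver-tabulate : ∀ {A : Set} {k} (g : Fin k → A) φ → sumOver (tabulate g) φ ≡ sum (φ ∘ g)
  sumOver-tabulate {k = zero}  g φ = ≡.refl
  sumOver-tabulate {k = suc k} g φ = ≡.cong (φ (g zero) ++_) (sumOver-tabulate (g ∘ suc) φ)

  -- The sum over one coordinate after another in a prescribed order, overwriting the default f.
  iterate : ∀ {k} {A : Fin k → Set} (as : ∀ i → List (A i)) → List (Fin k) → (∀ i → A i) → ((∀ i → A i) → L) → L
  iterate as []       f φ = φ f
  iterate as (i ∷ is) f φ = sumOver (as i) λ a → iterate as is (put f i a) φ

  iterate-map-suc : ∀ {k} {A : Fin (suc k) → Set} (as : ∀ i → List (A i)) is a f φ →
    iterate as (map suc is) (Fin.∀-cons {P = A} a f) φ ≋ iterate (as ∘ suc) is f (φ ∘ Fin.∀-cons {P = A} a)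
  iterate-map-suc as []       a f φ = ≋-refl
  iterate-map-suc as (i ∷ is) a f φ = sumOver-cong (as (suc i)) λ x → iterate-map-suc as is a (put f i x) φ

  sumOver-enumerate : ∀ {k} {A : Fin k → Set} (as : ∀ i → List (A i)) f φ →
    (∀ {g h} → (∀ i → g i ≡ h i) → φ g ≋ φ h) → sumOver (enumerate as) φ ≋ iterate as (allFin k) f φ
  sumOver-enumerate {zero}  as f φ resp = ≋-trans (≋-reflexive (List.++-identityʳ _)) (resp λ ())
  sumOver-enumerate {suc k} {A} as f φ resp = begin
    sumOver (cartesianProductWith Fin.∀-cons (as zero) (enumerate (as ∘ suc))) φ
      ≡⟨ sumOver-product Fin.∀-cons (as zero) (enumerate (as ∘ suc)) φ ⟩
    sumOver (as zero) (λ a → sumOver (enumerate (as ∘ suc)) (φ ∘ Fin.∀-cons a))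
      ≈⟨ sumOver-cong (as zero) (λ a → sumOver-enumerate (as ∘ suc) (f ∘ suc) (φ ∘ Fin.∀-cons a)
           λ p → resp λ { zero → ≡.refl ; (suc i) → p i }) ⟩
    sumOver (as zero) (λ a → iterate (as ∘ suc) (allFin k) (f ∘ suc) (φ ∘ Fin.∀-cons a))
      ≈⟨ sumOver-cong (as zero) (λ a → iterate-map-suc as (allFin k) a (f ∘ suc) φ) ⟨
    sumOver (as zero) (λ a → iterate as (map suc (allFin k)) (put f zero a) φ)
      ≡⟨ ≡.cong (λ is → sumOver (as zero) (λ a → iterate as is (put f zero a) φ)) (List.map-tabulate id suc) ⟩
    sumOver (as zero) (λ a → iterate as (tabulate suc) (put f zero a) φ) ∎
    where open ≋-Reasoning

  infix 4 _≐_ _≟ᵇ_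

  _≐_ : Filling γ → Filling γ → Set
  σ ≐ σ′ = ∀ i j → σ i j ≡ σ′ i j

  -- Rewriting sums changes fillings only up to pointwise equality, so the summand has to respect
  -- it.
  Extensional : (Filling γ → L) → Set
  Extensional φ = ∀ {σ σ′} → σ ≐ σ′ → φ σ ≋ φ σ′

  _≟ᵇ_ : (u v : Box γ) → Dec (u ≡ v)
  _≟ᵇ_ = Product.≡-dec Fin._≟_ Fin._≟_

  _[_≔_] : Filling γ → Box γ → Fin n → Filling γ
  (σ [ u ≔ x ]) i j = if does ((i , j) ≟ᵇ u) then x else σ i j

  update-same : ∀ σ i j x → (σ [ (i , j) ≔ x ]) i j ≡ x
  update-same σ i j x rewrite dec-true ((i , j) ≟ᵇ (i , j)) ≡.refl = ≡.refl

  update-other : ∀ σ u x {i j} → (i , j) ≢ u → (σ [ u ≔ x ]) i j ≡ σ i j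
  update-other σ u x {i} {j} ≢u rewrite dec-false ((i , j) ≟ᵇ u) ≢u = ≡.refl

  update-≐ : ∀ {σ σ′} u x → σ ≐ σ′ → σ [ u ≔ x ] ≐ σ′ [ u ≔ x ]
  update-≐ u x p i j = ≡.cong (λ y → if does ((i , j) ≟ᵇ u) then x else y) (p i j)

  update-swap : ∀ σ {u v} x y → u ≢ v → σ [ u ≔ x ] [ v ≔ y ] ≐ σ [ v ≔ y ] [ u ≔ x ]
  update-swap σ {u} {v} x y u≢v i j with (i , j) ≟ᵇ u | (i , j) ≟ᵇ v
  ... | yes p | yes r = contradiction (≡.trans (≡.sym p) r) u≢v
  ... | yes p | no  r = ≡.refl
  ... | no  p | yes r = ≡.refl
  ... | no  p | no  r = ≡.refl

  updateSum : List (Box γ) → Filling γ → (Filling γ → L) → L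
  updateSum []       σ φ = φ σ
  updateSum (u ∷ us) σ φ = sum λ x → updateSum us (σ [ u ≔ x ]) φ

  updateSum-≐ : ∀ us {φ} → Extensional φ → Extensional λ σ → updateSum us σ φ
  updateSum-≐ []       ext p = ext p
  updateSum-≐ (u ∷ us) ext p = sum-cong-≋ λ x → updateSum-≐ us ext (update-≐ u x p)

  updateSum-++ : ∀ us vs σ φ → updateSum (us ++ vs) σ φ ≋ updateSum us σ λ σ′ → updateSum vs σ′ φ
  updateSum-++ []       vs σ φ = ≋-refl
  updateSum-++ (u ∷ us) vs σ φ = sum-cong-≋ λ x → updateSum-++ us vs (σ [ u ≔ x ]) φ

  updateSum-↭ : ∀ {us vs φ} → Extensional φ → us ↭ vs → ∀ σ → updateSum us σ φ ≋ updateSum vs σ φ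
  updateSum-↭ ext ↭.refl         σ = ≋-refl
  updateSum-↭ ext (↭.prep u p)   σ = sum-cong-≋ λ x → updateSum-↭ ext p (σ [ u ≔ x ])
  updateSum-↭ ext (↭.trans p r)  σ = ≋-trans (updateSum-↭ ext p σ) (updateSum-↭ ext r σ)
  updateSum-↭ {φ = φ} ext (↭.swap {us} {vs} u v p) σ with u ≟ᵇ v
  -- For u = v both orders prescribe the same updates, so no sums are interchanged.
  ... | yes ≡.refl = sum-cong-≋ {n} {λ x → sum λ y → updateSum us (σ [ u ≔ x ] [ u ≔ y ]) φ} λ x →
    sum-cong-≋ λ y → updateSum-↭ ext p (σ [ u ≔ x ] [ u ≔ y ])
  ... | no  u≢v    = ≋-trans
    (sum-cong-≋ {n} {λ x → sum λ y → updateSum us (σ [ u ≔ x ] [ v ≔ y ]) φ} λ x →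
      sum-cong-≋ λ y → ≋-trans (updateSum-↭ ext p (σ [ u ≔ x ] [ v ≔ y ])) (updateSum-≐ vs ext (update-swap σ x y u≢v)))
    (∑-comm λ x y → updateSum vs (σ [ v ≔ y ] [ u ≔ x ]) φ)

  put-column : ∀ σ i (g : Fin (γ i) → Fin n) j x → put σ i (put g j x) ≐ put σ i g [ (i , j) ≔ x ]
  put-column σ i g j x i′ j′ with (i′ , j′) ≟ᵇ (i , j)
  ... | yes ≡.refl = ≡.trans (≡.cong-app (put-same σ i _) j) (put-same g j x)
  ... | no  ≢ij with i′ Fin.≟ i
  ...   | yes ≡.refl = ≡.trans (≡.cong-app (put-same σ i _) j′)
    (≡.trans (put-other g j x (≢ij ∘ ≡.cong (i ,_))) (≡.sym (≡.cong-app (put-same σ i g) j′)))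
  ...   | no  i′≢i   = ≡.trans (≡.cong-app (put-other σ i _ i′≢i) j′) (≡.sym (≡.cong-app (put-other σ i g i′≢i) j′))

  put-self : ∀ σ i → put σ i (σ i) ≐ σ
  put-self σ i i′ j with i′ Fin.≟ i
  ... | yes ≡.refl = ≡.cong-app (put-same σ i (σ i)) j
  ... | no  i′≢i   = ≡.cong-app (put-other σ i (σ i) i′≢i) j

  iterate-column : ∀ σ i φ → Extensional φ → ∀ js g →
    iterate (λ _ → allFin n) js g (φ ∘ put σ i) ≋ updateSum (map (i ,_) js) (put σ i g) φ
  iterate-column σ i φ ext []       g = ≋-refl
  iterate-column σ i φ ext (j ∷ js) g = begin
    sumOver (allFin n) (λ x → iterate (λ _ → allFin n) js (put g j x) (φ ∘ put σ i))
      ≡⟨ sumOver-tabulate {k = n} id (λ x → iterate (λ _ → allFin n) js (put g j x) (φ ∘ put σ i)) ⟩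
    sum (λ x → iterate (λ _ → allFin n) js (put g j x) (φ ∘ put σ i))
      ≈⟨ sum-cong-≋ (λ x → ≋-trans (iterate-column σ i φ ext js (put g j x))
           (updateSum-≐ (map (i ,_) js) ext (put-column σ i g j x))) ⟩
    sum (λ x → updateSum (map (i ,_) js) (put σ i g [ (i , j) ≔ x ]) φ) ∎
    where open ≋-Reasoning

  columns : ∀ i → List (Fin (γ i) → Fin n)
  columns i = enumerate λ _ → allFin n

  put-≐ : ∀ {σ σ′} i {g g′} → σ ≐ σ′ → g ≗ g′ → put σ i g ≐ put σ′ i g′
  put-≐ {σ} {σ′} i {g} {g′} p r i′ j with i′ Fin.≟ i
  ... | yes ≡.refl = ≡.trans (≡.cong-app (put-same σ i g) j) (≡.trans (r j) (≡.sym (≡.cong-app (put-same σ′ i g′) j)))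
  ... | no  i′≢i   = ≡.trans (≡.cong-app (put-other σ i g i′≢i) j)
    (≡.trans (p i′ j) (≡.sym (≡.cong-app (put-other σ′ i g′ i′≢i) j)))

  iterate-≐ : ∀ is {φ} → Extensional φ → Extensional λ σ → iterate columns is σ φ
  iterate-≐ []       ext p = ext p
  iterate-≐ (i ∷ is) ext p = sumOver-cong (columns i) λ g → iterate-≐ is ext (put-≐ i p λ _ → ≡.refl)

  iterate-columns : ∀ is σ φ → Extensional φ →
    iterate columns is σ φ ≋ updateSum (concatMap (λ i → map (i ,_) (allFin (γ i))) is) σ φ
  iterate-columns []       σ φ ext = ≋-refl
  iterate-columns (i ∷ is) σ φ ext = begin
    sumOver (columns i) (ψ ∘ put σ i)
      ≈⟨ sumOver-enumerate (λ _ → allFin n) (σ i) (ψ ∘ put σ i) (λ p → ψ-ext (put-≐ i (λ _ _ → ≡.refl) p)) ⟩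
    iterate (λ _ → allFin n) (allFin (γ i)) (σ i) (ψ ∘ put σ i)
      ≈⟨ iterate-column σ i ψ ψ-ext (allFin (γ i)) (σ i) ⟩
    updateSum us (put σ i (σ i)) ψ
      ≈⟨ updateSum-≐ us ψ-ext (put-self σ i) ⟩
    updateSum us σ ψ
      ≈⟨ updateSum-cong us σ (λ σ′ → iterate-columns is σ′ φ ext) ⟩
    updateSum us σ (λ σ′ → updateSum vs σ′ φ)
      ≈⟨ updateSum-++ us vs σ φ ⟨
    updateSum (us ++ vs) σ φ ∎
    where
    open ≋-Reasoning
    us vs : List (Box γ)
    us = map (i ,_) (allFin (γ i))
    vs = concatMap (λ i → map (i ,_) (allFin (γ i))) is
    ψ : Filling γ → L
    ψ σ = iterate columns is σ φ
    ψ-ext : Extensional ψ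
    ψ-ext = iterate-≐ is ext
    updateSum-cong : ∀ us σ {φ ψ} → (∀ σ → φ σ ≋ ψ σ) → updateSum us σ φ ≋ updateSum us σ ψ
    updateSum-cong []       σ p = p σ
    updateSum-cong (u ∷ us) σ p = sum-cong-≋ λ x → updateSum-cong us (σ [ u ≔ x ]) p

  -- The initial filling is arbitrary because `boxes γ` contains every box, so each of its entries
  -- is overwritten.
  sumOver-fillings : ∀ σ φ → Extensional φ → sumOver (fillings γ) φ ≋ updateSum (boxes γ) σ φ
  sumOver-fillings σ φ ext = ≋-trans
    (sumOver-enumerate columns σ φ (λ p → ext (λ i j → ≡.cong-app (p i) j)))
    (iterate-columns (allFin n) σ φ ext)

  Untouched : List (Box γ) → Filling γ → Filling γ → Set
  Untouched us σ σ′ = ∀ i j → All (λ u → (i , j) ≢ u) us → σ′ i j ≡ σ i j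

  -- Lets a summand rely on the entries read earlier: every filling that occurs agrees with σ off
  -- `us`.
  updateSum-cong-on : ∀ us σ {φ ψ} → (∀ σ′ → Untouched us σ σ′ → φ σ′ ≋ ψ σ′) → updateSum us σ φ ≋ updateSum us σ ψ
  updateSum-cong-on []       σ p = p σ λ _ _ _ → ≡.refl
  updateSum-cong-on (u ∷ us) σ p = sum-cong-≋ λ x → updateSum-cong-on us (σ [ u ≔ x ])
    λ σ′ r → p σ′ λ { i j (≢u ∷ ≢us) → ≡.trans (r i j ≢us) (update-other σ u x ≢u) }

  sum-linear : (G : L → L) → G [] ≋ [] → (∀ f g → G (f +ᴸ g) ≋ G f +ᴸ G g) →
               ∀ {k} (f : Vector L k) → G (sum f) ≋ sum (G ∘ f)
  sum-linear G G0 G+ {zero}  f = G0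
  sum-linear G G0 G+ {suc k} f = ≋-trans (G+ (f zero) (sum (f ∘ suc))) (+-cong ≋-refl (sum-linear G G0 G+ (f ∘ suc)))

  updateSum-linear : (G : L → L) → (∀ {f g} → f ≋ g → G f ≋ G g) → G [] ≋ [] → (∀ f g → G (f +ᴸ g) ≋ G f +ᴸ G g) →
                     ∀ us σ φ → G (updateSum us σ φ) ≋ updateSum us σ (G ∘ φ)
  updateSum-linear G G-cong G0 G+ []       σ φ = ≋-refl
  updateSum-linear G G-cong G0 G+ (u ∷ us) σ φ = ≋-trans (sum-linear G G0 G+ λ x → updateSum us (σ [ u ≔ x ]) φ)
    (sum-cong-≋ λ x → updateSum-linear G G-cong G0 G+ us (σ [ u ≔ x ]) φ)

-- Arms and attacking boxes in terms of the boxes read before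

∈-column : ∀ {n} {A : Fin n → Set} (xs : ∀ i → List (A i)) {is i x} → i ∈ is → x ∈ xs i →
           (i , x) ∈ concatMap (λ i → map (i ,_) (xs i)) is
∈-column xs (here ≡.refl) x∈ = ∈-++⁺ˡ (∈-map⁺ _ x∈)
∈-column xs {k ∷ _} (there i∈) x∈ = ∈-++⁺ʳ (map (k ,_) (xs k)) (∈-column xs i∈ x∈)

module _ {n : ℕ} (γ : WeakComposition n) where

  ∈-boxes : ∀ u → u ∈ boxes γ
  ∈-boxes (i , j) = ∈-column (λ i → allFin (γ i)) (∈-allFin i) (∈-allFin j)

  ∈-boxes^ : ∀ v → v ∈ boxes^ γ
  ∈-boxes^ (i , j) = ∈-column (λ i → allFin (suc (γ i))) (∈-allFin i) (∈-allFin j)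

  -- The boxes attacked by or attacking u that precede it in the row-by-row reading order.
  Prior : Box γ → Box^ γ → Set
  Prior u v = (row γ v ≡ row γ (up γ u) × col γ v Fin.< proj₁ u)
            ⊎ (row γ v ≡ row γ (d γ u)  × proj₁ u Fin.< col γ v)

  prior? : ∀ u v → Dec (Prior u v)
  prior? u v = (row γ v ℕ.≟ row γ (up γ u) ×-dec col γ v Fin.<? proj₁ u)
         ⊎-dec (row γ v ℕ.≟ row γ (d γ u)  ×-dec proj₁ u Fin.<? col γ v)

  prior : Box γ → List (Box^ γ)
  prior u = filter (prior? u) (boxes^ γ)

  height : Box^ γ → ℕ
  height v = γ (col γ v) ∸ row γ v

  suc-leg : ∀ u → suc (leg γ u) ≡ height (d γ u)
  suc-leg (i , j) = ≡.trans (≡.sym (ℕ.+-∸-assoc 1 (Fin.toℕ<n j))) (≡.cong (γ i ∸_) (≡.sym (Fin.toℕ-inject₁ j)))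

  row-≤ : ∀ v → row γ v ℕ.≤ γ (col γ v)
  row-≤ (i , j) = ℕ.≤-pred (Fin.toℕ<n j)

  ∸-≤ : ∀ {a b c} → c ℕ.≤ a → c ℕ.≤ b → a ∸ c ℕ.≤ b ∸ c → a ℕ.≤ b
  ∸-≤ {a} {b} {c} c≤a c≤b p = ≡.subst₂ ℕ._≤_ (ℕ.m∸n+n≡m c≤a) (ℕ.m∸n+n≡m c≤b) (ℕ.+-monoˡ-≤ c p)

  -- For u in row j, a prior box to the left lies in row j and one to the right in row j - 1. Having
  -- fewer than `suc (leg u)` = γ_i - j + 1 boxes above therefore means γ_i′ ≤ γ_i on the left and
  -- γ_i′ < γ_i on the right, the two conditions in the definition of the arm.
  inArm-prior : ∀ u v → does (prior? u v) ∧ does (height v ℕ.<? suc (leg γ u)) ≡ does (inArm? γ u v)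
  inArm-prior u@(i , j) v = does-⇔ (mk⇔ to from) (prior? u v ×-dec height v ℕ.<? suc (leg γ u)) (inArm? γ u v)
    where
    to : Prior u v × height v ℕ.< suc (leg γ u) → InArm γ u v
    to (inj₁ (r , c) , h) = inj₁ (r , c , ∸-≤ (row-≤ v) (≡.subst (ℕ._≤ γ i) (≡.sym r) (Fin.toℕ<n j))
      (≡.subst (λ k → height v ℕ.≤ γ i ∸ k) (≡.sym r) (ℕ.≤-pred h)))
    to (inj₂ (r , c) , h) = inj₂ (r , c , ∸-≤ (≡.subst (ℕ._≤ suc (γ (col γ v))) ≡.refl (ℕ.m≤n⇒m≤1+n (row-≤ v)))
      (≡.subst (ℕ._≤ γ i) (≡.sym r) (row-≤ (d γ u)))
      (≡.subst₂ ℕ._≤_ (≡.sym (ℕ.+-∸-assoc 1 (row-≤ v))) (≡.trans (suc-leg u) (≡.cong (γ i ∸_) (≡.sym r))) h))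
    from : InArm γ u v → Prior u v × height v ℕ.< suc (leg γ u)
    from (inj₁ (r , c , g)) = inj₁ (r , c) , ℕ.s≤s (≡.subst (λ k → height v ℕ.≤ γ i ∸ k) r (ℕ.∸-monoˡ-≤ (row γ v) g))
    from (inj₂ (r , c , g)) = inj₂ (r , c) , ≡.subst (height v ℕ.<_)
      (≡.sym (≡.trans (suc-leg u) (≡.cong (γ i ∸_) (≡.sym r)))) (ℕ.∸-monoˡ-< g (row-≤ v))

  entry : (Box^ γ → Fin n) → Box^ γ → ℕ × Fin n
  entry σ^ v = height v , σ^ v

  armCount-arm : ∀ σ^ u bs →
    armCount (suc (leg γ u)) (map (entry σ^) (filter (prior? u) bs)) ≡ length (filter (inArm? γ u) bs)
  armCount-arm σ^ u []       = ≡.refl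
  armCount-arm σ^ u (v ∷ bs) with does (prior? u v) | does (inArm? γ u v) | inArm-prior u v
  ... | false | _ | ≡.refl = armCount-arm σ^ u bs
  ... | true  | _ | ≡.refl with does (height v ℕ.<? suc (leg γ u))
  ...   | true  = ≡.cong suc (armCount-arm σ^ u bs)
  ...   | false = armCount-arm σ^ u bs

  coinvCount-arm : ∀ σ^ u bs →
    coinvCount (suc (leg γ u)) (σ^ (up γ u)) (σ^ (d γ u)) (map (entry σ^) (filter (prior? u) bs)) ≡
    length (filter (λ v → χ γ σ^ (up γ u) v ℕ.+ χ γ σ^ v (d γ u) ℕ.≟ χ γ σ^ (up γ u) (d γ u)) (filter (inArm? γ u) bs))
  coinvCount-arm σ^ u []       = ≡.refl
  coinvCount-arm σ^ u (v ∷ bs) with does (prior? u v) | does (inArm? γ u v) | inArm-prior u v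
  ... | false | _ | ≡.refl = coinvCount-arm σ^ u bs
  ... | true  | _ | ≡.refl with does (height v ℕ.<? suc (leg γ u))
  ...   | false = coinvCount-arm σ^ u bs
  ...   | true  with does (χ γ σ^ (up γ u) v ℕ.+ χ γ σ^ v (d γ u) ℕ.≟ χ γ σ^ (up γ u) (d γ u))
  ...     | true  = ≡.cong suc (coinvCount-arm σ^ u bs)
  ...     | false = coinvCount-arm σ^ u bs

  Valid : (Box^ γ → Fin n) → Box γ → Set
  Valid σ^ u = Fresh (σ^ (up γ u)) (map (entry σ^) (prior u))

  valid? : ∀ σ^ u → Dec (Valid σ^ u)
  valid? σ^ u = All.all? (λ (_ , y) → ¬? (σ^ (up γ u) Fin.≟ y)) _

  nonAttacking⇒valid : ∀ {σ^} → NonAttacking γ σ^ → ∀ u → Valid σ^ u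
  nonAttacking⇒valid {σ^} na u@(i , j) = All.map⁺ (All.tabulate λ {v} v∈ → na (up γ u) v (attack v (proj₂ (∈-filter⁻ (prior? u) {xs = boxes^ γ} v∈))))
    where
    attack : ∀ v → Prior u v → Attacking γ (up γ u) v
    attack v (inj₁ (r , c)) = inj₁ (≡.sym r , λ i≡ → ℕ.<-irrefl (≡.cong toℕ (≡.sym i≡)) c)
    attack v (inj₂ (r , c)) = inj₂ (≡.cong suc (≡.sym (≡.trans r (Fin.toℕ-inject₁ j))) , c)

  module _ (τ : Permutation′ n) where

    -- Of two attacking boxes not both in the basement, the one read later has the other among its
    -- prior boxes; within the basement τ is injective.
    valid⇒nonAttacking : ∀ {σ} → (∀ u → Valid (augment γ τ σ) u) → NonAttacking γ (augment γ τ σ)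
    valid⇒nonAttacking {σ} val = attack
      where
      σ^ : Box^ γ → Fin n
      σ^ = augment γ τ σ
      distinct : ∀ u v → Prior u v → σ^ (up γ u) ≢ σ^ v
      distinct u v p = All.lookup (All.map⁻ (val u)) (∈-filter⁺ (prior? u) (∈-boxes^ v) p)
      attack : NonAttacking γ σ^
      attack (i , zero)  (k , zero)  (inj₁ (_ , i≢k)) e =
        i≢k (≡.trans (≡.sym (inverseˡ τ)) (≡.trans (≡.cong (τ ⟨$⟩ˡ_) e) (inverseˡ τ)))
      attack (i , zero)  (k , suc l) (inj₁ (() , _))
      attack (i , suc j) (k , zero)  (inj₁ (() , _))
      attack (i , suc j) (k , suc l) (inj₁ (r , i≢k)) e with ℕ.<-cmp (toℕ i) (toℕ k)
      ... | tri< i<k _ _ = distinct (k , l) (i , suc j) (inj₁ (r , i<k)) (≡.sym e)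
      ... | tri≈ _ i≡k _ = i≢k (Fin.toℕ-injective i≡k)
      ... | tri> _ _ k<i = distinct (i , j) (k , suc l) (inj₁ (≡.sym r , k<i)) e
      attack (i , suc j) v (inj₂ (r , c)) e =
        distinct (i , j) v (inj₂ (≡.trans (≡.sym (ℕ.suc-injective r)) (≡.sym (Fin.toℕ-inject₁ j)) , c)) e

-- The weight of a filling as a product over its boxes

module LocalWeights (R : CommutativeRing 0ℓ 0ℓ)
  (q t : CommutativeRing.Carrier R) (fac : ℕ → ℕ → CommutativeRing.Carrier R) {n : ℕ} (γ : WeakComposition n) (τ : Permutation′ n) where

  open LaurentPolynomials R
  open QueueRecursion R q t fac n
  open FillingSums R γ

  weight : (Box^ γ → Fin n) → K
  weight σ^ = q K.^ maj γ σ^ K.* t K.^ coinvtrip γ σ^ K.*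
    foldr K._*_ K.1# (map (λ u → fac (suc (leg γ u)) (length (arm γ u)))
      (filter (λ u → ¬? (σ^ (up γ u) Fin.≟ σ^ (d γ u))) (boxes γ)))

  E : Laurent n
  E = map (λ σ → weight (augment γ τ σ) , monomial γ σ)
    (filter (λ σ → nonAttacking? γ (augment γ τ σ)) (fillings γ))

  localWeight : Filling γ → Box γ → K
  localWeight σ u = stepWeight (suc (leg γ u)) (σ^ (d γ u)) (map (entry γ σ^) (prior γ u)) (σ^ (up γ u))
    where σ^ = augment γ τ σ

  -- Nested in the same way as a summand of F when the recursion is unfolded along `us`.
  boxProduct : List (Box γ) → Filling γ → Laurent n
  boxProduct us σ = foldr (λ u f → localWeight σ u • X (σ (proj₁ u) (proj₂ u)) f) 1ᴸ us

  coefficient : List (Box γ) → Filling γ → K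
  coefficient us σ = foldr (λ u c → localWeight σ u K.* c) K.1# us

  exponent : List (Box γ) → Filling γ → Fin n → ℤ
  exponent us σ = foldr (λ u e k → δ (σ (proj₁ u) (proj₂ u)) k ℤ.+ e k) (λ _ → 0ℤ) us

  boxProduct-term : ∀ us σ → boxProduct us σ ≡ [ coefficient us σ , exponent us σ ]
  boxProduct-term []       σ = ≡.refl
  boxProduct-term (u ∷ us) σ = ≡.cong (λ f → localWeight σ u • X (σ (proj₁ u) (proj₂ u)) f) (boxProduct-term us σ)

  exponent-count : ∀ us σ k → exponent us σ k ≡ + length (filter (λ (i , j) → σ i j Fin.≟ k) us)
  exponent-count []             σ k = ≡.refl
  exponent-count ((i , j) ∷ us) σ k with does (σ i j Fin.≟ k)
  ... | true  = ≡.cong (λ z → 1ℤ ℤ.+ z) (exponent-count us σ k)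
  ... | false = ≡.trans (≡.cong (λ z → 0ℤ ℤ.+ z) (exponent-count us σ k)) ≡.refl

  module _ (σ : Filling γ) where

    private
      σ^ : Box^ γ → Fin n
      σ^ = augment γ τ σ

    descents : List (Box γ) → List (Box γ)
    descents = filter λ u → σ^ (d γ u) Fin.<? σ^ (up γ u)

    changes : List (Box γ) → List (Box γ)
    changes = filter λ u → ¬? (σ^ (up γ u) Fin.≟ σ^ (d γ u))

    factors : List (Box γ) → K
    factors us = foldr K._*_ K.1# (map (λ u → fac (suc (leg γ u)) (length (arm γ u))) (changes us))

    partialWeight : List (Box γ) → K
    partialWeight us = q K.^ sumℕ (map (λ u → suc (leg γ u)) (descents us)) K.*
      t K.^ sumℕ (map (length ∘ coinversions γ σ^) us) K.* factors us

    factor : Box γ → K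
    factor u = if does (σ^ (up γ u) Fin.≟ σ^ (d γ u)) then K.1# else fac (suc (leg γ u)) (length (arm γ u))

    q-descents : ∀ u us → q K.^ sumℕ (map (λ u → suc (leg γ u)) (descents (u ∷ us))) K.≈
      q K.^ (if does (σ^ (d γ u) Fin.<? σ^ (up γ u)) then suc (leg γ u) else 0) K.* q K.^ sumℕ (map (λ u → suc (leg γ u)) (descents us))
    q-descents u us with does (σ^ (d γ u) Fin.<? σ^ (up γ u))
    ... | true  = Exp.^-homo-* K.semiring q (suc (leg γ u)) (sumℕ (map (λ u → suc (leg γ u)) (descents us)))
    ... | false = K.sym (K.*-identityˡ _)

    factors-∷ : ∀ u us → factors (u ∷ us) K.≈ factor u K.* factors us
    factors-∷ u us with does (σ^ (up γ u) Fin.≟ σ^ (d γ u))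
    ... | true  = K.sym (K.*-identityˡ _)
    ... | false = K.refl

    localWeight-valid : ∀ u → Valid γ σ^ u → localWeight σ u K.≈
      q K.^ (if does (σ^ (d γ u) Fin.<? σ^ (up γ u)) then suc (leg γ u) else 0) K.*
      t K.^ length (coinversions γ σ^ u) K.* factor u
    localWeight-valid u val = K.reflexive (≡.trans
      (≡.cong (λ b → if b then boxWeight (suc (leg γ u)) (σ^ (d γ u)) (map (entry γ σ^) (prior γ u)) (σ^ (up γ u)) else K.0#) (fresh-true val))
      (≡.cong₂ (λ k l → q K.^ (if does (σ^ (d γ u) Fin.<? σ^ (up γ u)) then suc (leg γ u) else 0) K.* t K.^ k K.*
          (if does (σ^ (up γ u) Fin.≟ σ^ (d γ u)) then K.1# else fac (suc (leg γ u)) l))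
        (coinvCount-arm γ σ^ u (boxes^ γ)) (armCount-arm γ σ^ u (boxes^ γ))))

    coefficient-valid : ∀ us → All (Valid γ σ^) us → coefficient us σ K.≈ partialWeight us
    coefficient-valid []       []          = K.sym (K.trans (K.*-identityʳ _) (K.*-identityʳ _))
    coefficient-valid (u ∷ us) (val ∷ vals) = begin
      localWeight σ u K.* coefficient us σ
        ≈⟨ K.*-cong (localWeight-valid u val) (coefficient-valid us vals) ⟩
      (q₁ K.* t₁ K.* factor u) K.* (q₂ K.* t₂ K.* factors us)
        ≈⟨ interchange (q₁ K.* t₁) (factor u) (q₂ K.* t₂) (factors us) ⟩
      ((q₁ K.* t₁) K.* (q₂ K.* t₂)) K.* (factor u K.* factors us)
        ≈⟨ K.*-congʳ (interchange q₁ t₁ q₂ t₂) ⟩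
      ((q₁ K.* q₂) K.* (t₁ K.* t₂)) K.* (factor u K.* factors us)
        ≈⟨ K.*-cong (K.*-cong (q-descents u us)
             (Exp.^-homo-* K.semiring t (length (coinversions γ σ^ u)) (sumℕ (map (length ∘ coinversions γ σ^) us)))) (factors-∷ u us) ⟨
      partialWeight (u ∷ us) ∎
      where
      open SetoidReasoning K.setoid
      open CommutativeSemigroupProperties K.*-commutativeSemigroup using (interchange)
      q₁ q₂ t₁ t₂ : K
      q₁ = q K.^ (if does (σ^ (d γ u) Fin.<? σ^ (up γ u)) then suc (leg γ u) else 0)
      q₂ = q K.^ sumℕ (map (λ u → suc (leg γ u)) (descents us))
      t₁ = t K.^ length (coinversions γ σ^ u)
      t₂ = t K.^ sumℕ (map (length ∘ coinversions γ σ^) us)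

    coefficient-invalid : ∀ us → Any (¬_ ∘ Valid γ σ^) us → coefficient us σ K.≈ K.0#
    coefficient-invalid (u ∷ us) (here ¬val) = K.trans (K.*-congʳ (stepWeight-stale (suc (leg γ u)) (σ^ (d γ u)) (map (entry γ σ^) (prior γ u)) (σ^ (up γ u)) (stale ¬val))) (K.zeroˡ _)
      where
      stale : ¬ Valid γ σ^ u → fresh (σ^ (up γ u)) (map (entry γ σ^) (prior γ u)) ≡ false
      stale ¬val with fresh (σ^ (up γ u)) (map (entry γ σ^) (prior γ u)) in fr
      ... | true  = contradiction (true-fresh _ fr) ¬val
      ... | false = ≡.refl
    coefficient-invalid (u ∷ us) (there inv) = K.trans (K.*-congˡ (coefficient-invalid us inv)) (K.zeroʳ _)

    -- Fillings with an attack may be kept in the sum: one of their boxes is not `Valid`, and its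
    -- weight 0 kills the term.
    term-boxProduct : (if does (nonAttacking? γ σ^) then [ weight σ^ , monomial γ σ ] else []) ≋ boxProduct (boxes γ) σ
    term-boxProduct = ≋-trans (cases (nonAttacking? γ σ^)) (≋-reflexive (≡.sym (boxProduct-term (boxes γ) σ)))
      where
      cases : (D : Dec (NonAttacking γ σ^)) →
              (if does D then [ weight σ^ , monomial γ σ ] else []) ≋ [ coefficient (boxes γ) σ , exponent (boxes γ) σ ]
      cases (yes na) = singleton (K.sym (coefficient-valid (boxes γ) (All.universal (nonAttacking⇒valid γ na) _)))
        (λ k → ≡.sym (exponent-count (boxes γ) σ k))
      cases (no ¬na) with All.all? (valid? γ σ^) (boxes γ)
      ... | yes vals = contradiction (valid⇒nonAttacking γ τ λ u → All.lookup vals (∈-boxes γ u)) ¬na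
      ... | no ¬vals = ≋-sym (singleton-zero (coefficient-invalid (boxes γ) (All.¬All⇒Any¬ (valid? γ σ^) _ ¬vals)))

-- Independence of order, and the rows of a diagram

unique-set⇒↭ : ∀ {A : Set} {xs ys : List A} → Unique xs → Unique ys →
               (∀ {x} → x ∈ xs → x ∈ ys) → (∀ {x} → x ∈ ys → x ∈ xs) → xs ↭ ys
unique-set⇒↭ u v to from = ∼bag⇒↭ (unique∧set⇒bag u v (mk⇔ to from))

module _ {n : ℕ} where

  coinvCount-↭ : ∀ h (u w : Fin n) {r r′} → r ↭ r′ → coinvCount h u w r ≡ coinvCount h u w r′
  coinvCount-↭ h u w ↭.refl        = ≡.refl
  coinvCount-↭ h u w (↭.prep (h′ , v) p) = ≡.cong (indicator (does (h′ ℕ.<? h) ∧ coinversion u v w) ℕ.+_) (coinvCount-↭ h u w p)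
  coinvCount-↭ h u w (↭.swap (h′ , v) (h″ , v′) p) =
    ≡.trans (≡.cong (λ k → x ℕ.+ (y ℕ.+ k)) (coinvCount-↭ h u w p)) (+-swap x y _)
    where
    x y : ℕ
    x = indicator (does (h′ ℕ.<? h) ∧ coinversion u v w)
    y = indicator (does (h″ ℕ.<? h) ∧ coinversion u v′ w)
  coinvCount-↭ h u w (↭.trans p r) = ≡.trans (coinvCount-↭ h u w p) (coinvCount-↭ h u w r)

  armCount-↭ : ∀ h {r r′ : Queue n} → r ↭ r′ → armCount h r ≡ armCount h r′
  armCount-↭ h ↭.refl        = ≡.refl
  armCount-↭ h (↭.prep (h′ , v) p) = ≡.cong (indicator (does (h′ ℕ.<? h)) ℕ.+_) (armCount-↭ h p)
  armCount-↭ h (↭.swap (h′ , v) (h″ , v′) p) =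
    ≡.trans (≡.cong (λ k → x ℕ.+ (y ℕ.+ k)) (armCount-↭ h p)) (+-swap x y _)
    where
    x y : ℕ
    x = indicator (does (h′ ℕ.<? h))
    y = indicator (does (h″ ℕ.<? h))
  armCount-↭ h (↭.trans p r) = ≡.trans (armCount-↭ h p) (armCount-↭ h r)

  fresh-↭ : ∀ (u : Fin n) {r r′} → r ↭ r′ → fresh u r ≡ fresh u r′
  fresh-↭ u ↭.refl        = ≡.refl
  fresh-↭ u (↭.prep (h′ , v) p) = ≡.cong (not (does (u Fin.≟ v)) ∧_) (fresh-↭ u p)
  fresh-↭ u (↭.swap (h′ , v) (h″ , v′) p) = ≡.trans
    (≡.cong (λ k → not (does (u Fin.≟ v)) ∧ not (does (u Fin.≟ v′)) ∧ k) (fresh-↭ u p))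
    (∧-swap (not (does (u Fin.≟ v))) (not (does (u Fin.≟ v′))) _)
    where
    ∧-swap : ∀ x y z → x ∧ y ∧ z ≡ y ∧ x ∧ z
    ∧-swap true  true  z = ≡.refl
    ∧-swap true  false z = ≡.refl
    ∧-swap false true  z = ≡.refl
    ∧-swap false false z = ≡.refl
  fresh-↭ u (↭.trans p r) = ≡.trans (fresh-↭ u p) (fresh-↭ u r)

-- Used with γ for the boxes to be filled and with γ + 1 for the augmented diagram. The same level j
-- is row j + 1 in the first case and row j in the second, whose level 0 is the basement.
module Cells {n : ℕ} (ρ : Fin n → ℕ) where

  Cell : Set
  Cell = Σ[ i ∈ Fin n ] Fin (ρ i)

  level : Cell → ℕ
  level (i , j) = toℕ j

  cell : ℕ → Fin n → List Cell
  cell j i with j ℕ.<? ρ i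
  ... | yes j<ρ = [ i , fromℕ< j<ρ ]
  ... | no  _   = []

  cells : ℕ → List (Fin n) → List Cell
  cells j = concatMap (cell j)

  cell-at : ∀ x {j} → level x ≡ j → cell j (proj₁ x) ≡ [ x ]
  cell-at (i , k) {j} eq with j ℕ.<? ρ i
  ... | yes j<ρ = ≡.cong (λ l → [ i , l ]) (Fin.toℕ-injective (≡.trans (Fin.toℕ-fromℕ< j<ρ) (≡.sym eq)))
  ... | no  j≮ρ = contradiction (≡.subst (ℕ._< ρ i) eq (Fin.toℕ<n k)) j≮ρ

  cell-none : ∀ {i j} → ρ i ℕ.≤ j → cell j i ≡ []
  cell-none {i} {j} ρ≤j with j ℕ.<? ρ i
  ... | yes j<ρ = contradiction ρ≤j (ℕ.<⇒≱ j<ρ)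
  ... | no  _   = ≡.refl

  ∈-cell⁻ : ∀ {x j i} → x ∈ cell j i → level x ≡ j × proj₁ x ≡ i
  ∈-cell⁻ {j = j} {i} x∈ with j ℕ.<? ρ i
  ∈-cell⁻ (here ≡.refl) | yes j<ρ = Fin.toℕ-fromℕ< j<ρ , ≡.refl

  ∈-cells⁻ : ∀ {x j} is → x ∈ cells j is → level x ≡ j × proj₁ x ∈ is
  ∈-cells⁻ {j = j} (i ∷ is) x∈ with ∈-++⁻ (cell j i) x∈
  ... | inj₁ x∈i  = map₂ here (∈-cell⁻ x∈i)
  ... | inj₂ x∈is = map₂ there (∈-cells⁻ is x∈is)

  ∈-cells⁺ : ∀ {x j} is → level x ≡ j → proj₁ x ∈ is → x ∈ cells j is
  ∈-cells⁺ {x} {j} (i ∷ is) eq (here ≡.refl) = ∈-++⁺ˡ (≡.subst (x ∈_) (≡.sym (cell-at x eq)) (here ≡.refl))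
  ∈-cells⁺ {j = j} (i ∷ is) eq (there i∈)    = ∈-++⁺ʳ (cell j i) (∈-cells⁺ is eq i∈)

  unique-cell : ∀ j i → Unique (cell j i)
  unique-cell j i with j ℕ.<? ρ i
  ... | yes _ = [] ∷ []
  ... | no  _ = []

  unique-cells : ∀ j {is} → Unique is → Unique (cells j is)
  unique-cells j {[]}     []       = []
  unique-cells j {i ∷ is} (i∉ ∷ u) = Unique.++⁺ (unique-cell j i) (unique-cells j u)
    λ (x∈i , x∈is) → All.lookup i∉ (≡.subst (_∈ is) (proj₂ (∈-cell⁻ x∈i)) (proj₂ (∈-cells⁻ is x∈is))) ≡.refl

  cells-++ : ∀ j is ks → cells j (is ++ ks) ≡ cells j is ++ cells j ks
  cells-++ j is ks = List.concatMap-++ (cell j) is ks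

  cells-∷ʳ : ∀ j is k → cells j (is ∷ʳ k) ≡ cells j is ++ cell j k
  cells-∷ʳ j is k = ≡.trans (cells-++ j is [ k ]) (≡.cong (cells j is ++_) (List.++-identityʳ (cell j k)))

  rows : ℕ → ℕ → List Cell
  rows zero    j = []
  rows (suc k) j = cells j (allFin n) ++ rows k (suc j)

  ∈-rows⁻ : ∀ k {j x} → x ∈ rows k j → j ℕ.≤ level x
  ∈-rows⁻ (suc k) {j} x∈ with ∈-++⁻ (cells j (allFin n)) x∈
  ... | inj₁ x∈j = ℕ.≤-reflexive (≡.sym (proj₁ (∈-cells⁻ (allFin n) x∈j)))
  ... | inj₂ x∈k = ℕ.<⇒≤ (∈-rows⁻ k x∈k)

  ∈-rows⁺ : ∀ k {j x} → j ℕ.≤ level x → level x ℕ.< j ℕ.+ k → x ∈ rows k j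
  ∈-rows⁺ zero    {j} j≤ <j+0 = contradiction (≡.subst (_ ℕ.<_) (ℕ.+-identityʳ j) <j+0) (ℕ.≤⇒≯ j≤)
  ∈-rows⁺ (suc k) {j} {x} j≤ <j+k with level x ℕ.≟ j
  ... | yes eq = ∈-++⁺ˡ (∈-cells⁺ (allFin n) eq (∈-allFin _))
  ... | no  ≢j = ∈-++⁺ʳ (cells j (allFin n))
    (∈-rows⁺ k (ℕ.≤∧≢⇒< j≤ (≢j ∘ ≡.sym)) (≡.subst (level x ℕ.<_) (ℕ.+-suc j k) <j+k))

  unique-rows : ∀ k j → Unique (rows k j)
  unique-rows zero    j = []
  unique-rows (suc k) j = Unique.++⁺ (unique-cells j (Unique.allFin⁺ n)) (unique-rows k (suc j))
    λ (x∈j , x∈k) → ℕ.<-irrefl (≡.sym (proj₁ (∈-cells⁻ (allFin n) x∈j))) (∈-rows⁻ k x∈k)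

unique-columns : ∀ {n} {A : Fin n → Set} (xs : ∀ i → List (A i)) → (∀ i → Unique (xs i)) →
                 ∀ {is} → Unique is → Unique (concatMap (λ i → map (i ,_) (xs i)) is)
unique-columns xs u []       = []
unique-columns {A = A} xs u {i ∷ is} (i∉ ∷ us) = Unique.++⁺ (Unique.map⁺ (λ { ≡.refl → ≡.refl }) (u i)) (unique-columns xs u us)
  λ (x∈i , x∈is) → All.lookup i∉ (column∈ is x∈is) (≡.sym (≡.cong proj₁ (proj₂ (proj₂ (∈-map⁻ (i ,_) x∈i)))))
  where
  column∈ : ∀ is {x : Σ[ i ∈ _ ] A i} → x ∈ concatMap (λ i → map (i ,_) (xs i)) is → proj₁ x ∈ is
  column∈ (k ∷ is) x∈ with ∈-++⁻ (map (k ,_) (xs k)) x∈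
  ... | inj₁ x∈k  = here (≡.cong proj₁ (proj₂ (proj₂ (∈-map⁻ (k ,_) x∈k))))
  ... | inj₂ x∈is = there (column∈ is x∈is)

module _ {n : ℕ} where

  Sorted : List (Fin n) → Set
  Sorted = AllPairs Fin._<_

  sorted-allFin : Sorted (allFin n)
  sorted-allFin = AllPairs.tabulate⁺-< id

  sorted⇒unique : ∀ {is} → Sorted is → Unique is
  sorted⇒unique = AllPairs.map λ i<k i≡k → ℕ.<-irrefl (≡.cong toℕ i≡k) i<k

  sorted-prefix : ∀ is {ks} → Sorted (is ++ ks) → Sorted is
  sorted-prefix []       s       = []
  sorted-prefix (i ∷ is) (p ∷ s) = All.++⁻ˡ is p ∷ sorted-prefix is s

  sorted-split : ∀ is {k ks} → Sorted (is ++ k ∷ ks) → All (Fin._< k) is × All (k Fin.<_) ks × Sorted ks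
  sorted-split []       (p ∷ s) = [] , p , s
  sorted-split (i ∷ is) (p ∷ s) with sorted-split is s
  ... | before , after , s′ = All.head (All.++⁻ʳ is p) ∷ before , after , s′

-- Reading a filling row by row

queue : ∀ {n} → WeakComposition n → (Fin n → Fin n) → Queue n
queue {n} γ β = map (λ i → γ i , β i) (allFin n)

module RowReading (R : CommutativeRing 0ℓ 0ℓ)
  (q t : CommutativeRing.Carrier R) (fac : ℕ → ℕ → CommutativeRing.Carrier R) {n : ℕ} (γ : WeakComposition n) (τ : Permutation′ n) where

  open LaurentPolynomials R
  open QueueRecursion R q t fac n
  open FillingSums R γ
  open LocalWeights R q t fac γ τ
  open Sum (+-commutativeMonoid {n}) using (sum-cong-≋)
  private
    module Filled    = Cells γ
    module Augmented = Cells (λ i → suc (γ i))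
  open Augmented using (cell; cells)

  -- The queue lists the prior boxes as they were read, `prior` lists them column by column; the
  -- weight sees only the multiset.
  stepWeight-↭ : ∀ {h h′ w w′ u u′ r r′} → h ≡ h′ → w ≡ w′ → r ↭ r′ → u ≡ u′ →
                 stepWeight h w r u ≡ stepWeight h′ w′ r′ u′
  stepWeight-↭ {h} {w = w} {u = u} ≡.refl ≡.refl p ≡.refl
    rewrite fresh-↭ u p | coinvCount-↭ h u w p | armCount-↭ h p = ≡.refl

  hat : Filling γ → Box^ γ → Fin n
  hat = augment γ τ

  hat-≐ : ∀ {σ σ′} → σ ≐ σ′ → hat σ ≗ hat σ′
  hat-≐ p (i , zero)  = ≡.refl
  hat-≐ p (i , suc j) = p i j

  localWeight-≐ : ∀ {σ σ′} u → σ ≐ σ′ → localWeight σ u ≡ localWeight σ′ u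
  localWeight-≐ {σ} {σ′} u p = stepWeight-↭ ≡.refl (hat-≐ p (d γ u))
    (↭.↭-reflexive (List.map-cong (λ v → ≡.cong (height γ v ,_) (hat-≐ p v)) (prior γ u))) (hat-≐ p (up γ u))

  X-≡ : ∀ {u v : Fin n} f → u ≡ v → X u f ≋ X v f
  X-≡ f ≡.refl = ≋-refl

  boxProduct-extensional : ∀ us → Extensional (boxProduct us)
  boxProduct-extensional []       p = ≋-refl
  boxProduct-extensional (u@(i , j) ∷ us) {σ} {σ′} p = •-cong (K.reflexive (localWeight-≐ u p))
    (≋-trans (X-cong (σ i j) (boxProduct-extensional us p)) (X-≡ (boxProduct us σ′) (p i j)))

  boxProduct-↭ : ∀ {us vs} → us ↭ vs → ∀ σ → boxProduct us σ ≋ boxProduct vs σ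
  boxProduct-↭ ↭.refl        σ = ≋-refl
  boxProduct-↭ (↭.prep (i , j) p) σ = •-cong K.refl (X-cong (σ i j) (boxProduct-↭ p σ))
  boxProduct-↭ (↭.trans p r) σ = ≋-trans (boxProduct-↭ p σ) (boxProduct-↭ r σ)
  boxProduct-↭ (↭.swap {us} {vs} u@(i , j) v@(k , l) p) σ = begin
    a • X x (b • X y f)    ≈⟨ •-cong K.refl (X-• x b (X y f)) ⟩
    a • (b • X x (X y f))  ≈⟨ •-comm a b (X x (X y f)) ⟩
    b • (a • X x (X y f))  ≈⟨ •-cong K.refl (•-cong K.refl (≋-trans (X-comm x y f) (X-cong y (X-cong x (boxProduct-↭ p σ))))) ⟩
    b • (a • X y (X x g))  ≈⟨ •-cong K.refl (X-• y a (X x g)) ⟨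
    b • X y (a • X x g)    ∎
    where
    open ≋-Reasoning
    a b : K
    a = localWeight σ u
    b = localWeight σ v
    x y : Fin n
    x = σ i j
    y = σ k l
    f g : Laurent n
    f = boxProduct us σ
    g = boxProduct vs σ

  E-updateSum : ∀ {us} → boxes γ ↭ us → ∀ σ → E ≋ updateSum us σ (boxProduct us)
  E-updateSum {us} p σ = begin
    E
      ≡⟨ sumOver-filter (λ σ → nonAttacking? γ (hat σ)) (λ σ → weight (hat σ) , monomial γ σ) (fillings γ) ⟩
    sumOver (fillings γ) (λ σ → if does (nonAttacking? γ (hat σ)) then [ weight (hat σ) , monomial γ σ ] else [])
      ≈⟨ sumOver-cong (fillings γ) (λ σ → ≋-trans (term-boxProduct σ) (boxProduct-↭ p σ)) ⟩
    sumOver (fillings γ) (boxProduct us)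
      ≈⟨ sumOver-fillings σ (boxProduct us) (boxProduct-extensional us) ⟩
    updateSum (boxes γ) σ (boxProduct us)
      ≈⟨ updateSum-↭ (boxProduct-extensional us) p σ ⟩
    updateSum us σ (boxProduct us) ∎
    where open ≋-Reasoning

  After : Box γ → Box γ → Set
  After (i , j) (i′ , j′) = (toℕ j′ ≡ toℕ j × i Fin.< i′) ⊎ toℕ j ℕ.< toℕ j′

  Before : Box γ → Box^ γ → Set
  Before u v = Prior γ u v ⊎ v ≡ d γ u

  Outside : List (Box γ) → Box^ γ → Set
  Outside us v = ∀ i j → v ≡ (i , suc j) → All ((i , j) ≢_) us

  after-asym : ∀ {x y} → After x y → ¬ After y x
  after-asym (inj₁ (_ , p)) (inj₁ (_ , r)) = ℕ.<-asym p r
  after-asym (inj₁ (e , _)) (inj₂ r)       = ℕ.<-irrefl e r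
  after-asym (inj₂ p)       (inj₁ (e , _)) = ℕ.<-irrefl e p
  after-asym (inj₂ p)       (inj₂ r)       = ℕ.<-asym p r

  after-distinct : ∀ {u us} → All (After u) us → All (u ≢_) us
  after-distinct = All.map λ { a ≡.refl → after-asym a a }

  before⇒after : ∀ u {i j} → Before u (i , suc j) → After (i , j) u
  before⇒after u (inj₁ (inj₁ (r , c))) = inj₁ (≡.sym (ℕ.suc-injective r) , c)
  before⇒after u (inj₁ (inj₂ (r , _))) = inj₂ (ℕ.≤-reflexive (≡.trans r (Fin.toℕ-inject₁ (proj₂ u))))
  before⇒after u (inj₂ eq) = inj₂ (ℕ.≤-reflexive (≡.trans (≡.cong (row γ) eq) (Fin.toℕ-inject₁ (proj₂ u))))

  before-outside : ∀ {u us v} → All (After u) us → Before u v → Outside (u ∷ us) v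
  before-outside {u} after before i j ≡.refl =
    (λ { ≡.refl → after-asym x<u x<u }) ∷ All.map (λ { a ≡.refl → after-asym x<u a }) after
    where
    x<u : After (i , j) u
    x<u = before⇒after u before

  -- Matches one unfolding of F with the outermost sum over entries. The prior boxes and `d u`
  -- precede u in reading order, so the data entering the weight of u are fixed before the boxes in
  -- `us` are summed over.
  module Step (u : Box γ) (rest : List (Box^ γ)) (us : List (Box γ))
    (rest↭prior : rest ↭ prior γ u) (after : All (After u) us) (u∉us : All (u ≢_) us) where

    i : Fin n
    i = proj₁ u
    j : Fin (γ i)
    j = proj₂ u

    module _ (σ : Filling γ) where

      outside : ∀ v → v ∈ rest ⊎ v ≡ d γ u → Outside (u ∷ us) v
      outside v (inj₁ v∈) = before-outside after
        (inj₁ (proj₂ (∈-filter⁻ (prior? γ u) {xs = boxes^ γ} (↭.∈-resp-↭ rest↭prior v∈))))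
      outside v (inj₂ eq) = before-outside after (inj₂ eq)

      unchanged : ∀ {x σ′} → Untouched us (σ [ u ≔ x ]) σ′ → ∀ v → v ∈ rest ⊎ v ≡ d γ u → hat σ′ v ≡ hat σ v
      unchanged r (k , zero)  _ = ≡.refl
      unchanged {x} r (k , suc l) v∈ with outside (k , suc l) v∈ k l ≡.refl
      ... | ≢u ∷ ≢us = ≡.trans (r k l ≢us) (update-other σ u x ≢u)

      unchanged-rest : ∀ {x σ′} → Untouched us (σ [ u ≔ x ]) σ′ → map (entry γ (hat σ′)) rest ≡ map (entry γ (hat σ)) rest
      unchanged-rest r = List.map-cong-local (All.tabulate λ {v} v∈ → ≡.cong (height γ v ,_) (unchanged r v (inj₁ v∈)))

      entry-u : ∀ {x σ′} → Untouched us (σ [ u ≔ x ]) σ′ → σ′ i j ≡ x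
      entry-u {x} r = ≡.trans (r i j u∉us) (update-same σ i j x)

      localWeight-≡ : ∀ {x σ′} → Untouched us (σ [ u ≔ x ]) σ′ →
        stepWeight (suc (leg γ u)) (hat σ (d γ u)) (map (entry γ (hat σ)) rest) x ≡ localWeight σ′ u
      localWeight-≡ {σ′ = σ′} r = stepWeight-↭ ≡.refl (≡.sym (unchanged r (d γ u) (inj₂ ≡.refl)))
        (↭.↭-trans (↭.↭-reflexive (≡.sym (unchanged-rest r))) (↭.map⁺ (entry γ (hat σ′)) rest↭prior))
        (≡.sym (entry-u r))

      untouched-refl : ∀ x → Untouched us (σ [ u ≔ x ]) (σ [ u ≔ x ])
      untouched-refl x _ _ _ = ≡.refl

      step : ∀ k → (∀ x → F k (map (entry γ (hat (σ [ u ≔ x ]))) (rest ∷ʳ up γ u)) ≋ updateSum us (σ [ u ≔ x ]) (boxProduct us)) →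
             F (suc k) (map (entry γ (hat σ)) (d γ u ∷ rest)) ≋ updateSum (u ∷ us) σ (boxProduct (u ∷ us))
      step k IH = begin
        F (suc k) ((height γ (d γ u) , w) ∷ r)
          ≡⟨ ≡.cong (λ h → F (suc k) ((h , w) ∷ r)) (≡.sym (suc-leg γ u)) ⟩
        sum (λ x → c x • X x (F k (r ∷ʳ (leg γ u , x))))
          ≈⟨ sum-cong-≋ term ⟩
        updateSum (u ∷ us) σ (boxProduct (u ∷ us)) ∎
        where
        open ≋-Reasoning
        w : Fin n
        w = hat σ (d γ u)
        r : Queue n
        r = map (entry γ (hat σ)) rest
        c : Fin n → K
        c = stepWeight (suc (leg γ u)) w r
        term : ∀ x → c x • X x (F k (r ∷ʳ (leg γ u , x))) ≋ updateSum us (σ [ u ≔ x ]) (boxProduct (u ∷ us))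
        term x = begin
          c x • X x (F k (r ∷ʳ (leg γ u , x)))
            ≡⟨ ≡.cong (λ l → c x • X x (F k l)) (≡.sym queue-≡) ⟩
          c x • X x (F k (map (entry γ (hat σx)) (rest ∷ʳ up γ u)))
            ≈⟨ •-cong K.refl (X-cong x (IH x)) ⟩
          c x • X x (updateSum us σx (boxProduct us))
            ≈⟨ updateSum-linear (λ f → c x • X x f) (λ p → •-cong K.refl (X-cong x p)) ≋-refl
                 (λ f g → ≋-trans (•-cong K.refl (X-+ x f g)) (•-distrib-+ (c x) (X x f) (X x g))) us σx (boxProduct us) ⟩
          updateSum us σx (λ σ′ → c x • X x (boxProduct us σ′))
            ≈⟨ updateSum-cong-on us σx (λ σ′ r → •-cong (K.reflexive (localWeight-≡ r)) (X-≡ (boxProduct us σ′) (≡.sym (entry-u r)))) ⟩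
          updateSum us σx (boxProduct (u ∷ us)) ∎
          where
          σx : Filling γ
          σx = σ [ u ≔ x ]
          queue-≡ : map (entry γ (hat σx)) (rest ∷ʳ up γ u) ≡ r ∷ʳ (leg γ u , x)
          queue-≡ = ≡.trans (List.map-++ (entry γ (hat σx)) rest [ up γ u ])
            (≡.cong₂ (λ l y → l ∷ʳ (leg γ u , y)) (unchanged-rest (untouched-refl x)) (update-same σ i j x))

  -- Bounds the remaining steps of F: dropping a completed column removes 1, and continuing a column
  -- lowers its height by 1.
  size : List (Box^ γ) → ℕ
  size Q = sumℕ (map (λ v → suc (height γ v)) Q)

  size-∷ʳ : ∀ Q v → size (Q ∷ʳ v) ≡ suc (height γ v) ℕ.+ size Q
  size-∷ʳ []      v = ≡.refl
  size-∷ʳ (x ∷ Q) v = ≡.trans (≡.cong (suc (height γ x) ℕ.+_) (size-∷ʳ Q v)) (+-swap (suc (height γ x)) (suc (height γ v)) (size Q))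

  Evaluates : ℕ → List (Box^ γ) → List (Box γ) → Filling γ → Set
  Evaluates k Q us σ = F k (map (entry γ (hat σ)) Q) ≋ updateSum us σ (boxProduct us)

  cells-empty : ∀ {j} → (∀ i → γ i ℕ.≤ j) → ∀ is → cells (suc j) is ≡ []
  cells-empty γ≤j []       = ≡.refl
  cells-empty γ≤j (i ∷ is) = ≡.cong₂ _++_ (Augmented.cell-none (ℕ.s≤s (γ≤j i))) (cells-empty γ≤j is)

  cells-snoc : ∀ {j c l} ds (Q : List (Box^ γ)) → cell j c ≡ l → Q ++ cells j (ds ∷ʳ c) ≡ (Q ++ cells j ds) ++ l
  cells-snoc {j} {c} ds Q ≡.refl = ≡.trans (≡.cong (Q ++_) (Augmented.cells-∷ʳ j ds c)) (≡.sym (List.++-assoc Q _ _))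

  -- In row j, with column c next, ds and cs are the columns to the left and to the right of c.
  run : ∀ k h j ds cs → ds ++ cs ≡ allFin n → (∀ i → γ i ℕ.≤ j ℕ.+ h) → ∀ σ →
        size (cells j cs ++ cells (suc j) ds) ℕ.< k →
        Evaluates k (cells j cs ++ cells (suc j) ds) (Filled.cells j cs ++ Filled.rows h (suc j)) σ
  -- No row is left: by `high` no column reaches above row j, so the queue is empty and both sides
  -- are 1.
  run (suc k) zero j ds [] eq high σ size<k =
    ≋-reflexive (≡.cong (λ Q → F (suc k) (map (entry γ (hat σ)) Q))
      (cells-empty (λ i → ≡.subst (γ i ℕ.≤_) (ℕ.+-identityʳ j) (high i)) ds))
  run k (suc h) j ds [] eq high σ size<k = ≡.subst (λ Q → Evaluates k Q (Filled.rows (suc h) (suc j)) σ) Q≡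
    (run k h (suc j) [] (allFin n) ≡.refl (λ i → ≡.subst (γ i ℕ.≤_) (ℕ.+-suc j h) (high i)) σ
      (≡.subst (λ Q → size Q ℕ.< k) (≡.sym Q≡) size<k))
    where
    Q≡ : cells (suc j) (allFin n) ++ [] ≡ cells (suc j) ds
    Q≡ = ≡.trans (List.++-identityʳ _) (≡.cong (cells (suc j)) (≡.trans (≡.sym eq) (List.++-identityʳ ds)))
  -- Column c was dropped in an earlier row (γ c < j), is complete and dropped now (γ c = j), or is
  -- continued by its box in row j + 1 (j < γ c).
  run k h j ds (c ∷ cs) eq high σ size<k with ℕ.<-cmp j (γ c)
  ... | tri> _ _ γ<j = ≡.subst₂ (λ Q us → Evaluates k Q us σ) Q≡ us≡
    (run k h j (ds ∷ʳ c) cs (≡.trans (List.∷ʳ-++ ds c cs) eq) high σ (≡.subst (λ Q → size Q ℕ.< k) (≡.sym Q≡) size<k))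
    where
    Q≡ : cells j cs ++ cells (suc j) (ds ∷ʳ c) ≡ cells j (c ∷ cs) ++ cells (suc j) ds
    Q≡ = ≡.trans (cells-snoc ds (cells j cs) (Augmented.cell-none (ℕ.s≤s (ℕ.<⇒≤ γ<j))))
      (≡.trans (List.++-identityʳ _) (≡.cong (λ l → (l ++ cells j cs) ++ cells (suc j) ds) (≡.sym (Augmented.cell-none γ<j))))
    us≡ : Filled.cells j cs ++ Filled.rows h (suc j) ≡ Filled.cells j (c ∷ cs) ++ Filled.rows h (suc j)
    us≡ = ≡.cong (λ l → (l ++ Filled.cells j cs) ++ Filled.rows h (suc j)) (≡.sym (Filled.cell-none (ℕ.<⇒≤ γ<j)))
  ... | tri≈ _ j≡γ _ = top k size<k
    where
    v : Box^ γ
    v = c , fromℕ (γ c)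
    rest : List (Box^ γ)
    rest = cells j cs ++ cells (suc j) ds
    Q≡ : v ∷ rest ≡ cells j (c ∷ cs) ++ cells (suc j) ds
    Q≡ = ≡.cong (λ l → (l ++ cells j cs) ++ cells (suc j) ds)
      (≡.sym (Augmented.cell-at v (≡.trans (Fin.toℕ-fromℕ (γ c)) (≡.sym j≡γ))))
    rest≡ : cells j cs ++ cells (suc j) (ds ∷ʳ c) ≡ rest
    rest≡ = ≡.trans (cells-snoc ds (cells j cs) (Augmented.cell-none (ℕ.s≤s (ℕ.≤-reflexive (≡.sym j≡γ))))) (List.++-identityʳ _)
    us≡ : Filled.cells j cs ++ Filled.rows h (suc j) ≡ Filled.cells j (c ∷ cs) ++ Filled.rows h (suc j)
    us≡ = ≡.cong (λ l → (l ++ Filled.cells j cs) ++ Filled.rows h (suc j)) (≡.sym (Filled.cell-none (ℕ.≤-reflexive (≡.sym j≡γ))))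
    height≡0 : height γ v ≡ 0
    height≡0 = ≡.trans (≡.cong (γ c ∸_) (Fin.toℕ-fromℕ (γ c))) (ℕ.n∸n≡0 (γ c))
    top : ∀ k → size (cells j (c ∷ cs) ++ cells (suc j) ds) ℕ.< k →
          Evaluates k (cells j (c ∷ cs) ++ cells (suc j) ds) (Filled.cells j (c ∷ cs) ++ Filled.rows h (suc j)) σ
    top (suc k) size<k = ≡.subst₂ (λ Q us → Evaluates (suc k) Q us σ) Q≡ us≡
      (≋-trans (≋-reflexive (≡.cong (λ h → F (suc k) ((h , hat σ v) ∷ map (entry γ (hat σ)) rest)) height≡0))
        (≡.subst (λ Q → Evaluates k Q (Filled.cells j cs ++ Filled.rows h (suc j)) σ) rest≡
          (run k h j (ds ∷ʳ c) cs (≡.trans (List.∷ʳ-++ ds c cs) eq) high σ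
            (≡.subst (λ Q → size Q ℕ.< k) (≡.sym rest≡) (ℕ.≤-trans (ℕ.s≤s (ℕ.m≤n+m (size rest) (height γ v)))
              (ℕ.≤-pred (≡.subst (λ Q → size Q ℕ.< suc k) (≡.sym Q≡) size<k)))))))
  ... | tri< j<γ _ _ = fill k size<k
    where
    u : Box γ
    u = c , fromℕ< j<γ
    rest : List (Box^ γ)
    rest = cells j cs ++ cells (suc j) ds
    us : List (Box γ)
    us = Filled.cells j cs ++ Filled.rows h (suc j)
    Q≡ : d γ u ∷ rest ≡ cells j (c ∷ cs) ++ cells (suc j) ds
    Q≡ = ≡.cong (λ l → (l ++ cells j cs) ++ cells (suc j) ds)
      (≡.sym (Augmented.cell-at (d γ u) (≡.trans (Fin.toℕ-inject₁ _) (Fin.toℕ-fromℕ< j<γ))))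
    rest≡ : cells j cs ++ cells (suc j) (ds ∷ʳ c) ≡ rest ∷ʳ up γ u
    rest≡ = cells-snoc ds (cells j cs) (Augmented.cell-at (up γ u) (≡.cong suc (Fin.toℕ-fromℕ< j<γ)))
    us≡ : u ∷ us ≡ Filled.cells j (c ∷ cs) ++ Filled.rows h (suc j)
    us≡ = ≡.cong (λ l → (l ++ Filled.cells j cs) ++ Filled.rows h (suc j)) (≡.sym (Filled.cell-at u (Fin.toℕ-fromℕ< j<γ)))
    sorted : Sorted (ds ++ c ∷ cs)
    sorted = ≡.subst Sorted (≡.sym eq) sorted-allFin
    ds<c : All (Fin._< c) ds
    ds<c = proj₁ (sorted-split ds sorted)
    c<cs : All (c Fin.<_) cs
    c<cs = proj₁ (proj₂ (sorted-split ds sorted))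
    locate : ∀ i → i ∈ ds ⊎ i ∈ c ∷ cs
    locate i = ∈-++⁻ ds (≡.subst (i ∈_) (≡.sym eq) (∈-allFin i))
    left∈ : ∀ {i} → i Fin.< c → i ∈ ds
    left∈ {i} i<c with locate i
    ... | inj₁ i∈            = i∈
    ... | inj₂ (here ≡.refl) = contradiction i<c (ℕ.<-irrefl ≡.refl)
    ... | inj₂ (there i∈)    = contradiction i<c (ℕ.<-asym (All.lookup c<cs i∈))
    right∈ : ∀ {i} → c Fin.< i → i ∈ cs
    right∈ {i} c<i with locate i
    ... | inj₁ i∈            = contradiction c<i (ℕ.<-asym (All.lookup ds<c i∈))
    ... | inj₂ (here ≡.refl) = contradiction c<i (ℕ.<-irrefl ≡.refl)
    ... | inj₂ (there i∈)    = i∈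
    row-d : row γ (d γ u) ≡ j
    row-d = ≡.trans (Fin.toℕ-inject₁ _) (Fin.toℕ-fromℕ< j<γ)
    row-up : row γ (up γ u) ≡ suc j
    row-up = ≡.cong suc (Fin.toℕ-fromℕ< j<γ)
    rest⇒prior : ∀ {v} → v ∈ rest → v ∈ prior γ u
    rest⇒prior {v} v∈ = ∈-filter⁺ (prior? γ u) (∈-boxes^ γ v) (position (∈-++⁻ (cells j cs) v∈))
      where
      position : v ∈ cells j cs ⊎ v ∈ cells (suc j) ds → Prior γ u v
      position (inj₁ v∈) = let r , i∈ = Augmented.∈-cells⁻ cs v∈ in inj₂ (≡.trans r (≡.sym row-d) , All.lookup c<cs i∈)
      position (inj₂ v∈) = let r , i∈ = Augmented.∈-cells⁻ ds v∈ in inj₁ (≡.trans r (≡.sym row-up) , All.lookup ds<c i∈)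
    prior⇒rest : ∀ {v} → v ∈ prior γ u → v ∈ rest
    prior⇒rest v∈ with proj₂ (∈-filter⁻ (prior? γ u) {xs = boxes^ γ} v∈)
    ... | inj₁ (r , i<c) = ∈-++⁺ʳ (cells j cs) (Augmented.∈-cells⁺ ds (≡.trans r row-up) (left∈ i<c))
    ... | inj₂ (r , c<i) = ∈-++⁺ˡ (Augmented.∈-cells⁺ cs (≡.trans r row-d) (right∈ c<i))
    -- Behind `d u` the queue holds row j to the right of c and row j + 1 to the left of c, which
    -- are the boxes prior to u.
    rest↭prior : rest ↭ prior γ u
    rest↭prior = unique-set⇒↭
      (Unique.++⁺ (Augmented.unique-cells j (sorted⇒unique (proj₂ (proj₂ (sorted-split ds sorted)))))
        (Augmented.unique-cells (suc j) (sorted⇒unique (sorted-prefix ds sorted)))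
        λ (p , r) → ℕ.1+n≢n (≡.trans (≡.sym (proj₁ (Augmented.∈-cells⁻ ds r))) (proj₁ (Augmented.∈-cells⁻ cs p))))
      (Unique.filter⁺ (prior? γ u) (unique-columns (λ i → allFin (suc (γ i))) (λ i → Unique.allFin⁺ (suc (γ i))) (Unique.allFin⁺ n)))
      rest⇒prior prior⇒rest
    after : All (After u) us
    after = All.tabulate λ {w} w∈ → position (∈-++⁻ (Filled.cells j cs) w∈)
      where
      position : ∀ {w} → w ∈ Filled.cells j cs ⊎ w ∈ Filled.rows h (suc j) → After u w
      position (inj₁ w∈) = let r , i∈ = Filled.∈-cells⁻ cs w∈ in
        inj₁ (≡.trans r (≡.sym (Fin.toℕ-fromℕ< j<γ)) , All.lookup c<cs i∈)
      position {w} (inj₂ w∈) = inj₂ (≡.subst (ℕ._< Filled.level w) (≡.sym (Fin.toℕ-fromℕ< j<γ)) (Filled.∈-rows⁻ h w∈))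
    fill : ∀ k → size (cells j (c ∷ cs) ++ cells (suc j) ds) ℕ.< k →
           Evaluates k (cells j (c ∷ cs) ++ cells (suc j) ds) (Filled.cells j (c ∷ cs) ++ Filled.rows h (suc j)) σ
    fill (suc k) size<k = ≡.subst₂ (λ Q us → Evaluates (suc k) Q us σ) Q≡ us≡
      (Step.step u rest us rest↭prior after (after-distinct after) σ k λ x →
        ≡.subst (λ Q → Evaluates k Q us (σ [ u ≔ x ])) rest≡
          (run k h j (ds ∷ʳ c) cs (≡.trans (List.∷ʳ-++ ds c cs) eq) high (σ [ u ≔ x ])
            (≡.subst (λ Q → size Q ℕ.< k) (≡.sym rest≡) size-rest<k)))
      where
      size-rest<k : size (rest ∷ʳ up γ u) ℕ.< k
      size-rest<k = ≡.subst₂ (λ s l → s ℕ.< k) (≡.sym (size-∷ʳ rest (up γ u))) (≡.refl {x = 0})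
        (≡.subst (λ h → suc h ℕ.+ size rest ℕ.≤ k) (≡.sym (suc-leg γ u))
          (ℕ.≤-pred (≡.subst (λ Q → size Q ℕ.< suc k) (≡.sym Q≡) size<k)))

  steps : ℕ
  steps = suc (size (cells 0 (allFin n) ++ []))

  -- The sum of all column heights serves as a crude bound on the number of rows.
  heights-bounded : ∀ i → γ i ℕ.≤ sumℕ (map γ (allFin n))
  heights-bounded i = member-≤ (∈-map⁺ γ (∈-allFin i))
    where
    member-≤ : ∀ {x xs} → x ∈ xs → x ℕ.≤ sumℕ xs
    member-≤ {xs = y ∷ ys} (here ≡.refl) = ℕ.m≤m+n y (sumℕ ys)
    member-≤ {xs = y ∷ ys} (there x∈)    = ℕ.≤-trans (member-≤ x∈) (ℕ.m≤n+m (sumℕ ys) y)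

  bottom-row : ∀ σ is → map (entry γ (hat σ)) (cells 0 is) ≡ map (λ i → γ i , τ ⟨$⟩ʳ i) is
  bottom-row σ []       = ≡.refl
  bottom-row σ (i ∷ is) rewrite Augmented.cell-at (i , zero) ≡.refl = ≡.cong ((γ i , τ ⟨$⟩ʳ i) ∷_) (bottom-row σ is)

  E≋F : E ≋ F steps (queue γ (τ ⟨$⟩ʳ_))
  E≋F = ≋-trans (E-updateSum reading σ) (≋-trans
    (≋-sym (run steps (sumℕ (map γ (allFin n))) 0 [] (allFin n) ≡.refl heights-bounded σ ℕ.≤-refl))
    (≋-reflexive (≡.cong (F steps) (≡.trans (≡.cong (map (entry γ (hat σ))) (List.++-identityʳ (cells 0 (allFin n))))
      (bottom-row σ (allFin n))))))
    where
    M : ℕ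
    M = sumℕ (map γ (allFin n))
    σ : Filling γ
    σ i _ = i
    reading : boxes γ ↭ Filled.cells 0 (allFin n) ++ Filled.rows M 1
    reading = unique-set⇒↭
      (unique-columns (λ i → allFin (γ i)) (λ i → Unique.allFin⁺ (γ i)) (Unique.allFin⁺ n))
      (Filled.unique-rows (suc M) 0)
      (λ {u} _ → Filled.∈-rows⁺ (suc M) ℕ.z≤n (ℕ.m<n⇒m<1+n (ℕ.<-≤-trans (Fin.toℕ<n (proj₂ u)) (heights-bounded (proj₁ u)))))
      (λ {u} _ → ∈-boxes γ u)

-- The path of basements along Yᵢ

-- Tracks the value v under the first half of Yᵢ: the value i climbs to the top
-- while the values between move down. At time k it stands at k ⊔ i.
data Rising (i k : ℕ) : ℕ → ℕ → Set where
  below  : ∀ {v} → v ℕ.< i → Rising i k v v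
  riser  : Rising i k i (k ℕ.⊔ i)
  passed : ∀ {v} → i ℕ.< suc v → suc v ℕ.≤ k → Rising i k (suc v) v
  above  : ∀ {v} → i ℕ.< v → k ℕ.< v → Rising i k v v

-- The second half, after the cyclic shift: i climbs from the bottom to its place.
data Returning (i k : ℕ) : ℕ → ℕ → Set where
  passed  : ∀ {v} → v ℕ.< i → v ℕ.< k → Returning i k v v
  waiting : ∀ {v} → v ℕ.< i → k ℕ.≤ v → Returning i k v (suc v)
  riser   : Returning i k i (k ℕ.⊓ i)
  above   : ∀ {v} → i ℕ.< v → Returning i k v v

rising-start : ∀ {i} v → Rising i 0 v v
rising-start {i} v with ℕ.<-cmp v i
... | tri< v<i _ _      = below v<i
... | tri≈ _ ≡.refl _   = riser
... | tri> _ _ i<v      = above i<v (ℕ.≤-<-trans ℕ.z≤n i<v)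

rising-idle : ∀ {i k v u} → k ℕ.< i → Rising i k v u → Rising i (suc k) v u
rising-idle k<i (below v<i) = below v<i
rising-idle {i} {k} k<i riser = ≡.subst (Rising i (suc k) i)
  (≡.trans (ℕ.m≤n⇒m⊔n≡n k<i) (≡.sym (ℕ.m≤n⇒m⊔n≡n (ℕ.<⇒≤ k<i)))) riser
rising-idle k<i (passed i<v v≤k) = contradiction (ℕ.<-≤-trans i<v v≤k) (ℕ.<-asym k<i)
rising-idle k<i (above i<v k<v) = above i<v (ℕ.≤-<-trans k<i i<v)

rising-riser : ∀ {i k u} → i ℕ.≤ k → Rising i k i u → u ≡ k
rising-riser i≤k (below i<i)    = contradiction i<i (ℕ.<-irrefl ≡.refl)
rising-riser i≤k riser          = ℕ.m≥n⇒m⊔n≡m i≤k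
rising-riser i≤k (passed i<i _) = contradiction i<i (ℕ.<-irrefl ≡.refl)
rising-riser i≤k (above i<i _)  = contradiction i<i (ℕ.<-irrefl ≡.refl)

-- The value k + 1 has not yet moved at time k, so the step exchanges i with the original value k +
-- 1.
rising-next : ∀ {i k u} → i ℕ.≤ k → Rising i k (suc k) u → u ≡ suc k
rising-next i≤k (below k<i)    = ≡.refl
rising-next i≤k riser          = contradiction i≤k (ℕ.<⇒≱ ℕ.≤-refl)
rising-next i≤k (passed _ k<k) = contradiction k<k (ℕ.<-irrefl ≡.refl)
rising-next i≤k (above _ _)    = ≡.refl

returning-idle : ∀ {i k v u} → i ℕ.≤ k → Returning i k v u → Returning i (suc k) v u
returning-idle i≤k (passed v<i v<k)  = passed v<i (ℕ.m<n⇒m<1+n v<k)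
returning-idle i≤k (waiting v<i k≤v) = contradiction (ℕ.≤-trans i≤k k≤v) (ℕ.<⇒≱ v<i)
returning-idle {i} {k} i≤k riser = ≡.subst (Returning i (suc k) i)
  (≡.trans (ℕ.m≥n⇒m⊓n≡n (ℕ.m≤n⇒m≤1+n i≤k)) (≡.sym (ℕ.m≥n⇒m⊓n≡n i≤k))) riser
returning-idle i≤k (above i<v) = above i<v

returning-riser : ∀ {i k u} → k ℕ.< i → Returning i k i u → u ≡ k
returning-riser k<i (passed i<i _)  = contradiction i<i (ℕ.<-irrefl ≡.refl)
returning-riser k<i (waiting i<i _) = contradiction i<i (ℕ.<-irrefl ≡.refl)
returning-riser k<i riser           = ℕ.m≤n⇒m⊓n≡m (ℕ.<⇒≤ k<i)
returning-riser k<i (above i<i)     = contradiction i<i (ℕ.<-irrefl ≡.refl)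

-- The cyclic shift has raised the waiting value k to k + 1, so the step exchanges i with the
-- original value k.
returning-next : ∀ {i k u} → k ℕ.< i → Returning i k k u → u ≡ suc k
returning-next k<i (passed _ k<k) = contradiction k<k (ℕ.<-irrefl ≡.refl)
returning-next k<i (waiting _ _)  = ≡.refl
returning-next k<i riser          = contradiction k<i (ℕ.<-irrefl ≡.refl)
returning-next k<i (above i<k)    = contradiction i<k (ℕ.<-asym k<i)

returning-end : ∀ {i k v u} → i ℕ.≤ k → Returning i k v u → u ≡ v
returning-end i≤k (passed _ _)      = ≡.refl
returning-end i≤k (waiting v<i k≤v) = contradiction (ℕ.≤-trans i≤k k≤v) (ℕ.<⇒≱ v<i)
returning-end i≤k riser             = ℕ.m≥n⇒m⊓n≡n i≤k
returning-end i≤k (above _)         = ≡.refl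

data Swap (k : ℕ) : ℕ → ℕ → Set where
  low   : Swap k k (suc k)
  high  : Swap k (suc k) k
  other : ∀ {u} → u ≢ k → u ≢ suc k → Swap k u u

swap-low : ∀ {k w} → Swap k k w → w ≡ suc k
swap-low low           = ≡.refl
swap-low (other k≢k _) = contradiction ≡.refl k≢k

swap-high : ∀ {k w} → Swap k (suc k) w → w ≡ k
swap-high high          = ≡.refl
swap-high (other _ k≢k) = contradiction ≡.refl k≢k

swap-other : ∀ {k u w} → u ≢ k → u ≢ suc k → Swap k u w → w ≡ u
swap-other u≢k _  low         = contradiction ≡.refl u≢k
swap-other _ u≢k′ high        = contradiction ≡.refl u≢k′
swap-other _ _    (other _ _) = ≡.refl

rising-swap : ∀ {i k v u w} → i ℕ.≤ k → Rising i k v u → Swap k u w → Rising i (suc k) v w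
rising-swap i≤k (below v<i) s
  rewrite swap-other (ℕ.<⇒≢ (ℕ.<-≤-trans v<i i≤k)) (ℕ.<⇒≢ (ℕ.m<n⇒m<1+n (ℕ.<-≤-trans v<i i≤k))) s = below v<i
rising-swap {i} {k} i≤k riser s rewrite ℕ.m≥n⇒m⊔n≡m i≤k | swap-low s =
  ≡.subst (Rising i (suc k) i) (ℕ.m≥n⇒m⊔n≡m (ℕ.m≤n⇒m≤1+n i≤k)) riser
rising-swap i≤k (passed i<v v<k) s
  rewrite swap-other (ℕ.<⇒≢ v<k) (ℕ.<⇒≢ (ℕ.m<n⇒m<1+n v<k)) s = passed i<v (ℕ.m≤n⇒m≤1+n v<k)
rising-swap {k = k} {v} i≤k (above i<v k<v) s with v ℕ.≟ suc k
... | yes ≡.refl rewrite swap-high s = passed i<v ℕ.≤-refl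
... | no  v≢     rewrite swap-other (≡.≢-sym (ℕ.<⇒≢ k<v)) v≢ s = above i<v (ℕ.≤∧≢⇒< k<v (≡.≢-sym v≢))

returning-swap : ∀ {i k v u w} → k ℕ.< i → Returning i k v u → Swap k u w → Returning i (suc k) v w
returning-swap k<i (passed v<i v<k) s
  rewrite swap-other (ℕ.<⇒≢ v<k) (ℕ.<⇒≢ (ℕ.m<n⇒m<1+n v<k)) s = passed v<i (ℕ.m<n⇒m<1+n v<k)
returning-swap {k = k} {v} k<i (waiting v<i k≤v) s with v ℕ.≟ k
... | yes ≡.refl rewrite swap-high s = passed v<i ℕ.≤-refl
... | no  v≢k    rewrite swap-other (≡.≢-sym (ℕ.<⇒≢ (ℕ.s≤s k≤v))) (v≢k ∘ ℕ.suc-injective) s =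
  waiting v<i (ℕ.≤∧≢⇒< k≤v (≡.≢-sym v≢k))
returning-swap {i} {k} k<i riser s rewrite ℕ.m≤n⇒m⊓n≡m (ℕ.<⇒≤ k<i) | swap-low s =
  ≡.subst (Returning i (suc k) i) (ℕ.m≤n⇒m⊓n≡m k<i) riser
returning-swap k<i (above i<v) s
  rewrite swap-other (≡.≢-sym (ℕ.<⇒≢ (ℕ.<-trans k<i i<v))) (≡.≢-sym (ℕ.<⇒≢ (ℕ.≤-<-trans k<i i<v))) s = above i<v

rotate-value : ∀ {m} (u : Fin (suc m)) →
  (toℕ u ≡ m × toℕ (rotate u) ≡ 0) ⊎ (toℕ u ℕ.< m × toℕ (rotate u) ≡ suc (toℕ u))
rotate-value u with view u
... | ‵fromℕ     = inj₁ (Fin.toℕ-fromℕ _ , ≡.refl)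
... | ‵inject₁ i = inj₂ (≡.subst (ℕ._< _) (≡.sym (Fin.toℕ-inject₁ i)) (Fin.toℕ<n i) , ≡.cong suc (≡.sym (Fin.toℕ-inject₁ i)))

-- At time m the value i is at the top and the shift sends it to the bottom. The values above i,
-- lowered by one on the way, are restored; those below i are raised by one and wait for i to pass.
rising-rotate : ∀ {i m v u w} → i ℕ.≤ m → v ℕ.≤ m → Rising i m v u →
                (u ≡ m × w ≡ 0) ⊎ (u ℕ.< m × w ≡ suc u) → Returning i 0 v w
rising-rotate i≤m v≤m (below v<i) (inj₁ (≡.refl , _)) = contradiction v<i (ℕ.≤⇒≯ i≤m)
rising-rotate i≤m v≤m (below v<i) (inj₂ (_ , ≡.refl)) = waiting v<i ℕ.z≤n
rising-rotate i≤m v≤m riser (inj₁ (_ , ≡.refl)) = riser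
rising-rotate i≤m v≤m riser (inj₂ (u<m , _)) = contradiction (ℕ.m≥n⇒m⊔n≡m i≤m) (ℕ.<⇒≢ u<m)
rising-rotate i≤m v≤m (passed i<v v<m) (inj₁ (≡.refl , _)) = contradiction v<m (ℕ.<-irrefl ≡.refl)
rising-rotate i≤m v≤m (passed i<v v<m) (inj₂ (_ , ≡.refl)) = above i<v
rising-rotate i≤m v≤m (above _ m<v) _ = contradiction m<v (ℕ.≤⇒≯ v≤m)

-- Traversing `allFin m` including the indices rejected by the filters keeps the time k equal to the
-- index of the operator.
data Consecutive {m : ℕ} : ℕ → List (Fin m) → Set where
  []  : Consecutive m []
  _∷_ : ∀ {k j js} → toℕ j ≡ k → Consecutive (suc k) js → Consecutive k (j ∷ js)

consecutive-allFin : ∀ m → Consecutive 0 (allFin m)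
consecutive-allFin m = go m id (λ _ → ≡.refl) ≡.refl
  where
  go : ∀ p {k} (f : Fin p → Fin m) → (∀ x → toℕ (f x) ≡ k ℕ.+ toℕ x) → k ℕ.+ p ≡ m → Consecutive k (tabulate f)
  go zero    {k} f eq k+p≡m = ≡.subst (λ l → Consecutive l []) (≡.trans (≡.sym k+p≡m) (ℕ.+-identityʳ k)) []
  go (suc p) {k} f eq k+p≡m = ≡.trans (eq zero) (ℕ.+-identityʳ k) ∷
    go p (f ∘ suc) (λ x → ≡.trans (eq (suc x)) (ℕ.+-suc k (toℕ x))) (≡.trans (≡.sym (ℕ.+-suc k p)) k+p≡m)

-- Following a basement through the factors of Yᵢ

module BasementPath (R : CommutativeRing 0ℓ 0ℓ)
  (q q⁻¹ t t⁻¹ : CommutativeRing.Carrier R) (qq⁻¹≈1 : Inverse R q q⁻¹) (t⁻¹t≈1 : Inverse R t⁻¹ t)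
  (fac : ℕ → ℕ → CommutativeRing.Carrier R)
  (fac-eq : FactorIdentity R q t fac)
  {m : ℕ} (γ : WeakComposition (suc m)) (steps : ℕ) where

  open LaurentPolynomials R
  open QueueRecursion R q t fac (suc m) using (F)
  open Rotation R q q⁻¹ t qq⁻¹≈1 fac m using (π; π-cong; π-•; π-F)

  private
    n : ℕ
    n = suc m

  Relation : Set₁
  Relation = Laurent n → Laurent n → Set

  T : Fin m → Relation
  T j = DemazureLusztig._↦_ R j t t⁻¹ t⁻¹t≈1

  T^ : Sign → Fin m → Relation
  T^ Sign.+ j f g = T j f g
  T^ Sign.- j f g = T j g f

  graph : (Laurent n → Laurent n) → Relation
  graph G f g = g ≋ G f

  composite : List Relation → Relation
  composite []       f g = g ≋ f
  composite (P ∷ Ps) f g = Σ[ h ∈ Laurent n ] (P f h × composite Ps h g)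

  -- Stated for every representative f of a multiple of F, since E equals its F only up to
  -- coefficients. The powers of t and q⁻¹ are absorbed into c′.
  Maps : Relation → Queue n → Queue n → Set
  Maps P Q Q′ = ∀ f c → f ≋ c • F steps Q → ∃[ c′ ] P f (c′ • F steps Q′)

  data Path : List Relation → Queue n → Queue n → Set₁ where
    []  : ∀ {Q} → Path [] Q Q
    _∷_ : ∀ {P Ps Q Q′ Q″} → Maps P Q Q′ → Path Ps Q′ Q″ → Path (P ∷ Ps) Q Q″

  _++ᴾ_ : ∀ {Ps Rs Q Q′ Q″} → Path Ps Q Q′ → Path Rs Q′ Q″ → Path (Ps ++ Rs) Q Q″
  []      ++ᴾ r = r
  (s ∷ p) ++ᴾ r = s ∷ (p ++ᴾ r)

  -- The end point g stays free up to `≋`, so that a multiple of the initial f itself can be placed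
  -- there.
  path⇒composite : ∀ {Ps Q Q′} → Path Ps Q Q′ → ∀ f c → f ≋ c • F steps Q →
                   ∃[ c′ ] (∀ g → g ≋ c′ • F steps Q′ → composite Ps f g)
  path⇒composite []      f c f≋ = c , λ g g≋ → ≋-trans g≋ (≋-sym f≋)
  path⇒composite {Q′ = Q″} (_∷_ {Q′ = Q′} s p) f c f≋ with s f c f≋
  ... | c₁ , Pf with path⇒composite p (c₁ • F steps Q′) c₁ ≋-refl
  ... | c₂ , rest = c₂ , λ g g≋ → c₁ • F steps Q′ , Pf , rest g g≋

  queueOn : (Fin n → Fin n) → List (Fin n) → Queue n
  queueOn β = map λ z → γ z , β z

  queueOn-cong : ∀ {β β′} is → (∀ {z} → z ∈ is → β z ≡ β′ z) → queueOn β is ≡ queueOn β′ is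
  queueOn-cong is p = List.map-cong-local (All.tabulate λ {z} z∈ → ≡.cong (γ z ,_) (p z∈))

  module _ (j : Fin m) where

    open BasementExchange R q t t⁻¹ t⁻¹t≈1 fac fac-eq j
    open DemazureLusztig R j t t⁻¹ t⁻¹t≈1 using (a; b; Other; σ; _↦_; ↦-resp; ↦-•)

    swapped : (Fin n → Fin n) → Fin n → Fin n
    swapped β z = σ ⟨$⟩ʳ β z

    swapped-injective : ∀ {β} → Injective _≡_ _≡_ β → Injective _≡_ _≡_ (swapped β)
    swapped-injective inj e = inj (≡.trans (≡.sym (inverseˡ σ)) (≡.trans (≡.cong (σ ⟨$⟩ˡ_) e) (inverseˡ σ)))

    module _ {β : Fin n → Fin n} (inj : Injective _≡_ _≡_ β) {x y : Fin n} (βx≡a : β x ≡ a) (βy≡b : β y ≡ b) where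

      elsewhere : ∀ {z} → z ≢ x → z ≢ y → Other (β z)
      elsewhere z≢x z≢y = (λ e → z≢x (inj (≡.trans e (≡.sym βx≡a)))) , (λ e → z≢y (inj (≡.trans e (≡.sym βy≡b))))

      swapped-elsewhere : ∀ {z} → z ≢ x → z ≢ y → swapped β z ≡ β z
      swapped-elsewhere z≢x z≢y = let z≢a , z≢b = elsewhere z≢x z≢y in transpose-other z≢a z≢b

      swapped-x : swapped β x ≡ b
      swapped-x = ≡.trans (≡.cong (σ ⟨$⟩ʳ_) βx≡a) (transpose-left a b)

      swapped-y : swapped β y ≡ a
      swapped-y = ≡.trans (≡.cong (σ ⟨$⟩ʳ_) βy≡b) (transpose-right a b)

      none-queue : ∀ {is} → All (x ≢_) is → All (y ≢_) is → None (queueOn β is)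
      none-queue []        []        = []
      none-queue (x≢ ∷ xs) (y≢ ∷ ys) = elsewhere (≡.≢-sym x≢) (≡.≢-sym y≢) ∷ none-queue xs ys

      one-queue : ∀ {is} → Sorted is → All (x ≢_) is → y ∈ is → One (γ y) (queueOn β is) (queueOn (swapped β) is)
      one-queue {y ∷ is} (y< ∷ s) (_ ∷ x∉) (here ≡.refl) = ≡.subst₂ (One (γ y))
        (≡.cong (λ u → (γ y , u) ∷ queueOn β is) (≡.sym βy≡b))
        (≡.cong₂ (λ u l → (γ y , u) ∷ l) (≡.sym swapped-y)
          (queueOn-cong is λ z∈ → ≡.sym (swapped-elsewhere (≡.≢-sym (All.lookup x∉ z∈)) (≡.≢-sym (All.lookup y∉ z∈)))))
        (here (none-queue x∉ y∉))
        where
        y∉ : All (y ≢_) is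
        y∉ = All.map (λ { y<y ≡.refl → ℕ.<-irrefl ≡.refl y<y }) y<
      one-queue {z ∷ is} (z< ∷ s) (x≢z ∷ x∉) (there y∈) = ≡.subst (λ u → One (γ y) _ ((γ z , u) ∷ queueOn (swapped β) is))
        (≡.sym (swapped-elsewhere (≡.≢-sym x≢z) z≢y)) (there (elsewhere (≡.≢-sym x≢z) z≢y) (one-queue s x∉ y∈))
        where
        z≢y : z ≢ y
        z≢y ≡.refl = ℕ.<-irrefl ≡.refl (All.lookup z< y∈)

      -- Columns stand in the queue from left to right, so x < y puts a before b; sortedness also
      -- shows that each of the two columns occurs only once.
      two-queue : ∀ {is} → Sorted is → x Fin.< y → x ∈ is → y ∈ is → Two (γ x) (γ y) (queueOn β is) (queueOn (swapped β) is)
      two-queue (x< ∷ s) x<y (here ≡.refl) (here ≡.refl) = contradiction x<y (ℕ.<-irrefl ≡.refl)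
      two-queue {x ∷ is} (x< ∷ s) x<y (here ≡.refl) (there y∈) = ≡.subst₂ (Two (γ x) (γ y))
        (≡.cong (λ u → (γ x , u) ∷ queueOn β is) (≡.sym βx≡a)) (≡.cong (λ u → (γ x , u) ∷ queueOn (swapped β) is) (≡.sym swapped-x))
        (here (one-queue s (All.map (λ { x<x ≡.refl → ℕ.<-irrefl ≡.refl x<x }) x<) y∈))
      two-queue (y< ∷ s) x<y (there x∈) (here ≡.refl) = contradiction (All.lookup y< x∈) (ℕ.<-asym x<y)
      two-queue {z ∷ is} (z< ∷ s) x<y (there x∈) (there y∈) = ≡.subst (λ u → Two (γ x) (γ y) _ ((γ z , u) ∷ queueOn (swapped β) is))
        (≡.sym (swapped-elsewhere z≢x z≢y)) (there (elsewhere z≢x z≢y) (two-queue s x<y x∈ y∈))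
        where
        z≢x : z ≢ x
        z≢x ≡.refl = ℕ.<-irrefl ≡.refl (All.lookup z< x∈)
        z≢y : z ≢ y
        z≢y ≡.refl = ℕ.<-irrefl ≡.refl (All.lookup z< y∈)

      exchange⁺ : x Fin.< y → Maps (T^ Sign.+ j) (queue γ β) (queue γ (swapped β))
      exchange⁺ x<y f c f≋ = _ , ↦-resp (≋-sym f≋) (≋-sym (•-assoc c _ (F steps (queue γ (swapped β)))))
        (↦-• c (exchange₂ steps (two-queue sorted-allFin x<y (∈-allFin x) (∈-allFin y))))

    t⁻¹^ : ∀ k → t⁻¹ K.^ k K.* t K.^ k K.≈ K.1#
    t⁻¹^ zero    = K.*-identityˡ _
    t⁻¹^ (suc k) = K.trans (interchange t⁻¹ _ t _) (K.trans (K.*-cong t⁻¹t≈1 (t⁻¹^ k)) (K.*-identityˡ _))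
      where open CommutativeSemigroupProperties K.*-commutativeSemigroup using (interchange)

    -- With b before a, it is the exchanged queue that has a before b: T takes its F to t^e times
    -- the given one, and T⁻¹ is the converse relation.
    exchange⁻ : ∀ {β} → Injective _≡_ _≡_ β → ∀ {x y} → β x ≡ a → β y ≡ b → y Fin.< x →
                Maps (T^ Sign.- j) (queue γ β) (queue γ (swapped β))
    exchange⁻ {β} inj {x} {y} βx≡a βy≡b y<x f c f≋ = c K.* t⁻¹ K.^ e , ↦-resp
      (≋-sym (•-assoc c _ _))
      (≋-trans (•-cong K.refl (≋-trans (≋-sym (•-assoc _ _ (F steps Q))) (≋-trans (•-cong (t⁻¹^ e) ≋-refl) (1• (F steps Q))))) (≋-sym f≋))
      (↦-• c (↦-• (t⁻¹ K.^ e) (≡.subst (λ Q → F steps Q′ ↦ t K.^ e • F steps Q) Q≡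
        (exchange₂ steps (two-queue (swapped-injective inj) (swapped-y inj βx≡a βy≡b) (swapped-x inj βx≡a βy≡b)
          sorted-allFin y<x (∈-allFin y) (∈-allFin x))))))
      where
      Q Q′ : Queue n
      Q  = queue γ β
      Q′ = queue γ (swapped β)
      e : ℕ
      e = ascent (γ y) (γ x)
      Q≡ : queue γ (swapped (swapped β)) ≡ Q
      Q≡ = queueOn-cong (allFin n) λ {z} _ → involutive (β z)
        where
        involutive : ∀ u → σ ⟨$⟩ʳ (σ ⟨$⟩ʳ u) ≡ u
        involutive u = cases (u Fin.≟ a) (u Fin.≟ b)
          where
          cases : ∀ {u} → Dec (u ≡ a) → Dec (u ≡ b) → σ ⟨$⟩ʳ (σ ⟨$⟩ʳ u) ≡ u
          cases (yes ≡.refl) _            = ≡.trans (≡.cong (σ ⟨$⟩ʳ_) (transpose-left a b)) (transpose-right a b)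
          cases (no _)       (yes ≡.refl) = ≡.trans (≡.cong (σ ⟨$⟩ʳ_) (transpose-right a b)) (transpose-left a b)
          cases (no u≢a)     (no u≢b)     =
            ≡.trans (≡.cong (σ ⟨$⟩ʳ_) (transpose-other u≢a u≢b)) (transpose-other u≢a u≢b)

    swap-value : ∀ u → Swap (toℕ j) (toℕ u) (toℕ (σ ⟨$⟩ʳ u))
    swap-value u = cases (u Fin.≟ a) (u Fin.≟ b)
      where
      cases : ∀ {u} → Dec (u ≡ a) → Dec (u ≡ b) → Swap (toℕ j) (toℕ u) (toℕ (σ ⟨$⟩ʳ u))
      cases (yes ≡.refl) _            = ≡.subst₂ (Swap (toℕ j)) (≡.sym (Fin.toℕ-inject₁ j)) (≡.cong toℕ (≡.sym (transpose-left a b))) low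
      cases (no _)       (yes ≡.refl) = ≡.subst (Swap (toℕ j) (suc (toℕ j)))
        (≡.trans (≡.sym (Fin.toℕ-inject₁ j)) (≡.cong toℕ (≡.sym (transpose-right a b)))) high
      cases {u} (no u≢a) (no u≢b)     = ≡.subst (Swap (toℕ j) (toℕ u)) (≡.cong toℕ (≡.sym (transpose-other u≢a u≢b)))
        (other (λ e → u≢a (Fin.toℕ-injective (≡.trans e (≡.sym (Fin.toℕ-inject₁ j))))) (u≢b ∘ Fin.toℕ-injective))

  rotation : ∀ β → Maps (graph π) (queue γ β) (queue γ (rotate ∘ β))
  rotation β f c f≋ = c K.* s , (begin
    (c K.* s) • F steps Q′                    ≈⟨ •-assoc c s (F steps Q′) ⟩
    c • (s • F steps Q′)                      ≈⟨ •-cong K.refl (π-F steps Q′) ⟨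
    c • π (F steps (map (map₂ unrotate) Q′))  ≡⟨ ≡.cong (λ Q → c • π (F steps Q)) Q≡ ⟩
    c • π (F steps (queue γ β))               ≈⟨ π-• c (F steps (queue γ β)) ⟨
    π (c • F steps (queue γ β))               ≈⟨ π-cong f≋ ⟨
    π f                                       ∎)
    where
    open ≋-Reasoning
    Q′ : Queue n
    Q′ = queue γ (rotate ∘ β)
    s : K
    s = q⁻¹ K.^ bottomHeight Q′
    Q≡ : map (map₂ unrotate) Q′ ≡ queue γ β
    Q≡ = ≡.trans (≡.sym (List.map-∘ (allFin n))) (queueOn-cong (allFin n) λ {z} _ → unrotate-rotate (β z))

  scaling : ∀ s {Q Q′} → Q ≡ Q′ → Maps (graph (s •_)) Q Q′
  scaling s {Q} ≡.refl f c f≋ = s K.* c , ≋-trans (•-assoc s c (F steps Q)) (•-cong K.refl (≋-sym f≋))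

  module _ (τ : Permutation′ n) (i : Fin n) where

    T^ε : Fin m → Relation
    T^ε j = T^ (ε τ i j) j

    τ-injective : Injective _≡_ _≡_ (τ ⟨$⟩ʳ_)
    τ-injective e = ≡.trans (≡.sym (inverseˡ τ)) (≡.trans (≡.cong (τ ⟨$⟩ˡ_) e) (inverseˡ τ))

    record Basement (Position : ℕ → ℕ → Set) : Set where
      constructor basement
      field
        β         : Fin n → Fin n
        injective : Injective _≡_ _≡_ β
        position  : ∀ z → Position (toℕ (τ ⟨$⟩ʳ z)) (toℕ (β z))

    open Basement

    along : ∀ {js js′ Q Q′} → js ≡ js′ → Path (map T^ε js′) Q Q′ → Path (map T^ε js) Q Q′
    along ≡.refl p = p

    signed-exchange : ∀ j {β} → Injective _≡_ _≡_ β → ∀ {x y} → β x ≡ inject₁ j → β y ≡ suc j →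
      (x Fin.< y → ε τ i j ≡ Sign.+) → (y Fin.< x → ε τ i j ≡ Sign.-) →
      Maps (T^ε j) (queue γ β) (queue γ (swapped j β))
    signed-exchange j {β} inj {x} {y} βx βy pos neg with ℕ.<-cmp (toℕ x) (toℕ y)
    ... | tri< x<y _ _ = ≡.subst (λ s → Maps (T^ s j) (queue γ β) (queue γ (swapped j β))) (≡.sym (pos x<y)) (exchange⁺ j inj βx βy x<y)
    ... | tri> _ _ y<x = ≡.subst (λ s → Maps (T^ s j) (queue γ β) (queue γ (swapped j β))) (≡.sym (neg y<x)) (exchange⁻ j inj βx βy y<x)
    ... | tri≈ _ x≡y _ = contradiction
      (≡.trans (≡.sym (Fin.toℕ-inject₁ j)) (≡.cong toℕ (≡.trans (≡.sym βx) (≡.trans (≡.cong β (Fin.toℕ-injective x≡y)) βy))))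
      (≡.≢-sym ℕ.1+n≢n)

    ε-right : ∀ {j} → toℕ i ℕ.≤ toℕ j → ε τ i j ≡ (if does (inversion? τ i (suc j)) then Sign.- else Sign.+)
    ε-right {j} i≤j = ≡.cong (λ d → if d then (if does (inversion? τ i (suc j)) then Sign.- else Sign.+)
      else (if does (inversion? τ (inject₁ j) i) then Sign.+ else Sign.-)) (dec-true (toℕ i ℕ.≤? toℕ j) i≤j)

    ε-left : ∀ {j} → toℕ j ℕ.< toℕ i → ε τ i j ≡ (if does (inversion? τ (inject₁ j) i) then Sign.+ else Sign.-)
    ε-left {j} j<i = ≡.cong (λ d → if d then (if does (inversion? τ i (suc j)) then Sign.- else Sign.+)
      else (if does (inversion? τ (inject₁ j) i) then Sign.+ else Sign.-)) (dec-false (toℕ i ℕ.≤? toℕ j) (ℕ.<⇒≱ j<i))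

    rise : ∀ {k js} → Consecutive k js → (B : Basement (Rising (toℕ i) k)) →
      Σ[ B′ ∈ Basement (Rising (toℕ i) m) ]
        Path (map T^ε (filter (λ j → toℕ i ℕ.≤? toℕ j) js)) (queue γ (β B)) (queue γ (β B′))
    rise [] B = B , []
    rise {k} (_∷_ {j = j} {js} ≡.refl cs) B with toℕ i ℕ.≤? k
    ... | no  i≰k = let B′ , path = rise cs (basement (β B) (injective B) λ z → rising-idle (ℕ.≰⇒> i≰k) (position B z))
      in B′ , along (List.filter-reject (λ j → toℕ i ℕ.≤? toℕ j) i≰k) path
    ... | yes i≤k =
      let B′ , path = rise cs (basement (swapped j (β B)) (swapped-injective j (injective B))
                        λ z → rising-swap i≤k (position B z) (swap-value j (β B z)))
      in B′ , along (List.filter-accept (λ j → toℕ i ℕ.≤? toℕ j) i≤k)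
        (signed-exchange j (injective B) βx βy pos neg ∷ path)
      where
      x y : Fin n
      x = τ ⟨$⟩ˡ i
      y = τ ⟨$⟩ˡ suc j
      βx : β B x ≡ inject₁ j
      βx = Fin.toℕ-injective (≡.trans (rising-riser i≤k (≡.subst (λ v → Rising (toℕ i) k (toℕ v) (toℕ (β B x))) (inverseʳ τ) (position B x)))
        (≡.sym (Fin.toℕ-inject₁ j)))
      βy : β B y ≡ suc j
      βy = Fin.toℕ-injective (rising-next i≤k (≡.subst (λ v → Rising (toℕ i) k (toℕ v) (toℕ (β B y))) (inverseʳ τ) (position B y)))
      -- As x and y are the columns of i and j + 1 in τ itself, y < x is the inversion that ε tests
      -- for.
      pos : x Fin.< y → ε τ i j ≡ Sign.+
      pos x<y = ≡.trans (ε-right i≤k) (≡.cong (λ d → if d then Sign.- else Sign.+) (dec-false (inversion? τ i (suc j)) (ℕ.<-asym x<y)))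
      neg : y Fin.< x → ε τ i j ≡ Sign.-
      neg y<x = ≡.trans (ε-right i≤k) (≡.cong (λ d → if d then Sign.- else Sign.+) (dec-true (inversion? τ i (suc j)) y<x))

    return : ∀ {k js} → Consecutive k js → (B : Basement (Returning (toℕ i) k)) →
      Σ[ B′ ∈ Basement (Returning (toℕ i) m) ]
        Path (map T^ε (filter (λ j → toℕ j ℕ.<? toℕ i) js)) (queue γ (β B)) (queue γ (β B′))
    return [] B = B , []
    return {k} (_∷_ {j = j} {js} ≡.refl cs) B with k ℕ.<? toℕ i
    ... | no  k≮i = let B′ , path = return cs (basement (β B) (injective B) λ z → returning-idle (ℕ.≮⇒≥ k≮i) (position B z))
      in B′ , along (List.filter-reject (λ j → toℕ j ℕ.<? toℕ i) k≮i) path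
    ... | yes k<i =
      let B′ , path = return cs (basement (swapped j (β B)) (swapped-injective j (injective B))
                        λ z → returning-swap k<i (position B z) (swap-value j (β B z)))
      in B′ , along (List.filter-accept (λ j → toℕ j ℕ.<? toℕ i) k<i)
        (signed-exchange j (injective B) βx βy pos neg ∷ path)
      where
      x y : Fin n
      x = τ ⟨$⟩ˡ i
      y = τ ⟨$⟩ˡ inject₁ j
      βx : β B x ≡ inject₁ j
      βx = Fin.toℕ-injective (≡.trans (returning-riser k<i (≡.subst (λ v → Returning (toℕ i) k (toℕ v) (toℕ (β B x))) (inverseʳ τ) (position B x)))
        (≡.sym (Fin.toℕ-inject₁ j)))
      βy : β B y ≡ suc j
      βy = Fin.toℕ-injective (returning-next k<i (≡.subst (λ v → Returning (toℕ i) k v (toℕ (β B y)))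
        (≡.trans (≡.cong toℕ (inverseʳ τ)) (Fin.toℕ-inject₁ j)) (position B y)))
      -- Now x and y are the columns of i and j with j below i, so x < y is the inversion, and ε
      -- assigns it the sign +.
      pos : x Fin.< y → ε τ i j ≡ Sign.+
      pos x<y = ≡.trans (ε-left k<i) (≡.cong (λ d → if d then Sign.+ else Sign.-) (dec-true (inversion? τ (inject₁ j) i) x<y))
      neg : y Fin.< x → ε τ i j ≡ Sign.-
      neg y<x = ≡.trans (ε-left k<i) (≡.cong (λ d → if d then Sign.+ else Sign.-) (dec-false (inversion? τ (inject₁ j) i) (ℕ.<-asym y<x)))

    Y : K → List Relation
    Y s = map T^ε (filter (λ j → toℕ i ℕ.≤? toℕ j) (allFin m)) ++ [ graph π ] ++
          map T^ε (filter (λ j → toℕ j ℕ.<? toℕ i) (allFin m)) ++ [ graph (s •_) ]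

    Y-path : ∀ s → Path (Y s) (queue γ (τ ⟨$⟩ʳ_)) (queue γ (τ ⟨$⟩ʳ_))
    Y-path s =
      let B₁ , path₁ = rise (consecutive-allFin m) (basement (τ ⟨$⟩ʳ_) τ-injective λ z → rising-start _)
          B₂ , path₂ = return (consecutive-allFin m) (basement (rotate ∘ β B₁) (rotate-injective (injective B₁))
            λ z → rising-rotate i≤m (ℕ.≤-pred (Fin.toℕ<n (τ ⟨$⟩ʳ z))) (position B₁ z) (rotate-value (β B₁ z)))
          Q≡ = queueOn-cong (allFin n) λ {z} _ → Fin.toℕ-injective (returning-end i≤m (position B₂ z))
      in path₁ ++ᴾ (rotation (β B₁) ∷ (path₂ ++ᴾ (scaling s Q≡ ∷ [])))
      where
      i≤m : toℕ i ℕ.≤ m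
      i≤m = ℕ.≤-pred (Fin.toℕ<n i)
      rotate-injective : ∀ {β} → Injective _≡_ _≡_ β → Injective _≡_ _≡_ (rotate ∘ β)
      rotate-injective {β} inj {x} {y} e = inj (≡.trans (≡.sym (unrotate-rotate (β x))) (≡.trans (≡.cong unrotate e) (unrotate-rotate (β y))))

    Y-eigenfunction : ∀ s f → f ≋ F steps (queue γ (τ ⟨$⟩ʳ_)) → ∃[ c ] composite (Y s) f (c • f)
    Y-eigenfunction s f f≋F =
      let c , composes = path⇒composite (Y-path s) f K.1# (≋-trans f≋F (≋-sym (1• (F steps (queue γ (τ ⟨$⟩ʳ_))))))
      in c , composes (c • f) (•-cong K.refl f≋F)

open import Defs

-- Specialisation to ℚ(q,t)

module FractionIdentities {c ℓ} (D : CommutativeRing c ℓ)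
  (integral : NoZeroDivisors D) (1≉0 : Nontrivial D) where
  open CommutativeRing D
  open Fractions D integral 1≉0
  module Frac = CommutativeRing commutativeRingᶠ
  open Exp semiring using (_^_)
  open Exp Frac.semiring using () renaming (_^_ to _^ᶠ_)

  embed : Carrier → Fraction
  embed p = p / 1# ⟨ 1≉0 ⟩

  embed-* : ∀ p r → embed p *ᶠ embed r ≈ᶠ embed (p * r)
  embed-* p r .cross = trans (*-identityʳ _) (trans (sym (*-identityʳ _)) (*-congˡ (sym (*-identityʳ 1#))))

  embed-^ : ∀ p k → embed p ^ᶠ k ≈ᶠ embed (p ^ k)
  embed-^ p zero    = reflᶠ
  embed-^ p (suc k) = transᶠ (*ᶠ-cong {x = embed p} reflᶠ (embed-^ p k)) (embed-* p (p ^ k))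

  embed-1- : ∀ p → 1ᶠ +ᶠ -ᶠ embed p ≈ᶠ embed (1# + - p)
  embed-1- p .cross = trans (*-identityʳ _) (trans (+-cong (*-identityʳ _) (*-identityʳ _))
    (trans (sym (*-identityʳ _)) (*-congˡ (sym (*-identityʳ 1#)))))

  quotient-* : ∀ a b b≉0 → (a / b ⟨ b≉0 ⟩) *ᶠ embed b ≈ᶠ embed a
  quotient-* a b b≉0 .cross = trans (*-identityʳ _) (*-congˡ (sym (*-identityʳ b)))

  inverse-* : ∀ x (x≉0 : ¬ num x ≈ 0#) → (x ⁻¹⟨ x≉0 ⟩) *ᶠ x ≈ᶠ 1ᶠ
  inverse-* x x≉0 = transᶠ (*ᶠ-comm (x ⁻¹⟨ x≉0 ⟩) x) (*ᶠ-inverseʳ x x≉0)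

  module _ (q t : Carrier) where

    -- The fraction satisfies f(1 - q^h t^(k+1)) = 1 - t, and `clear-denominator` removes the
    -- denominator.
    factor-identity : ∀ h k (d≉0 : ¬ 1# + - (q ^ h * t ^ suc k) ≈ 0#) →
      let f = (1# + - t) / (1# + - (q ^ h * t ^ suc k)) ⟨ d≉0 ⟩ in
      (embed q ^ᶠ h *ᶠ embed t ^ᶠ k) *ᶠ f *ᶠ embed t +ᶠ 1ᶠ ≈ᶠ f +ᶠ embed t
    factor-identity h k d≉0 = clear-denominator {f} {embed qt} {embed q ^ᶠ h *ᶠ embed t ^ᶠ k} {embed t}
      (transᶠ (symᶠ (embed-* (q ^ h) (t ^ suc k)))
        (transᶠ (*ᶠ-cong {x = embed (q ^ h)} (symᶠ (embed-^ q h)) (symᶠ (embed-^ t (suc k))))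
          (transᶠ (*ᶠ-cong {x = embed q ^ᶠ h} reflᶠ (*ᶠ-comm (embed t) (embed t ^ᶠ k)))
            (symᶠ (*ᶠ-assoc (embed q ^ᶠ h) (embed t ^ᶠ k) (embed t))))))
      (transᶠ (*ᶠ-cong {x = f} reflᶠ (embed-1- qt))
        (transᶠ (quotient-* (1# + - t) (1# + - qt) d≉0) (symᶠ (embed-1- t))))
      where
      open RingIdentities commutativeRingᶠ using (clear-denominator)
      qt : Carrier
      qt = q ^ h * t ^ suc k
      f : Fraction
      f = (1# + - t) / (1# + - qt) ⟨ d≉0 ⟩

module ℚFrac = FractionIdentities ℚ[q,t]
  (ℚ[q][t].noZeroDivisors (ℚ[q].noZeroDivisors ℚ-noZeroDivisors))
  (ℚ[q][t].nontrivial ℚ[q]-nontrivial)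

t⁻¹ : K
t⁻¹ = t ℚ⟨q,t⟩.⁻¹⟨ ℚ[q][t].X-nonzero ℚ[q]-nontrivial ⟩

t⁻¹t≈1 : t⁻¹ K.* t K.≈ K.1#
t⁻¹t≈1 = ℚFrac.inverse-* t (ℚ[q][t].X-nonzero ℚ[q]-nontrivial)

qq⁻¹≈1 : q K.* q⁻¹ K.≈ K.1#
qq⁻¹≈1 = ℚ⟨q,t⟩.*ᶠ-inverseʳ q q-nonzero

fac : ℕ → ℕ → K
fac h k = [1-t]/[1-q^ h t^1+ k ]

fac-eq : ∀ h k → q K.^ h K.* t K.^ k K.* fac h k K.* t K.+ K.1# K.≈ fac h k K.+ t
fac-eq h k = ℚFrac.factor-identity qᴾ tᴾ h k (1-qᵃt¹⁺ᵇ-nonzero h k)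

module Generic = LaurentPolynomials K-commutativeRing
open Generic using (_≋_; at)

coeff-generic : ∀ {n} (f : Laurent n) e → Generic.coeff f e ≡ coeff f e
coeff-generic []            e = ≡.refl
coeff-generic ((c , e′) ∷ f) e = ≡.cong (λ r → if does (e′ ≟ᵉ e) then c K.+ r else r) (coeff-generic f e)

≋⇒≈ᴸ : ∀ {n} (f g : Laurent n) → f ≋ g → f ≈ᴸ g
≋⇒≈ᴸ f g p e = ≡.subst₂ K._≈_ (coeff-generic f e) (coeff-generic g e) (p .at e)

module _ {m : ℕ} where

  open DividedDifference K-commutativeRing {m} using (↦-graph)
  open Rotation K-commutativeRing q q⁻¹ t qq⁻¹≈1 fac m using () renaming (π to πᴳ)

  ↦⇒T : ∀ j {f g : Laurent (suc m)} → DemazureLusztig._↦_ K-commutativeRing j t t⁻¹ t⁻¹t≈1 f g → T j f g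
  ↦⇒T j {f} {g} F = let h , quotient , value = ↦-graph j t t⁻¹ t⁻¹t≈1 F in
    h , ≋⇒≈ᴸ ((1ᴸ -ᴸ x inject₁ j /x suc j) *ᴸ h) (f -ᴸ s j f) quotient
      , ≋⇒≈ᴸ g (t • s j f +ᴸ (t K.- K.1#) • h) value

  open Rotation K-commutativeRing q q⁻¹ t qq⁻¹≈1 fac m using () renaming (q^ℤ_ to q^ℤᴳ_)

  q^ℤ-generic : ∀ z → q^ℤ z ≡ q^ℤᴳ z
  q^ℤ-generic (ℤ.+ k)    = ≡.refl
  q^ℤ-generic ℤ.-[1+ k ] = ≡.refl

  *-congʳ-≡ : ∀ c {x y} → x ≡ y → c K.* y ≡ c K.* x
  *-congʳ-≡ c ≡.refl = ≡.refl

  -- The exponents `e ∘ unrotate` and those in `π` come from different case distinctions and are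
  -- compared value by value.
  π-pointwise : ∀ f → Pointwise (λ (c , e) (c′ , e′) → c ≡ c′ × e ≗ e′) (πᴳ f) (π f)
  π-pointwise []            = []
  π-pointwise ((c , e) ∷ f) =
    (*-congʳ-≡ c (q^ℤ-generic (ℤ.- e (fromℕ m))) , λ { zero → ≡.refl ; (suc k) → ≡.refl })
    ∷ π-pointwise f

  π-generic : ∀ (f g : Laurent (suc m)) → g ≋ πᴳ f → g ≈ᴸ π f
  π-generic f g p = ≋⇒≈ᴸ g (π f) g≋πf
    where
    πᴳf≋πf : πᴳ f ≋ π f
    πᴳf≋πf = Generic.≋-pointwise (π-pointwise f)
    g≋πf : g ≋ π f
    g≋πf = Generic.≋-trans p πᴳf≋πf

module _ {m : ℕ} (γ : WeakComposition (suc m)) (τ : Permutation′ (suc m)) where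

  open LocalWeights K-commutativeRing q t fac γ τ using () renaming (E to Eᴳ)
  open RowReading K-commutativeRing q t fac γ τ using (steps; E≋F)
  open BasementPath K-commutativeRing q q⁻¹ t t⁻¹ qq⁻¹≈1 t⁻¹t≈1 fac fac-eq γ steps
    using (Y-eigenfunction) renaming (Relation to Relationᴳ; Y to Yᴳ; composite to compositeᴳ; T^ to T^ᴳ; graph to graphᴳ)

  _⇒_ : Relationᴳ → Operator (suc m) → Set
  P ⇒ P′ = ∀ {f g : Laurent (suc m)} → P f g → P′ f g

  -- A composite is existential in the intermediate polynomials, so these can be kept when each
  -- factor is replaced by a larger relation.
  composite-mono : ∀ {Ps Ps′} → Pointwise _⇒_ Ps Ps′ → ∀ {f g : Laurent (suc m)} → compositeᴳ Ps f g → composite Ps′ f g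
  composite-mono []       {f} {g} p    = ≋⇒≈ᴸ g f p
  composite-mono (i ∷ is) {f} {g} (h , p , ps) = h , i {f} {h} p , composite-mono is {h} {g} ps

  T^ᴳ⇒T^ : ∀ s j → T^ᴳ s j ⇒ T^ s j
  T^ᴳ⇒T^ Sign.+ j {f} {g} = ↦⇒T j {f} {g}
  T^ᴳ⇒T^ Sign.- j {f} {g} = ↦⇒T j {g} {f}

  signed : ∀ i js → Pointwise _⇒_ (map (λ j → T^ᴳ (ε τ i j) j) js) (map (λ j → T^ (ε τ i j) j) js)
  signed i []       = []
  signed i (j ∷ js) = (λ {f} {g} → T^ᴳ⇒T^ (ε τ i j) j {f} {g}) ∷ signed i js

  operators : ∀ i → Pointwise _⇒_ (Yᴳ τ i (t K.^ #ε⁻ τ i)) (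
    map (λ j → T^ (ε τ i j) j) (filter (λ j → toℕ i ℕ.≤? toℕ j) (allFin m)) ++ [ graph π ] ++
    map (λ j → T^ (ε τ i j) j) (filter (λ j → toℕ j ℕ.<? toℕ i) (allFin m)) ++ [ graph (t K.^ #ε⁻ τ i •_) ])
  operators i = Pointwise.++⁺ (signed i _)
    ((λ {f} {g} → π-generic f g) ∷ Pointwise.++⁺ (signed i _) ((λ {f} {g} → ≋⇒≈ᴸ g (t K.^ #ε⁻ τ i • f)) ∷ []))

  eigenfunction : ∀ i → ∃[ c ] Y τ i (E γ τ) (c • E γ τ)
  -- Over ℚ(q,t) the generic `Eᴳ` unfolds to `E γ τ`.
  eigenfunction i = let c , composes = Y-eigenfunction τ i (t K.^ #ε⁻ τ i) Eᴳ E≋F in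
    c , composite-mono (operators i) {Eᴳ} {c • Eᴳ} composes

proposition4p4p8 : (m : ℕ) → 3 ≤ suc m →
    (γ : WeakComposition (suc m)) (τ : Permutation′ (suc m)) (i : Fin (suc m)) →
    ∃[ c ] Y τ i (E γ τ) (c • E γ τ)
proposition4p4p8 m _ γ τ i = eigenfunction γ τ i
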